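{- Let $G$ be a finite, simple, connected $K_{1,4}$-free graph and let $k\geq 3$ be an integer. If $\sigma_{2k+3}(G) \geq |G| - k + 1$, then $G$ has a spanning tree whose reducible stem has at most $k$ leaves.
   Context: All graphs are finite and simple; $|G|$ denotes the number of vertices of $G$ and $\deg_G(v)$ the degree of $v$ in $G$. A graph is $K_{1,4}$-free if it contains no induced subgraph isomorphic to the star $K_{1,4}$. For an integer $p\geq 2$, $\sigma_p(G)$ is the minimum of $\sum_{x\in S}\deg_G(x)$ over all independent sets $S\subseteq V(G)$ with $|S|=p$; by convention $\sigma_p(G)=+\infty$ if $G$ has no independent set of size $p$. For a tree $T$, a leaf is a vertex of degree one and a branch vertex is a vertex of degree at least three. For a leaf $x$ of $T$, let $y_x$ be the branch vertex of $T$ nearest to $x$, and let $P_T[x,y_x)$ be the path in $T$ from $x$ to $y_x$ not including $y_x$ (the leaf-branch path incident to $x$). The reducible stem of $T$ is the subtree obtained from $T$ by deleting $P_T[x,y_x)$ for every leaf $x$ of $T$; equivalently, it is the smallest subtree of $T$ containing all branch vertices of $T$. Its leaves are its vertices of degree one (in the reducible stem). -}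

module Defs where

open import Data.Nat using (ℕ; _+_; _≤_)
open import Data.Bool using (Bool; true; false; if_then_else_)
open import Data.Fin using (Fin)
open import Data.List using (List; []; _∷_; length; map; allFin)
open import Data.Nat.ListAction using (sum)
open import Data.List.Membership.Propositional using (_∈_)
open import Data.List.Relation.Unary.Unique.Propositional using (Unique)
open import Data.Product using (Σ; ∃; ∃-syntax; _×_)
open import Relation.Binary.PropositionalEquality using (_≡_)
open import Relation.Nullary using (¬_)

record Graph (n : ℕ) : Set where
  field
    adj    : Fin n → Fin n → Bool
    sym    : ∀ u v → adj u v ≡ adj v u
    irrefl : ∀ v → adj v v ≡ false
open Graph public

Adj : ∀ {n} → Graph n → Fin n → Fin n → Set
Adj G u v = adj G u v ≡ true

deg : ∀ {n} → Graph n → Fin n → ℕ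
deg {n} G v = sum (map (λ u → if adj G v u then 1 else 0) (allFin n))

data Walk {n : ℕ} (G : Graph n) : Fin n → Fin n → List (Fin n) → Set where
  here : ∀ u → Walk G u u (u ∷ [])
  step : ∀ {u v w vs} → Adj G u v → Walk G v w vs → Walk G u w (u ∷ vs)

Path : ∀ {n} → Graph n → Fin n → Fin n → List (Fin n) → Set
Path G u w vs = Walk G u w vs × Unique vs

Connected : ∀ {n} → Graph n → Set
Connected {n} G = ∀ (u v : Fin n) → ∃[ vs ] Walk G u v vs

HasCycle : ∀ {n} → Graph n → Set
HasCycle {n} G = ∃[ u ] ∃[ w ] ∃[ vs ] (Path G u w vs × 3 ≤ length vs × Adj G w u)

Acyclic : ∀ {n} → Graph n → Set
Acyclic G = ¬ HasCycle G

IsTree : ∀ {n} → Graph n → Set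
IsTree G = Connected G × Acyclic G

SubgraphOf : ∀ {n} → Graph n → Graph n → Set
SubgraphOf T G = ∀ u v → Adj T u v → Adj G u v

IsSpanningTree : ∀ {n} → Graph n → Graph n → Set
IsSpanningTree T G = SubgraphOf T G × IsTree T

K14Free : ∀ {n} → Graph n → Set
K14Free {n} G = ∀ (c : Fin n) (xs : List (Fin n)) → length xs ≡ 4 → Unique xs →
  (∀ x → x ∈ xs → Adj G c x) → ¬ (∀ x y → x ∈ xs → y ∈ xs → adj G x y ≡ false)

IndependentOfSize : ∀ {n} → Graph n → ℕ → List (Fin n) → Set
IndependentOfSize G p S =
  length S ≡ p × Unique S × (∀ x y → x ∈ S → y ∈ S → adj G x y ≡ false)

degSum : ∀ {n} → Graph n → List (Fin n) → ℕ
degSum G S = sum (map (deg G) S)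

-- σ_p(G) ≥ m  (with m = a - b written as: for all independent p-sets S, degSum + b ≥ a).
-- Vacuous when G has no independent p-set (σ_p = +∞ convention).
SigmaAtLeast : ∀ {n} → Graph n → ℕ → (a b : ℕ) → Set
SigmaAtLeast {n} G p a b = ∀ (S : List (Fin n)) → IndependentOfSize G p S → a ≤ degSum G S + b

Branch : ∀ {n} → Graph n → Fin n → Set
Branch T v = 3 ≤ deg T v

-- vertex of the reducible stem of tree T: lies on the T-path between two branch
-- vertices (the smallest subtree containing all branch vertices)
InStem : ∀ {n} → Graph n → Fin n → Set
InStem {n} T v = ∃[ b₁ ] ∃[ b₂ ] ∃[ vs ]
  (Branch T b₁ × Branch T b₂ × Path T b₁ b₂ vs × v ∈ vs)

StemLeaf : ∀ {n} → Graph n → Fin n → Set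
StemLeaf {n} T v = InStem T v × ∃[ u ] (Adj T v u × InStem T u ×
  (∀ w → Adj T v w → InStem T w → w ≡ u))

StemLeavesAtMost : ∀ {n} → Graph n → ℕ → Set
StemLeavesAtMost {n} T k = ∃[ L ] (length L ≤ k × (∀ v → StemLeaf T v → v ∈ L))

{-# OPTIONS --safe #-}

-- Suppose that the stem of every spanning tree has more than k leaves. Each stem leaf carries at least two
-- leaf-branch paths, so every spanning tree has at least 2k + 2 leaves. Take a spanning tree T with the fewest
-- leaves and, among these, with the largest stem. Edge exchanges show that the leaves of T are independent, and
-- together with K₁,₄-freeness that a vertex of the stem sees at most one leaf, unless it sees exactly two leaves,
-- both on leaf-branch paths hanging from it. On a leaf-branch path P the leaves have at most |P| − 1 neighbours
-- in total, once the neighbours of its own leaf are shifted by one step.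
-- If T has at least 2k + 3 leaves, then 2k + 3 of them have degree sum at most n − k − 2.
-- If T has 2k + 2 leaves, then every leaf-branch path hangs from a stem leaf, for otherwise some tree with as few
-- leaves would have at most k stem leaves. Let s be a branch vertex of the largest possible degree that is not a
-- stem leaf. Exchanges that would hang a leaf-branch path from s show that the leaves together with s are
-- independent, and that their degree sum is at most n − k. Here k ≥ 3 gives s a fourth tree neighbour when three
-- stem leaves hang next to it, and the star at s is excluded.

module Submission where

open import Defs
open import Data.Nat using (ℕ; _+_; _*_; _≤_)
open import Data.Product using (∃-syntax; _×_)
open import Data.Nat as ℕ using (zero; suc; _∸_; _<_; z≤n; s≤s; _≤?_)
open import Data.Nat.Properties hiding (_≟_)
open import Data.Nat.Tactic.RingSolver using (solve-∀)
import Data.Nat.ListAction as ListAction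
open import Algebra.Properties.CommutativeMonoid.Sum +-0-commutativeMonoid
  using (sum; sum-cong-≗; ∑-distrib-+; ∑-comm; sum-replicate-zero)
open import Data.Bool using (Bool; true; false; if_then_else_; not; _∧_; _∨_; _xor_)
open import Data.Bool.Properties using () renaming (_≟_ to _≟ᵇ_)
open import Data.Fin using (Fin; zero; suc)
open import Data.Fin.Properties using (_≟_; any?; all?)
open import Data.List as List using (List; []; _∷_; length)
open import Data.List.Properties using (map-tabulate)
open import Data.List.Membership.Propositional using (_∈_)
open import Data.List.Membership.Propositional.Properties using (∈-filter⁻; ∈-filter⁺; ∈-allFin)
import Data.List.Membership.DecPropositional as DecMembership
open import Data.List.Relation.Unary.Any using (here; there)
open import Data.List.Relation.Unary.All as All using (All; []; _∷_)
open import Data.List.Relation.Unary.AllPairs using ([]; _∷_)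
open import Data.List.Relation.Unary.Unique.Propositional using (Unique)
import Data.List.Relation.Unary.Unique.Propositional.Properties as Unique
open import Data.Vec using (Vec; []; _∷_; lookup; tabulate)
open import Data.Vec.Properties using (lookup∘tabulate)
open import Data.Product using (Σ; ∃; _,_; proj₁; proj₂)
open import Data.Sum using (_⊎_; inj₁; inj₂; [_,_]′)
open import Data.Empty using (⊥; ⊥-elim)
open import Function using (_∘_; id)
open import Relation.Binary.PropositionalEquality as ≡ using (_≡_; _≢_; refl; trans; cong; cong₂; subst; subst₂)
open import Relation.Nullary using (¬_; Dec; yes; no; contradiction; does)
open import Relation.Nullary.Decidable
  using (_×-dec_; _⊎-dec_; _→-dec_; ¬?; map′; dec-true; dec-false; decidable-stable; ¬¬-excluded-middle)

-- Counting over Fin n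

-- Most non-adjacencies come from one source. An exchange that does not increase the number of
-- leaves yields another extremal tree, so facts about leaves extend to every vertex that some
-- exchange turns into a leaf: such a vertex sees no other leaf and, in the tight case, not the hub
-- `s`. This is how the independent neighbours of an induced star are found. Paths are awkward to
-- follow through exchanges. They are replaced by two-valued functions on the vertices that are
-- constant along all edges but one, or along all edges that avoid one vertex; connectedness then
-- says that a function constant along every edge is constant. With only `2k + 2` leaves the hub `s`
-- is the missing element of the independent set, and a stem vertex may see two leaves and `s`. The
-- excess is paid, by an injection with at most two exceptions, by stem vertices that see nothing.
-- Those two exceptions use up the whole slack of the bound `n - k`.

T≢F : {b : Bool} → b ≡ true → b ≡ false → ⊥
T≢F refl ()

¬T→F : {b : Bool} → ¬ (b ≡ true) → b ≡ false
¬T→F {true}  h = ⊥-elim (h refl)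
¬T→F {false} h = refl

¬F→T : {b : Bool} → ¬ (b ≡ false) → b ≡ true
¬F→T {true}  h = refl
¬F→T {false} h = ⊥-elim (h refl)

bool : (b : Bool) → (b ≡ true) ⊎ (b ≡ false)
bool true  = inj₁ refl
bool false = inj₂ refl

∧-T : {a b : Bool} → a ≡ true → b ≡ true → a ∧ b ≡ true
∧-T refl refl = refl

∧-T₁ : {a b : Bool} → a ∧ b ≡ true → a ≡ true
∧-T₁ {true} _ = refl

∧-T₂ : {a b : Bool} → a ∧ b ≡ true → b ≡ true
∧-T₂ {true} h = h

does⇒ : {A : Set} (d : Dec A) → does d ≡ true → A
does⇒ (yes a) _ = a

≤-stable : ∀ {a b} → ¬ ¬ (a ≤ b) → a ≤ b
≤-stable {a} {b} = decidable-stable (a ≤? b)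

ind : Bool → ℕ
ind b = if b then 1 else 0

ind≤1 : ∀ b → ind b ≤ 1
ind≤1 true  = ≤-refl
ind≤1 false = z≤n

private variable n m : ℕ

_∖_ : (Fin n → Bool) → Fin n → Fin n → Bool
(P ∖ a) v = P v ∧ not (does (v ≟ a))

opaque
  cnt : (Fin n → Bool) → ℕ
  cnt P = sum (λ i → ind (P i))

  cnt-sum : (P : Fin n → Bool) → cnt P ≡ sum (λ i → ind (P i))
  cnt-sum P = refl

δ : Fin n → Fin n → ℕ
δ v a = ind (does (v ≟ a))

δ-same : (v : Fin n) → δ v v ≡ 1
δ-same v = cong ind (dec-true (v ≟ v) refl)

δ-diff : {v a : Fin n} → v ≢ a → δ v a ≡ 0
δ-diff {v = v} {a} h = cong ind (dec-false (v ≟ a) h)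

sum-mono : {f g : Fin n → ℕ} → (∀ i → f i ≤ g i) → sum f ≤ sum g
sum-mono {zero}  h = z≤n
sum-mono {suc n} h = +-mono-≤ (h zero) (sum-mono (h ∘ suc))

sum-zero : {f : Fin n → ℕ} → (∀ i → f i ≡ 0) → sum f ≡ 0
sum-zero {n} h = trans (sum-cong-≗ h) (sum-replicate-zero n)

does-suc : (v a : Fin n) → does (suc v ≟ suc a) ≡ does (v ≟ a)
does-suc v a with v ≟ a
... | yes refl = refl
... | no _     = refl

sum-δ : (a : Fin n) → sum (λ v → δ v a) ≡ 1
sum-δ {suc n} zero = cong suc (sum-zero {n} {λ i → δ (suc i) zero} (λ i → refl))
sum-δ (suc a) = trans (sum-cong-≗ (λ i → cong ind (does-suc i a))) (sum-δ a)

sum-const1 : ∀ n → sum {n} (λ _ → 1) ≡ n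
sum-const1 zero    = refl
sum-const1 (suc n) = cong suc (sum-const1 n)

opaque
  unfolding cnt

  cnt-cong : {P Q : Fin n → Bool} → (∀ v → P v ≡ Q v) → cnt P ≡ cnt Q
  cnt-cong h = sum-cong-≗ (cong ind ∘ h)

  cnt-mono : {P Q : Fin n → Bool} → (∀ v → P v ≡ true → Q v ≡ true) → cnt P ≤ cnt Q
  cnt-mono {P = P} {Q} h = sum-mono λ v → lem (P v) (Q v) (h v)
    where lem : ∀ a b → (a ≡ true → b ≡ true) → ind a ≤ ind b
          lem true  b h rewrite h refl = ≤-refl
          lem false b h = z≤n

  cnt≤n : (P : Fin n → Bool) → cnt P ≤ n
  cnt≤n {n} P = subst (cnt P ≤_) (sum-const1 n) (sum-mono (ind≤1 ∘ P))

  cnt-not : (P : Fin n → Bool) → cnt P + cnt (not ∘ P) ≡ n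
  cnt-not {n} P = trans (≡.sym (∑-distrib-+ (ind ∘ P) (ind ∘ not ∘ P)))
                        (trans (sum-cong-≗ (λ v → lem (P v))) (sum-const1 n))
    where lem : ∀ b → ind b + ind (not b) ≡ 1
          lem true  = refl
          lem false = refl

  cnt-remove : (P : Fin n → Bool) (a : Fin n) → P a ≡ true → cnt P ≡ suc (cnt (P ∖ a))
  cnt-remove P a pa = begin
    cnt P                              ≡⟨ sum-cong-≗ lem ⟩
    sum (λ v → δ v a + ind ((P ∖ a) v)) ≡⟨ ∑-distrib-+ (λ v → δ v a) (λ v → ind ((P ∖ a) v)) ⟩
    sum (λ v → δ v a) + cnt (P ∖ a)    ≡⟨ cong (_+ cnt (P ∖ a)) (sum-δ a) ⟩
    suc (cnt (P ∖ a))                  ∎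
    where
    open ≡.≡-Reasoning
    lem : ∀ v → ind (P v) ≡ δ v a + ind ((P ∖ a) v)
    lem v with v ≟ a
    ... | yes refl rewrite pa = refl
    ... | no _ with P v
    ...   | true  = refl
    ...   | false = refl

∖-intro : (P : Fin n → Bool) {a v : Fin n} → P v ≡ true → v ≢ a → (P ∖ a) v ≡ true
∖-intro P {a} {v} pv v≢a rewrite pv | dec-false (v ≟ a) v≢a = refl

∖-elim : (P : Fin n → Bool) {a v : Fin n} → (P ∖ a) v ≡ true → P v ≡ true × v ≢ a
∖-elim P {a} {v} h with v ≟ a
... | yes _  = ⊥-elim (T≢F (∧-T₂ {P v} h) refl)
... | no v≢a = ∧-T₁ h , v≢a

cnt-pick : (P : Fin n → Bool) → 1 ≤ cnt P → ∃[ a ] P a ≡ true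
cnt-pick P h with any? (λ a → P a ≟ᵇ true)
... | yes r = r
... | no ¬r = ⊥-elim (<-irrefl refl (subst (1 ≤_) (trans (cnt-sum P) (sum-zero λ v → cong ind (¬T→F λ p → ¬r (v , p)))) h))

cnt-pick-other : (P : Fin n → Bool) → 2 ≤ cnt P → ∀ a → ∃[ b ] (P b ≡ true × b ≢ a)
cnt-pick-other P h a with bool (P a)
... | inj₁ pa with cnt-pick (P ∖ a) (≤-pred (subst (2 ≤_) (cnt-remove P a pa) h))
...   | b , pb = b , ∖-elim P pb
cnt-pick-other P h a | inj₂ pa with cnt-pick P (≤-trans (s≤s z≤n) h)
...   | b , pb = b , pb , λ { refl → T≢F pb pa }

cnt-pick2 : (P : Fin n → Bool) → 2 ≤ cnt P → ∃[ a ] ∃[ b ] (P a ≡ true × P b ≡ true × b ≢ a)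
cnt-pick2 P h with cnt-pick P (≤-trans (s≤s z≤n) h)
... | a , pa with cnt-pick-other P h a
...   | b , pb , b≢a = a , b , pa , pb , b≢a

cnt-third : (P : Fin n → Bool) → 3 ≤ cnt P → ∀ a b → ∃[ c ] (P c ≡ true × c ≢ a × c ≢ b)
cnt-third P h a b with bool (P a)
... | inj₁ pa with cnt-pick-other (P ∖ a) (≤-pred (subst (3 ≤_) (cnt-remove P a pa) h)) b
...   | c , pc , c≢b with ∖-elim P pc
...     | pc′ , c≢a = c , pc′ , c≢a , c≢b
cnt-third P h a b | inj₂ pa with cnt-pick-other P (≤-trans (s≤s (s≤s z≤n)) h) b
...   | c , pc , c≢b = c , pc , (λ { refl → T≢F pc pa }) , c≢b

cnt-fourth : (P : Fin n → Bool) → 4 ≤ cnt P → ∀ a b c →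
  ∃[ d ] (P d ≡ true × d ≢ a × d ≢ b × d ≢ c)
cnt-fourth P h a b c with bool (P a)
... | inj₁ pa with cnt-third (P ∖ a) (≤-pred (subst (4 ≤_) (cnt-remove P a pa) h)) b c
...   | d , pd , d≢b , d≢c with ∖-elim P pd
...     | pd′ , d≢a = d , pd′ , d≢a , d≢b , d≢c
cnt-fourth P h a b c | inj₂ pa with cnt-third P (≤-trans (s≤s (s≤s (s≤s z≤n))) h) b c
...   | d , pd , d≢b , d≢c = d , pd , (λ { refl → T≢F pd pa }) , d≢b , d≢c

cnt≥1 : (P : Fin n → Bool) {a : Fin n} → P a ≡ true → 1 ≤ cnt P
cnt≥1 P {a} pa = subst (1 ≤_) (≡.sym (cnt-remove P a pa)) (s≤s z≤n)

cnt≥2 : (P : Fin n → Bool) {a b : Fin n} → P a ≡ true → P b ≡ true → b ≢ a → 2 ≤ cnt P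
cnt≥2 P {a} pa pb b≢a =
  subst (2 ≤_) (≡.sym (cnt-remove P a pa)) (s≤s (cnt≥1 (P ∖ a) (∖-intro P pb b≢a)))

cnt≥3 : (P : Fin n → Bool) {a b c : Fin n} → P a ≡ true → P b ≡ true → P c ≡ true →
  b ≢ a → c ≢ a → c ≢ b → 3 ≤ cnt P
cnt≥3 P {a} pa pb pc b≢a c≢a c≢b =
  subst (3 ≤_) (≡.sym (cnt-remove P a pa))
    (s≤s (cnt≥2 (P ∖ a) (∖-intro P pb b≢a) (∖-intro P pc c≢a) c≢b))

cnt≥4 : (P : Fin n → Bool) {a b c d : Fin n} → P a ≡ true → P b ≡ true → P c ≡ true → P d ≡ true →
  b ≢ a → c ≢ a → d ≢ a → c ≢ b → d ≢ b → d ≢ c → 4 ≤ cnt P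
cnt≥4 P {a} pa pb pc pd b≢a c≢a d≢a c≢b d≢b d≢c =
  subst (4 ≤_) (≡.sym (cnt-remove P a pa))
    (s≤s (cnt≥3 (P ∖ a) (∖-intro P pb b≢a) (∖-intro P pc c≢a) (∖-intro P pd d≢a) c≢b d≢b d≢c))

cnt-pick3 : (P : Fin n → Bool) → 3 ≤ cnt P →
  ∃[ a ] ∃[ b ] ∃[ c ] (P a ≡ true × P b ≡ true × P c ≡ true × a ≢ b × a ≢ c × b ≢ c)
cnt-pick3 P h with cnt-pick2 P (≤-trans (s≤s (s≤s z≤n)) h)
... | a , b , pa , pb , b≢a with cnt-third P h a b
...   | c , pc , c≢a , c≢b = a , b , c , pa , pb , pc , b≢a ∘ ≡.sym , c≢a ∘ ≡.sym , c≢b ∘ ≡.sym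

cnt≤ind : (Q : Fin n → Bool) {b : Bool} → (∀ {w} → Q w ≡ true → b ≡ true) →
  (∀ {w w′} → Q w ≡ true → Q w′ ≡ true → w ≡ w′) → cnt Q ≤ ind b
cnt≤ind Q {true} h u with cnt Q ≤? 1
... | yes le = le
... | no ¬le with cnt-pick2 Q (≰⇒> ¬le)
...   | a , b , qa , qb , b≢a = ⊥-elim (b≢a (u qb qa))
cnt≤ind Q {false} h u with cnt Q ≤? 0
... | yes le = le
... | no ¬le with cnt-pick Q (≰⇒> ¬le)
...   | a , qa = ⊥-elim (T≢F (h qa) refl)

cnt-split : (P Q : Fin n → Bool) → cnt P ≡ cnt (λ v → P v ∧ Q v) + cnt (λ v → P v ∧ not (Q v))
cnt-split P Q = trans (cnt-sum P) (trans (sum-cong-≗ (λ v → lem (P v) (Q v)))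
  (trans (∑-distrib-+ (λ v → ind (P v ∧ Q v)) (λ v → ind (P v ∧ not (Q v)))) (≡.sym (cong₂ _+_ (cnt-sum _) (cnt-sum _)))))
  where
  lem : ∀ a b → ind a ≡ ind (a ∧ b) + ind (a ∧ not b)
  lem true  true  = refl
  lem true  false = refl
  lem false b     = refl

not-T : {b : Bool} → not b ≡ true → b ≡ false
not-T {false} _ = refl

-- The incidences `ω` are summed by rows, where each marked row holds at least two, and by columns,
-- where each column holds at most one.
double-count : (ω : Fin n → Fin m → Bool) (e : Fin n → Bool) (P : Fin m → Bool) → (∀ {w} → e w ≡ true → 2 ≤ cnt (ω w)) →
  (∀ {w u} → ω w u ≡ true → P u ≡ true) → (∀ {w w′ u} → ω w u ≡ true → ω w′ u ≡ true → w ≡ w′) → cnt e + cnt e ≤ cnt P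
double-count ω e P two sub unique = begin
  cnt e + cnt e                       ≡⟨ cong₂ _+_ (cnt-sum e) (cnt-sum e) ⟩
  sum (ind ∘ e) + sum (ind ∘ e)       ≡⟨ ∑-distrib-+ (ind ∘ e) (ind ∘ e) ⟨
  sum (λ w → ind (e w) + ind (e w))   ≤⟨ sum-mono (λ w → row w (bool (e w))) ⟩
  sum (λ w → cnt (ω w))               ≡⟨ sum-cong-≗ (λ w → cnt-sum (ω w)) ⟩
  sum (λ w → sum (λ u → ind (ω w u))) ≡⟨ ∑-comm (λ w u → ind (ω w u)) ⟩
  sum (λ u → sum (λ w → ind (ω w u))) ≡⟨ sum-cong-≗ (λ u → ≡.sym (cnt-sum (λ w → ω w u))) ⟩
  sum (λ u → cnt (λ w → ω w u))       ≤⟨ sum-mono (λ u → cnt≤ind (λ w → ω w u) sub unique) ⟩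
  sum (ind ∘ P)                       ≡⟨ cnt-sum P ⟨
  cnt P                               ∎
  where
  open ≤-Reasoning
  row : ∀ w → e w ≡ true ⊎ e w ≡ false → ind (e w) + ind (e w) ≤ cnt (ω w)
  row w (inj₁ t) = subst (λ b → ind b + ind b ≤ cnt (ω w)) (≡.sym t) (two t)
  row w (inj₂ f) = subst (λ b → ind b + ind b ≤ cnt (ω w)) (≡.sym f) z≤n

-- Parity decides the counts of pairs: `2m + 1` vertices hold only `m` disjoint pairs.
half : ∀ {c m} → c + c ≤ suc (m + m) → c ≤ m
half {c} {m} h with c ≤? m
... | yes p = p
... | no ¬p = ⊥-elim (<-irrefl refl (≤-trans (s≤s h) (≤-trans (≤-reflexive (cong suc (≡.sym (+-suc m m)))) (+-mono-≤ (≰⇒> ¬p) (≰⇒> ¬p)))))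

1≢2 : 1 ≢ 2
1≢2 ()

-- Finiteness makes double negation commute with the universal quantifier. This is what provides a
-- Boolean table for a property that quantifies over functions, as long as the goal is a
-- contradiction or a decidable inequality.
¬¬-All : {P : Fin n → Set} → (∀ i → ¬ ¬ P i) → ¬ ¬ (∀ i → P i)
¬¬-All {zero}  h k = k λ ()
¬¬-All {suc n} h k = h zero λ p₀ → ¬¬-All (h ∘ suc) λ ps → k λ { zero → p₀ ; (suc i) → ps i }

record Indicates (P : Fin n → Set) (χ : Fin n → Bool) : Set where
  field
    to   : ∀ {v} → χ v ≡ true → P v
    from : ∀ {v} → P v → χ v ≡ true
open Indicates public

indicator : (P : Fin n → Set) → ¬ ¬ (∃[ χ ] Indicates P χ)
indicator P k = ¬¬-All (λ v → ¬¬-excluded-middle {A = P v}) λ d → k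
  ( (λ v → does (d v))
  , record { to = λ {v} → does⇒ (d v) ; from = λ {v} p → dec-true (d v) p } )

-- R need only be left-unique, and its witnesses need only exist classically.
cnt-inj : {P : Fin n → Bool} {Q : Fin m → Bool} (R : Fin n → Fin m → Set) →
  (∀ {x} → P x ≡ true → ¬ ¬ (∃[ y ] (Q y ≡ true × R x y))) →
  (∀ {x x′ y} → P x ≡ true → P x′ ≡ true → R x y → R x′ y → x ≡ x′) → cnt P ≤ cnt Q
cnt-inj {P = P} {Q} R f inj = go (cnt P) P Q refl f inj
  where
  go : ∀ j (P : Fin _ → Bool) (Q : Fin _ → Bool) → cnt P ≡ j →
    (∀ {x} → P x ≡ true → ¬ ¬ (∃[ y ] (Q y ≡ true × R x y))) →
    (∀ {x x′ y} → P x ≡ true → P x′ ≡ true → R x y → R x′ y → x ≡ x′) → cnt P ≤ cnt Q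
  go zero    P Q eq f inj = subst (_≤ cnt Q) (≡.sym eq) z≤n
  go (suc j) P Q eq f inj with cnt-pick P (subst (1 ≤_) (≡.sym eq) (s≤s z≤n))
  ... | a , pa = ≤-stable λ k → f pa λ { (y , qy , ray) → k
    (subst₂ _≤_ (≡.sym (cnt-remove P a pa)) (≡.sym (cnt-remove Q y qy)) (s≤s
      (go j (P ∖ a) (Q ∖ y) (suc-injective (trans (≡.sym (cnt-remove P a pa)) eq))
        (λ {x} px k′ → f (proj₁ (∖-elim P px)) λ { (y′ , qy′ , r) →
          k′ (y′ , ∖-intro Q qy′ (λ { refl →
            proj₂ (∖-elim P px) (inj (proj₁ (∖-elim P px)) pa r ray) }) , r) })
        (λ px px′ → inj (proj₁ (∖-elim P px)) (proj₁ (∖-elim P px′)))))) }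

subset-of-size : (P : Fin n → Bool) (j : ℕ) → j ≤ cnt P →
  ∃[ Q ] ((∀ v → Q v ≡ true → P v ≡ true) × cnt Q ≡ j)
subset-of-size {n} P j j≤ = go (cnt P ∸ j) P (≡.sym (m∸n+n≡m j≤))
  where
  go : ∀ i (P : Fin n → Bool) → cnt P ≡ i + j → ∃[ Q ] ((∀ v → Q v ≡ true → P v ≡ true) × cnt Q ≡ j)
  go zero    P eq = P , (λ _ p → p) , eq
  go (suc i) P eq with cnt-pick P (subst (1 ≤_) (≡.sym eq) (s≤s z≤n))
  ... | a , pa with go i (P ∖ a) (suc-injective (trans (≡.sym (cnt-remove P a pa)) eq))
  ...   | Q , sub , eq′ = Q , (λ v q → proj₁ (∖-elim P (sub v q))) , eq′

-- Descent on a bound for `f a`: either some `b` lies lower or `a` is minimal. Nothing about `A` is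
-- decided, hence the double negation.
argmin : {A : Set} (f : A → ℕ) → A → ¬ ¬ (∃[ a ] (∀ b → f a ≤ f b))
argmin {A} f a₀ k = go (f a₀) a₀ ≤-refl
  where
  go : ∀ j a → f a ≤ j → ⊥
  go zero    a fa≤ = k (a , λ b → ≤-trans fa≤ z≤n)
  go (suc j) a fa≤ = k (a , λ b → ≤-stable λ ¬le → go j b (≤-pred (≤-trans (≰⇒> ¬le) fa≤)))

-- Degree sums

elements : ∀ {n} → (Fin n → Bool) → List (Fin n)
elements P = List.filter (λ v → P v ≟ᵇ true) (List.allFin _)

weight : Bool → ℕ → ℕ
weight true  m = m
weight false m = 0

sum-filter : ∀ {m n} (P : Fin n → Bool) (f : Fin n → ℕ) (g : Fin m → Fin n) →
  ListAction.sum (List.map f (List.filter (λ v → P v ≟ᵇ true) (List.tabulate g))) ≡ sum (λ i → weight (P (g i)) (f (g i)))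
sum-filter {zero}  P f g = refl
sum-filter {suc m} P f g with P (g zero)
... | true  = cong (f (g zero) +_) (sum-filter P f (g ∘ suc))
... | false = sum-filter P f (g ∘ suc)

length-filter : ∀ {m n} (P : Fin n → Bool) (g : Fin m → Fin n) →
  length (List.filter (λ v → P v ≟ᵇ true) (List.tabulate g)) ≡ sum (λ i → ind (P (g i)))
length-filter {zero}  P g = refl
length-filter {suc m} P g with P (g zero)
... | true  = cong suc (length-filter P (g ∘ suc))
... | false = length-filter P (g ∘ suc)

length-elements : ∀ {n} (P : Fin n → Bool) → length (elements P) ≡ cnt P
length-elements P = trans (length-filter P id) (≡.sym (cnt-sum P))

∈-elements : ∀ {n} (P : Fin n → Bool) {v} → P v ≡ true → v ∈ elements P
∈-elements P {v} p = ∈-filter⁺ (λ v → P v ≟ᵇ true) (∈-allFin v) p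

sum-tabulate : ∀ {n} (f : Fin n → ℕ) → ListAction.sum (List.tabulate f) ≡ sum f
sum-tabulate {zero}  f = refl
sum-tabulate {suc n} f = cong (f zero +_) (sum-tabulate (f ∘ suc))

deg-cnt : ∀ {n} (G : Graph n) v → deg G v ≡ cnt (adj G v)
deg-cnt G v = trans (cong ListAction.sum (map-tabulate id (ind ∘ adj G v))) (trans (sum-tabulate (ind ∘ adj G v)) (≡.sym (cnt-sum (adj G v))))

hits : ∀ {n} (G : Graph n) → (Fin n → Bool) → Fin n → ℕ
hits G S x = cnt (λ v → S v ∧ adj G v x)

-- Edges at `S` are counted at their other endpoint, so that a degree sum can be estimated one
-- vertex `x` at a time.
degSum-hits : ∀ {n} (G : Graph n) (S : Fin n → Bool) → degSum G (elements S) ≡ sum (hits G S)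
degSum-hits {n} G S = begin
  degSum G (elements S)                              ≡⟨ sum-filter S (deg G) id ⟩
  sum (λ v → weight (S v) (deg G v))                 ≡⟨ sum-cong-≗ (λ v → lem v (S v)) ⟩
  sum (λ v → sum (λ x → ind (S v ∧ adj G v x)))      ≡⟨ ∑-comm (λ v x → ind (S v ∧ adj G v x)) ⟩
  sum (λ x → sum (λ v → ind (S v ∧ adj G v x)))      ≡⟨ sum-cong-≗ (λ x → ≡.sym (cnt-sum (λ v → S v ∧ adj G v x))) ⟩
  sum (hits G S)                                     ∎
  where
  open ≡.≡-Reasoning
  lem : ∀ v b → weight b (deg G v) ≡ sum (λ x → ind (b ∧ adj G v x))
  lem v true  = trans (deg-cnt G v) (cnt-sum (adj G v))
  lem v false = ≡.sym (sum-zero {n} {f = λ _ → 0} (λ _ → refl))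

sigma-hits : ∀ {n} (G : Graph n) {p a b} → SigmaAtLeast G p a b → ∀ S → cnt S ≡ p →
  (∀ {u v} → S u ≡ true → S v ≡ true → ¬ Adj G u v) → a ≤ sum (hits G S) + b
sigma-hits G {p} {a} {b} σ S size indep = subst (λ m → a ≤ m + b) (degSum-hits G S)
  (σ (elements S) (trans (length-elements S) size , Unique.filter⁺ _ (Unique.allFin⁺ _) , λ x y x∈ y∈ → ¬T→F (indep (mem x∈) (mem y∈))))
  where
  mem : ∀ {x} → x ∈ elements S → S x ≡ true
  mem x∈ = proj₂ (∈-filter⁻ (λ v → S v ≟ᵇ true) {xs = List.allFin _} x∈)

module SpanningTrees {n : ℕ} (G : Graph n) where

  -- Trees and edge exchanges

  V : Set
  V = Fin n

  Same : V → V → V → V → Set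
  Same u v c d = (u ≡ c × v ≡ d) ⊎ (u ≡ d × v ≡ c)

  opaque
    same? : ∀ u v c d → Dec (Same u v c d)
    same? u v c d = ((u ≟ c) ×-dec (v ≟ d)) ⊎-dec ((u ≟ d) ×-dec (v ≟ c))

    -- The row sum is what the edge `c d` contributes to the degree of `u`; the field `deg-eq` of an
    -- exchange rests on it.
    same-count : ∀ {c d} → c ≢ d → ∀ u → sum (λ v → ind (does (same? u v c d))) ≡ δ u c + δ u d
    same-count {c} {d} c≢d u with u ≟ c | u ≟ d
    ... | yes refl | yes refl = ⊥-elim (c≢d refl)
    ... | yes refl | no _     = trans (sum-cong-≗ lem) (sum-δ d)
      where lem : ∀ v → ind (does (v ≟ d) ∨ false) ≡ δ v d
            lem v with v ≟ d
            ... | yes _ = refl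
            ... | no _  = refl
    ... | no _     | yes refl = sum-δ c
    ... | no _     | no _     = sum-zero {n} {λ _ → 0} λ _ → refl

  Same-sym : ∀ {u v c d} → Same u v c d → Same v u c d
  Same-sym (inj₁ (p , q)) = inj₂ (q , p)
  Same-sym (inj₂ (p , q)) = inj₁ (q , p)

  -- A certificate that `c d` is a bridge.
  record IsCut (e : V → V → Bool) (c d : V) (f : V → Bool) : Set where
    field
      lo   : f c ≡ false
      hi   : f d ≡ true
      flat : ∀ {x y} → e x y ≡ true → ¬ Same x y c d → f x ≡ f y

  -- conn says that no proper cut separates the vertices, which is connectedness without walks.
  record Laws (e : V → V → Bool) (s : V → V → V → Bool) : Set where
    field
      esym  : ∀ u v → e u v ≡ e v u
      eirr  : ∀ v → e v v ≡ false
      esub  : ∀ u v → e u v ≡ true → Adj G u v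
      iscut : ∀ c d → e c d ≡ true → IsCut e c d (s c d)
      conn  : ∀ (f : V → Bool) → (∀ x y → e x y ≡ true → f x ≡ f y) → ∀ x y → f x ≡ f y

  -- A tree is a connected graph whose edges are all bridges; side c d is the component of d after deleting c d.
  -- Vectors make trees searchable. A side is junk when c d is not an edge.
  record Tree : Set where
    field
      rows : Vec (Vec Bool n) n
      cuts : Vec (Vec (Vec Bool n) n) n
      laws : Laws (λ u v → lookup (lookup rows u) v) (λ c d v → lookup (lookup (lookup cuts c) d) v)
  open Tree public

  opaque
    edge : Tree → V → V → Bool
    edge T u v = lookup (lookup (rows T) u) v

    side : Tree → V → V → V → Bool
    side T c d v = lookup (lookup (lookup (cuts T) c) d) v

    tree-laws : ∀ T → Laws (edge T) (side T)
    tree-laws = laws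

  Edge : Tree → V → V → Set
  Edge T u v = edge T u v ≡ true

  Cut : Tree → V → V → (V → Bool) → Set
  Cut T = IsCut (edge T)

  module _ (T : Tree) where
    open Laws (tree-laws T) public renaming (conn to connT; esym to esymT; eirr to eirrT; esub to esubT; iscut to iscutT)
    open IsCut

    esym : ∀ {u v} → Edge T u v → Edge T v u
    esym {u} {v} h = trans (≡.sym (esymT u v)) h

    eirr : ∀ {u v} → Edge T u v → u ≢ v
    eirr {u} h refl = T≢F h (eirrT u)

    conn : ∀ (f : V → Bool) → (∀ {x y} → Edge T x y → f x ≡ f y) → ∀ x y → f x ≡ f y
    conn f h = connT f (λ x y → h)

    scut : ∀ {c d} → Edge T c d → Cut T c d (side T c d)
    scut {c} {d} h = iscutT c d h

    slo : ∀ {c d} → Edge T c d → side T c d c ≡ false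
    slo h = lo (scut h)

    shi : ∀ {c d} → Edge T c d → side T c d d ≡ true
    shi h = hi (scut h)

  degree : Tree → V → ℕ
  degree T v = cnt (edge T v)

  opaque
    unfolding edge

    mkTree : (e : V → V → Bool) → (∀ u v → e u v ≡ e v u) → (∀ v → e v v ≡ false) →
      (∀ u v → e u v ≡ true → Adj G u v) → (∀ c d → e c d ≡ true → ∃[ f ] IsCut e c d f) →
      (∀ (f : V → Bool) → (∀ x y → e x y ≡ true → f x ≡ f y) → ∀ x y → f x ≡ f y) →
      ∃[ T ] (∀ u v → edge T u v ≡ e u v)
    mkTree e es ei eg ec cn = T , eq
      where
      pick : ∀ p q b → e p q ≡ b → V → Bool
      pick p q true  h = proj₁ (ec p q h)
      pick p q false h = λ _ → false
      s : V → V → V → Bool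
      s p q = pick p q (e p q) refl
      pick-cut : ∀ p q b (h : e p q ≡ b) → e p q ≡ true → IsCut e p q (pick p q b h)
      pick-cut p q true  h h′ = proj₂ (ec p q h)
      pick-cut p q false h h′ = ⊥-elim (T≢F h′ h)
      R : Vec (Vec Bool n) n
      R = tabulate λ u → tabulate (e u)
      S : Vec (Vec (Vec Bool n) n) n
      S = tabulate λ u → tabulate λ v → tabulate (s u v)
      eq : ∀ u v → lookup (lookup R u) v ≡ e u v
      eq u v = trans (cong (λ r → lookup r v) (lookup∘tabulate (λ u → tabulate (e u)) u)) (lookup∘tabulate (e u) v)
      eqs : ∀ u v w → lookup (lookup (lookup S u) v) w ≡ s u v w
      eqs u v w = trans (cong (λ r → lookup (lookup r v) w) (lookup∘tabulate (λ u → tabulate λ v → tabulate (s u v)) u))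
        (trans (cong (λ r → lookup r w) (lookup∘tabulate (λ v → tabulate (s u v)) v)) (lookup∘tabulate (s u v) w))
      T : Tree
      T = record { rows = R ; cuts = S ; laws = record
        { esym = λ u v → trans (eq u v) (trans (es u v) (≡.sym (eq v u)))
        ; eirr = λ v → trans (eq v v) (ei v)
        ; esub = λ u v h → eg u v (trans (≡.sym (eq u v)) h)
        ; iscut = λ c d h → let k = pick-cut c d (e c d) refl (trans (≡.sym (eq c d)) h) in record
            { lo = trans (eqs c d c) (IsCut.lo k)
            ; hi = trans (eqs c d d) (IsCut.hi k)
            ; flat = λ {x} {y} h′ ns → trans (eqs c d x) (trans (IsCut.flat k (trans (≡.sym (eq x y)) h′) ns) (≡.sym (eqs c d y))) }
        ; conn = λ f h → cn f (λ x y h′ → h x y (trans (eq x y) h′)) } }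

  xor-F : ∀ {a b} → a xor b ≡ false → a ≡ b
  xor-F {true}  {true}  _ = refl
  xor-F {false} {false} _ = refl

  xor-self : ∀ a → a xor a ≡ false
  xor-self true  = refl
  xor-self false = refl

  -- T′ is T + ab − cd; in deg-eq the deleted and the added edges stand on opposite sides to avoid subtraction.
  record Swapped (T : Tree) (a b c d : V) (T′ : Tree) : Set where
    field
      keep : ∀ {u v} → Edge T u v → ¬ Same u v c d → Edge T′ u v
      new  : Edge T′ a b
      inv  : ∀ {u v} → Edge T′ u v → (Edge T u v × ¬ Same u v c d) ⊎ Same u v a b
      deg-eq : ∀ v → degree T′ v + (δ v c + δ v d) ≡ degree T v + (δ v a + δ v b)

  opaque
    -- The last hypothesis excludes putting back the deleted edge. Since `c d` is the only edge of
    -- `T` that crosses its cut, `a b` is then a new edge, and the degrees balance.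
    swap : (T : Tree) {a b c d : V} → Edge T c d → side T c d a ≡ false → side T c d b ≡ true →
      Adj G a b → ¬ (a ≡ c × b ≡ d) → ∃[ T′ ] Swapped T a b c d T′
    swap T {a} {b} {c} {d} cd fa fb gab ab≢cd = T′ , record
      { keep = λ {u} {v} h ns → trans (eq u v) (e-keep h ns)
      ; new = trans (eq a b) e-new
      ; inv = λ {u} {v} h → e-inv u v (trans (≡.sym (eq u v)) h)
      ; deg-eq = deg-eq }
      where
      open IsCut
      f : V → Bool
      f = side T c d
      fcut : Cut T c d f
      fcut = scut T cd
      e : V → V → Bool
      e u v = (edge T u v ∧ not (does (same? u v c d))) ∨ does (same? u v a b)
      a≢b : a ≢ b
      a≢b refl = T≢F fb fa
      not-ab : ¬ Edge T a b
      not-ab h with same? a b c d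
      ... | yes (inj₁ p) = ab≢cd p
      ... | yes (inj₂ (refl , refl)) = T≢F (hi fcut) fa
      ... | no ns = T≢F fb (trans (≡.sym (flat fcut h ns)) fa)
      not-same : ∀ {u v} → Same u v a b → ¬ Edge T u v
      not-same (inj₁ (refl , refl)) h = not-ab h
      not-same (inj₂ (refl , refl)) h = not-ab (esym T h)
      is-edge : ∀ {u v} → Same u v c d → Edge T u v
      is-edge (inj₁ (refl , refl)) = cd
      is-edge (inj₂ (refl , refl)) = esym T cd
      e-keep : ∀ {u v} → Edge T u v → ¬ Same u v c d → e u v ≡ true
      e-keep {u} {v} h ns rewrite h | dec-false (same? u v c d) ns = refl
      or-T₂ : ∀ {x y} → y ≡ true → x ∨ y ≡ true
      or-T₂ {true}  _ = refl
      or-T₂ {false} h = h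
      e-add : ∀ {u v} → Same u v a b → e u v ≡ true
      e-add {u} {v} s = or-T₂ (dec-true (same? u v a b) s)
      e-new : e a b ≡ true
      e-new = e-add (inj₁ (refl , refl))
      e-inv : ∀ u v → e u v ≡ true → (Edge T u v × ¬ Same u v c d) ⊎ Same u v a b
      e-inv u v h with same? u v a b
      ... | yes s = inj₂ s
      ... | no _ with same? u v c d | bool (edge T u v)
      ...   | no ns | inj₁ h′ = inj₁ (h′ , ns)
      ...   | no ns | inj₂ h′ = ⊥-elim (T≢F h (cong (λ z → (z ∧ true) ∨ false) h′))
      ...   | yes _ | inj₁ h′ = ⊥-elim (T≢F h (cong (λ z → (z ∧ false) ∨ false) h′))
      ...   | yes _ | inj₂ h′ = ⊥-elim (T≢F h (cong (λ z → (z ∧ false) ∨ false) h′))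
      e-sym′ : ∀ u v → e u v ≡ true → e v u ≡ true
      e-sym′ u v h with e-inv u v h
      ... | inj₁ (h′ , ns) = e-keep (esym T h′) (ns ∘ Same-sym)
      ... | inj₂ s = e-add (Same-sym s)
      e-sym : ∀ u v → e u v ≡ e v u
      e-sym u v with bool (e u v) | bool (e v u)
      ... | inj₁ p | inj₁ q = trans p (≡.sym q)
      ... | inj₂ p | inj₂ q = trans p (≡.sym q)
      ... | inj₁ p | inj₂ q = ⊥-elim (T≢F (e-sym′ u v p) q)
      ... | inj₂ p | inj₁ q = ⊥-elim (T≢F (e-sym′ v u q) p)
      e-irr : ∀ v → e v v ≡ false
      e-irr v = ¬T→F λ h → lem (e-inv v v h)
        where lem : (Edge T v v × ¬ Same v v c d) ⊎ Same v v a b → ⊥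
              lem (inj₁ (h , _)) = eirr T h refl
              lem (inj₂ (inj₁ (refl , refl))) = a≢b refl
              lem (inj₂ (inj₂ (refl , refl))) = a≢b refl
      e-sub : ∀ u v → e u v ≡ true → Adj G u v
      e-sub u v h with e-inv u v h
      ... | inj₁ (h′ , _) = esubT T u v h′
      ... | inj₂ (inj₁ (refl , refl)) = gab
      ... | inj₂ (inj₂ (refl , refl)) = trans (≡.sym (Graph.sym G a b)) gab
      crossed : ∀ {x y z w p} → x ≢ y → z ≡ false → w ≡ true → x xor (z xor p) ≡ y xor (w xor p)
      crossed {true}  {true}  ne refl refl = ⊥-elim (ne refl)
      crossed {true}  {false} {p = true}  ne refl refl = refl
      crossed {true}  {false} {p = false} ne refl refl = refl
      crossed {false} {true}  {p = true}  ne refl refl = refl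
      crossed {false} {true}  {p = false} ne refl refl = refl
      crossed {false} {false} ne refl refl = ⊥-elim (ne refl)
      e-cut : ∀ p q → e p q ≡ true → ∃[ g ] IsCut e p q g
      e-cut p q h with e-inv p q h
      -- The two parts of `T` without `c d` are also the two sides of the new edge.
      ... | inj₂ (inj₁ (refl , refl)) = f , record { lo = fa ; hi = fb ; flat = fl }
        where fl : ∀ {x y} → e x y ≡ true → ¬ Same x y a b → f x ≡ f y
              fl {x} {y} h ns with e-inv x y h
              ... | inj₁ (h′ , ns′) = flat fcut h′ ns′
              ... | inj₂ s = ⊥-elim (ns s)
      ... | inj₂ (inj₂ (refl , refl)) = not ∘ f , record { lo = cong not fb ; hi = cong not fa ; flat = fl }
        where fl : ∀ {x y} → e x y ≡ true → ¬ Same x y b a → not (f x) ≡ not (f y)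
              fl {x} {y} h ns with e-inv x y h
              ... | inj₁ (h′ , ns′) = cong not (flat fcut h′ ns′)
              ... | inj₂ (inj₁ s) = ⊥-elim (ns (inj₂ s))
              ... | inj₂ (inj₂ s) = ⊥-elim (ns (inj₁ s))
      ... | inj₁ (pq , ns) with side T p q a ≟ᵇ side T p q b
      ...   | yes gab = g , record { lo = lo gcut ; hi = hi gcut ; flat = fl }
        where
        g : V → Bool
        g = side T p q
        gcut : Cut T p q g
        gcut = scut T pq
        fl : ∀ {x y} → e x y ≡ true → ¬ Same x y p q → g x ≡ g y
        fl {x} {y} h ns with e-inv x y h
        ... | inj₁ (h′ , _) = flat gcut h′ ns
        ... | inj₂ (inj₁ (refl , refl)) = gab
        ... | inj₂ (inj₂ (refl , refl)) = ≡.sym gab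
      ...   | no ¬gab = g′ , record
          { lo = trans (cong₂ _xor_ (lo gcut) (xor-self (f p))) refl
          ; hi = trans (cong₂ _xor_ (hi gcut) (trans (cong (_xor f p) (≡.sym (flat fcut pq ns))) (xor-self (f p)))) refl
          ; flat = fl }
        where
        g : V → Bool
        g = side T p q
        gcut : Cut T p q g
        gcut = scut T pq
        -- The new edge a b crosses both cuts, hence not their symmetric difference.
        g′ : V → Bool
        g′ v = g v xor (f v xor f p)
        fl : ∀ {x y} → e x y ≡ true → ¬ Same x y p q → g′ x ≡ g′ y
        fl {x} {y} h ns with e-inv x y h
        ... | inj₁ (h′ , ns′) = cong₂ _xor_ (flat gcut h′ ns) (cong (_xor f p) (flat fcut h′ ns′))
        ... | inj₂ (inj₁ (refl , refl)) = crossed ¬gab fa fb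
        ... | inj₂ (inj₂ (refl , refl)) = ≡.sym (crossed ¬gab fa fb)
      e-conn : ∀ (h : V → Bool) → (∀ x y → e x y ≡ true → h x ≡ h y) → ∀ x y → h x ≡ h y
      e-conn h fl with h c ≟ᵇ h d
      ... | yes hcd = conn T h λ {x} {y} k → [ (λ { (inj₁ (refl , refl)) → hcd ; (inj₂ (refl , refl)) → ≡.sym hcd })
                                             , (λ ns → fl x y (e-keep k ns)) ]′ (dec⊎ (same? x y c d))
        where dec⊎ : ∀ {A : Set} → Dec A → A ⊎ ¬ A
              dec⊎ (yes x) = inj₁ x
              dec⊎ (no x)  = inj₂ x
      -- If `h` differs at `c` and `d`, then `h xor f` is constant along every edge of `T`, hence
      -- constant. But `f` separates `a` from `b`, while `h` agrees on them because of the new edge.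
      ... | no hcd = ⊥-elim (contra (trans (≡.sym (cong (h a xor_) fa)) (trans (h′ a b) (cong (h b xor_) fb))) (fl a b e-new))
        where
        contra : ∀ {x y} → x xor false ≡ y xor true → x ≡ y → ⊥
        contra {true}  () refl
        contra {false} () refl
        ends : ∀ {x y z w} → x ≢ y → z ≡ false → w ≡ true → x xor z ≡ y xor w
        ends {true}  {true}  ne refl refl = ⊥-elim (ne refl)
        ends {true}  {false} ne refl refl = refl
        ends {false} {true}  ne refl refl = refl
        ends {false} {false} ne refl refl = ⊥-elim (ne refl)
        h′ : ∀ x y → h x xor f x ≡ h y xor f y
        h′ = conn T (λ v → h v xor f v) lem
          where
          lem : ∀ {x y} → Edge T x y → h x xor f x ≡ h y xor f y
          lem {x} {y} k with same? x y c d
          ... | yes (inj₁ (refl , refl)) = ends hcd (lo fcut) (hi fcut)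
          ... | yes (inj₂ (refl , refl)) = ≡.sym (ends hcd (lo fcut) (hi fcut))
          ... | no ns = cong₂ _xor_ (fl x y (e-keep k ns)) (flat fcut k ns)
      mk : ∃[ T ] (∀ u v → edge T u v ≡ e u v)
      mk = mkTree e e-sym e-irr e-sub e-cut e-conn
      T′ : Tree
      T′ = proj₁ mk
      eq : ∀ u v → edge T′ u v ≡ e u v
      eq = proj₂ mk
      deg-eq : ∀ v → degree T′ v + (δ v c + δ v d) ≡ degree T v + (δ v a + δ v b)
      deg-eq u = begin
        degree T′ u + (δ u c + δ u d)
          ≡⟨ cong₂ _+_ (trans (cnt-cong (eq u)) (cnt-sum (e u))) (≡.sym (same-count (eirr T cd) u)) ⟩
        sum (ind ∘ e u) + sum (λ v → ind (does (same? u v c d)))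
          ≡⟨ ≡.sym (∑-distrib-+ (ind ∘ e u) (λ v → ind (does (same? u v c d)))) ⟩
        sum (λ v → ind (e u v) + ind (does (same? u v c d)))
          ≡⟨ sum-cong-≗ (λ v → lem v (same? u v c d) (same? u v a b)) ⟩
        sum (λ v → ind (edge T u v) + ind (does (same? u v a b)))
          ≡⟨ ∑-distrib-+ (ind ∘ edge T u) (λ v → ind (does (same? u v a b))) ⟩
        sum (ind ∘ edge T u) + sum (λ v → ind (does (same? u v a b)))
          ≡⟨ cong₂ _+_ (≡.sym (cnt-sum (edge T u))) (same-count a≢b u) ⟩
        degree T u + (δ u a + δ u b) ∎
        where
        open ≡.≡-Reasoning
        lem : ∀ v (p : Dec (Same u v c d)) (q : Dec (Same u v a b)) →
          ind ((edge T u v ∧ not (does p)) ∨ does q) + ind (does p) ≡ ind (edge T u v) + ind (does q)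
        lem v (yes p) (yes q) = ⊥-elim (not-same q (is-edge p))
        lem v (yes p) (no _) rewrite is-edge p = refl
        lem v (no _) (yes q) rewrite ¬T→F (not-same q) = refl
        lem v (no _) (no _) with edge T u v
        ... | true  = refl
        ... | false = refl

  open IsCut public

  Leaf : Tree → V → Set
  Leaf T v = degree T v ≡ 1

  Br : Tree → V → Set
  Br T v = 3 ≤ degree T v

  -- Constant on the components of T − x.
  Flat : Tree → V → (V → Bool) → Set
  Flat T x f = ∀ {v w} → Edge T v w → v ≢ x → w ≢ x → f v ≡ f w

  -- A side without branch vertices is a path, the leaf-branch path of its leaf.
  Bare : Tree → (V → Bool) → Set
  Bare T f = ∀ {b} → Br T b → f b ≡ false

  -- (t , a) is the first edge at a branch vertex met on the way from w through p.
  record Climb (T : Tree) (p w : V) : Set where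
    constructor climbed
    field
      {t a} : V
      ta    : Edge T t a
      brt   : Br T t
      ⊆     : ∀ {v} → side T p w v ≡ true → side T t a v ≡ true
      ⊇     : ∀ {v} → side T t a v ≡ true → side T p w v ≡ true ⊎ degree T v ≡ 2

  -- Sides and directions in one tree

  module _ (T : Tree) where

    -- The exclusive or of two certificates is constant along every edge, the edge `c d` included,
    -- and it is false at `c`.
    cut-unique : ∀ {c d f g} → Cut T c d f → Cut T c d g → ∀ v → f v ≡ g v
    cut-unique {c} {d} {f} {g} p q v =
      xor-F (trans (conn T (λ v → f v xor g v) along v c) (cong₂ _xor_ (lo p) (lo q)))
      where
      along : ∀ {x y} → Edge T x y → f x xor g x ≡ f y xor g y
      along {x} {y} e with same? x y c d
      ... | yes (inj₁ (refl , refl)) = trans (cong₂ _xor_ (lo p) (lo q)) (≡.sym (cong₂ _xor_ (hi p) (hi q)))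
      ... | yes (inj₂ (refl , refl)) = trans (cong₂ _xor_ (hi p) (hi q)) (≡.sym (cong₂ _xor_ (lo p) (lo q)))
      ... | no ns = cong₂ _xor_ (flat p e ns) (flat q e ns)

    cut-rev : ∀ {c d f} → Cut T c d f → Cut T d c (not ∘ f)
    cut-rev p = record { lo = cong not (hi p) ; hi = cong not (lo p) ; flat = λ e ns → cong not (flat p e (ns ∘ swapS)) }
      where swapS : ∀ {x y c d} → Same x y c d → Same x y d c
            swapS (inj₁ s) = inj₂ s
            swapS (inj₂ s) = inj₁ s

    side-rev : ∀ {c d} → Edge T c d → ∀ v → side T d c v ≡ not (side T c d v)
    side-rev cd = cut-unique (scut T (esym T cd)) (cut-rev (scut T cd))

    side-rev-T : ∀ {c d v} → Edge T c d → side T c d v ≡ false → side T d c v ≡ true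
    side-rev-T {v = v} cd h = trans (side-rev cd v) (cong not h)

    side-rev-F : ∀ {c d v} → Edge T c d → side T c d v ≡ true → side T d c v ≡ false
    side-rev-F {v = v} cd h = trans (side-rev cd v) (cong not h)

    -- Both ends of either edge lie outside the side of the other edge, so the conjunction of `f`
    -- and `g` is constant along all edges. It is false at `z`, hence everywhere.
    disjoint : ∀ {z y z′ y′ f g} → Edge T z y → Edge T z′ y′ → Cut T z y f → Cut T z′ y′ g →
      f z′ ≡ false → g z ≡ false → ¬ (z ≡ z′ × y ≡ y′) → ∀ {v} → f v ≡ true → g v ≡ true → ⊥
    disjoint {z} {y} {z′} {y′} {f} {g} zy zy′ p q fz′ gz ne {v} fv gv =
      T≢F (∧-T fv gv) (trans (conn T (λ v → f v ∧ g v) along v z) (cong (_∧ g z) (lo p)))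
      where
      ns₁ : ¬ Same z y z′ y′
      ns₁ (inj₁ s) = ne s
      ns₁ (inj₂ (refl , refl)) = T≢F (hi p) fz′
      ns₂ : ¬ Same z′ y′ z y
      ns₂ (inj₁ (refl , refl)) = ne (refl , refl)
      ns₂ (inj₂ (refl , refl)) = T≢F (hi p) fz′
      F∧ : ∀ a {b} → b ≡ false → a ∧ b ≡ false
      F∧ true  h = h
      F∧ false h = refl
      gy : g y ≡ false
      gy = trans (≡.sym (flat q zy ns₁)) gz
      fy′ : f y′ ≡ false
      fy′ = trans (≡.sym (flat p zy′ ns₂)) fz′
      at₁ : ∀ {x} → x ≡ z ⊎ x ≡ y → f x ∧ g x ≡ false
      at₁ {x} (inj₁ refl) = F∧ (f x) gz
      at₁ {x} (inj₂ refl) = F∧ (f x) gy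
      at₂ : ∀ {x} → x ≡ z′ ⊎ x ≡ y′ → f x ∧ g x ≡ false
      at₂ {x} (inj₁ refl) = cong (_∧ g x) fz′
      at₂ {x} (inj₂ refl) = cong (_∧ g x) fy′
      along : ∀ {x w} → Edge T x w → f x ∧ g x ≡ f w ∧ g w
      along {x} {w} e with same? x w z y | same? x w z′ y′
      ... | yes (inj₁ (s , t)) | _ = trans (at₁ (inj₁ s)) (≡.sym (at₁ (inj₂ t)))
      ... | yes (inj₂ (s , t)) | _ = trans (at₁ (inj₂ s)) (≡.sym (at₁ (inj₁ t)))
      ... | no _ | yes (inj₁ (s , t)) = trans (at₂ (inj₁ s)) (≡.sym (at₂ (inj₂ t)))
      ... | no _ | yes (inj₂ (s , t)) = trans (at₂ (inj₂ s)) (≡.sym (at₂ (inj₁ t)))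
      ... | no ns | no ns′ = cong₂ _∧_ (flat p e ns) (flat q e ns′)

    flat-side : ∀ {x y} → Edge T x y → Flat T x (side T x y)
    flat-side xy e v≢x w≢x = flat (scut T xy) e λ { (inj₁ (p , _)) → v≢x p ; (inj₂ (_ , q)) → w≢x q }

    opaque
      -- This stands in for the first edge of the path from `x` to `v`. The vertices other than `x`
      -- that lie in no direction from `x` are closed under adjacency, so by connectedness there are
      -- none.
      next : ∀ {x v} → x ≢ v → ∃[ y ] (Edge T x y × side T x y v ≡ true)
      next {x} {v} x≢v with any? (λ y → (edge T x y ≟ᵇ true) ×-dec (side T x y v ≟ᵇ true))
      ... | yes r = r
      ... | no ¬r = ⊥-elim (T≢F (to-T (away? v) away-v) (trans (conn T (λ w → does (away? w)) along v x)
                                                            (dec-false (away? x) λ a → proj₁ a refl)))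
        where
        Away : V → Set
        Away w = x ≢ w × (∀ y → Edge T x y → side T x y w ≡ false)
        away? : ∀ w → Dec (Away w)
        away? w with x ≟ w | all? (λ y → (edge T x y ≟ᵇ true) →-dec (side T x y w ≟ᵇ false))
        ... | yes p | _     = no λ a → proj₁ a p
        ... | no p  | yes q = yes (p , q)
        ... | no p  | no q  = no λ a → q (proj₂ a)
        to-T : ∀ {A : Set} (d : Dec A) → A → does d ≡ true
        to-T = dec-true
        away-v : Away v
        away-v = x≢v , λ y e → ¬T→F λ s → ¬r (y , e , s)
        move : ∀ {a b} → Edge T a b → Away a → Away b
        move {a} {b} e (x≢a , h) with x ≟ b
        ... | yes refl = ⊥-elim (T≢F (shi T (esym T e)) (h a (esym T e)))
        ... | no x≢b = x≢b , λ y xy → trans (≡.sym (flat-side xy e (x≢a ∘ ≡.sym) (x≢b ∘ ≡.sym))) (h y xy)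
        along : ∀ {a b} → Edge T a b → does (away? a) ≡ does (away? b)
        along {a} {b} e with away? a | away? b
        ... | yes _ | yes _ = refl
        ... | no _  | no _  = refl
        ... | yes p | no ¬q = ⊥-elim (¬q (move e p))
        ... | no ¬p | yes q = ⊥-elim (¬p (move (esym T e) q))

    next-unique : ∀ {x y y′ v} → Edge T x y → Edge T x y′ → side T x y v ≡ true → side T x y′ v ≡ true → y ≡ y′
    next-unique {x} {y} {y′} e e′ s s′ with y ≟ y′
    ... | yes p = p
    ... | no ne = ⊥-elim (disjoint e e′ (scut T e) (scut T e′) (slo T e) (slo T e′) (λ p → ne (proj₂ p)) s s′)

    other-side : ∀ {x y y′ v} → Edge T x y → Edge T x y′ → y ≢ y′ → side T x y v ≡ true → side T x y′ v ≡ false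
    other-side e e′ ne s = ¬T→F λ s′ → ne (next-unique e e′ s s′)

    side-≢ : ∀ {x y v} → Edge T x y → side T x y v ≡ true → v ≢ x
    side-≢ e s refl = T≢F s (slo T e)

    crossing : ∀ {z y f x w} → Cut T z y f → Edge T x w → f x ≡ false → f w ≡ true → x ≡ z × w ≡ y
    crossing {z} {y} {f} {x} {w} p e fx fw with same? x w z y
    ... | yes (inj₁ s) = s
    ... | yes (inj₂ (refl , refl)) = ⊥-elim (T≢F (hi p) fx)
    ... | no ns = ⊥-elim (T≢F (trans (flat p e ns) fw) fx)

    -- The complement of a side is connected, hence it stays in one piece when a vertex of the side is deleted.
    bypass : ∀ {z y g x f} → Cut T z y g → g x ≡ true → Flat T x f →
      ∀ {b₁ b₂} → g b₁ ≡ false → g b₂ ≡ false → f b₁ ≡ f b₂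
    bypass {z} {y} {g} {x} {f} p gx fl {b₁} {b₂} g₁ g₂ =
      trans (≡.sym (out g₁)) (trans (conn T h along b₁ b₂) (out g₂))
      where
      h : V → Bool
      h v = if g v then f z else f v
      out : ∀ {v} → g v ≡ false → h v ≡ f v
      out {v} e = cong (λ b → if b then f z else f v) e
      inn : ∀ {v} → g v ≡ true → h v ≡ f z
      inn {v} e = cong (λ b → if b then f z else f v) e
      along : ∀ {v w} → Edge T v w → h v ≡ h w
      along {v} {w} e with same? v w z y
      ... | yes (inj₁ (refl , refl)) = trans (out (lo p)) (≡.sym (inn (hi p)))
      ... | yes (inj₂ (refl , refl)) = trans (inn (hi p)) (≡.sym (out (lo p)))
      ... | no ns with bool (g v)
      ...   | inj₁ gv = trans (inn gv) (≡.sym (inn (trans (≡.sym (flat p e ns)) gv)))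
      ...   | inj₂ gv = trans (out gv) (trans (fl e (λ { refl → T≢F gx gv }) (λ { refl → T≢F gx gw })) (≡.sym (out gw)))
        where gw = trans (≡.sym (flat p e ns)) gv

    bypass′ : ∀ {z y g x f} → Cut T z y g → g x ≡ false → Flat T x f →
      ∀ {b₁ b₂} → g b₁ ≡ true → g b₂ ≡ true → f b₁ ≡ f b₂
    bypass′ p gx fl g₁ g₂ = bypass (cut-rev p) (cong not gx) fl (cong not g₁) (cong not g₂)

    deg≥1 : ∀ {x y} → Edge T x y → 1 ≤ degree T x
    deg≥1 {x} e = cnt≥1 (edge T x) e

    deg≥2 : ∀ {x y z} → Edge T x y → Edge T x z → z ≢ y → 2 ≤ degree T x
    deg≥2 {x} e e′ = cnt≥2 (edge T x) e e′

    deg≥3 : ∀ {x a b c} → Edge T x a → Edge T x b → Edge T x c → b ≢ a → c ≢ a → c ≢ b → 3 ≤ degree T x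
    deg≥3 {x} = cnt≥3 (edge T x)

    leaf-unique : ∀ {u a b} → Leaf T u → Edge T u a → Edge T u b → a ≡ b
    leaf-unique {u} {a} {b} l ea eb with b ≟ a
    ... | yes p = ≡.sym p
    ... | no ne = ⊥-elim (<-irrefl refl (subst (2 ≤_) l (deg≥2 ea eb ne)))

    leaf-¬Br : ∀ {u} → Leaf T u → ¬ Br T u
    leaf-¬Br l b with ≤-trans b (≤-reflexive l)
    ... | s≤s ()

    two-¬Br : ∀ {u} → degree T u ≡ 2 → ¬ Br T u
    two-¬Br l b with ≤-trans b (≤-reflexive l)
    ... | s≤s (s≤s ())

    two-nbrs : ∀ {x a b c} → degree T x ≡ 2 → Edge T x a → Edge T x b → b ≢ a → Edge T x c → c ≡ a ⊎ c ≡ b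
    two-nbrs {x} {a} {b} {c} l ea eb ne ec with c ≟ a | c ≟ b
    ... | yes p | _ = inj₁ p
    ... | no _ | yes q = inj₂ q
    ... | no p | no q = ⊥-elim (two-¬Br l (deg≥3 ea eb ec ne p q))

    leaf-side : ∀ {u z v} → Leaf T u → Edge T z u → side T z u v ≡ true → v ≡ u
    leaf-side {u} {z} {v} l e s with u ≟ v
    ... | yes p = ≡.sym p
    ... | no ne with next ne
    ...   | y , uy , s′ with leaf-unique l uy (esym T e)
    ...     | refl = ⊥-elim (T≢F s (side-rev-F uy s′))

    ¬leaf-2 : ∀ {x y} → Edge T x y → ¬ Leaf T x → 2 ≤ degree T x
    ¬leaf-2 {x} e nl = ≤∧≢⇒< (deg≥1 e) (nl ∘ ≡.sym)

    other-nbr : ∀ {x} → 2 ≤ degree T x → ∀ y → ∃[ z ] (Edge T x z × z ≢ y)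
    other-nbr {x} h y = cnt-pick-other (edge T x) h y

    third-nbr : ∀ {x} → Br T x → ∀ y z → ∃[ w ] (Edge T x w × w ≢ y × w ≢ z)
    third-nbr {x} h y z = cnt-third (edge T x) h y z

    opaque
      side-leaf : ∀ {c d} → Edge T c d → ∃[ u ] (Leaf T u × side T c d u ≡ true)
      side-leaf {c} {d} e = go (cnt (side T c d)) e ≤-refl
        where
        go : ∀ j {c d} → Edge T c d → cnt (side T c d) ≤ j → ∃[ u ] (Leaf T u × side T c d u ≡ true)
        go zero {c} {d} e h = ⊥-elim (<-irrefl refl (≤-trans (cnt≥1 (side T c d) (shi T e)) h))
        go (suc j) {c} {d} e h with degree T d Data.Nat.≟ 1
          where import Data.Nat
        ... | yes l = d , l , shi T e
        ... | no nl with other-nbr (¬leaf-2 (esym T e) nl) c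
        ...   | x , dx , x≢c = let (u , l , s) = go j dx smaller in u , l , sub s
          where
          sub : ∀ {v} → side T d x v ≡ true → side T c d v ≡ true
          sub s = side-rev-T (esym T e) (other-side dx (esym T e) x≢c s)
          smaller : cnt (side T d x) ≤ j
          smaller = ≤-pred (≤-trans (s≤s (cnt-mono λ v s → ∖-intro (side T c d) (sub s) (side-≢ dx s)))
                      (≤-trans (≤-reflexive (≡.sym (cnt-remove (side T c d) d (shi T e)))) h))

    opaque
      -- While `p` is not a branch vertex, its only neighbours are `w` and the one towards `b`. The
      -- edge then moves one step towards `b`, and its side gains only `p`, of degree two.
      climb : ∀ {p w b} → Edge T p w → Br T b → side T p w b ≡ false → Climb T p w
      climb {p} {w} {b} e hb s = go (cnt (not ∘ side T p w)) e s ≤-refl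
        where
        go : ∀ j {p w} → Edge T p w → side T p w b ≡ false → cnt (not ∘ side T p w) ≤ j → Climb T p w
        go zero {p} {w} e s h = ⊥-elim (<-irrefl refl (≤-trans (cnt≥1 (not ∘ side T p w) (cong not s)) h))
        go (suc j) {p} {w} e s h with 3 ≤? degree T p
        ... | yes br = climbed e br id inj₁
        ... | no ¬br with next {p} {b} (λ { refl → ¬br hb })
        ...   | c , pc , sc = lift (go j (esym T pc) (side-rev-F pc sc) smaller)
          where
          c≢w : c ≢ w
          c≢w refl = T≢F sc s
          two : degree T p ≡ 2
          two = ≤-antisym (≤-pred (≰⇒> ¬br)) (deg≥2 e pc c≢w)
          ⊆ : ∀ {v} → side T p w v ≡ true → side T c p v ≡ true
          ⊆ s = side-rev-T pc (other-side e pc (c≢w ∘ ≡.sym) s)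
          ⊇ : ∀ {v} → side T c p v ≡ true → side T p w v ≡ true ⊎ degree T v ≡ 2
          ⊇ {v} s with p ≟ v
          ... | yes refl = inj₂ two
          ... | no ne with next ne
          ...   | y , py , s′ with two-nbrs two e pc c≢w py
          ...     | inj₁ refl = inj₁ s′
          ...     | inj₂ refl = ⊥-elim (T≢F s (side-rev-F pc s′))
          smaller : cnt (not ∘ side T c p) ≤ j
          smaller = ≤-pred (≤-trans (s≤s (cnt-mono λ v k → ∖-intro (not ∘ side T p w)
                        (cong not (¬T→F λ s → T≢F k (cong not (⊆ s)))) (λ { refl → T≢F k (cong not (shi T (esym T pc))) })))
                      (≤-trans (≤-reflexive (≡.sym (cnt-remove (not ∘ side T p w) p (cong not (slo T e))))) h))
          lift : Climb T c p → Climb T p w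
          lift (climbed ta br up dn) = climbed ta br (λ s → up (⊆ s)) (λ s → split (dn s))
            where
            split : ∀ {v} → side T c p v ≡ true ⊎ degree T v ≡ 2 → side T p w v ≡ true ⊎ degree T v ≡ 2
            split (inj₁ s) = ⊇ s
            split (inj₂ l) = inj₂ l

  -- Trees with the fewest leaves

  gsym : ∀ {u v} → Adj G u v → Adj G v u
  gsym {u} {v} h = trans (Graph.sym G v u) h

  girr : ∀ {u v} → Adj G u v → u ≢ v
  girr {u} h refl = T≢F h (Graph.irrefl G u)

  E⇒G : ∀ T {u v} → Edge T u v → Adj G u v
  E⇒G T {u} {v} = esubT T u v

  leaf? : Tree → V → Bool
  leaf? T v = does (degree T v ℕ.≟ 1)

  ℓ : Tree → ℕ
  ℓ T = cnt (leaf? T)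

  leaf-T : ∀ T {v} → Leaf T v → leaf? T v ≡ true
  leaf-T T {v} l = dec-true (degree T v ℕ.≟ 1) l

  T-leaf : ∀ T {v} → leaf? T v ≡ true → Leaf T v
  T-leaf T {v} = does⇒ (degree T v ℕ.≟ 1)

  Min : Tree → Set
  Min T = ∀ T′ → ℓ T ≤ ℓ T′

  -- The graph of the injection behind the leaf counts below: the one possible new leaf `y` goes to
  -- the lost leaf `u`, and every other leaf to itself.
  Replaces : V → V → V → V → Set
  Replaces y u v w = (v ≡ y × w ≡ u) ⊎ (v ≢ y × w ≡ v)

  module _ {T T′ : Tree} {u y : V}
    (old : ∀ {v} → Leaf T′ v → v ≢ y → Leaf T v) (lu : Leaf T u) (gone : u ≢ y → ¬ Leaf T′ u) where

    private
      rep : ∀ v → ∃[ w ] Replaces y u v w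
      rep v with v ≟ y
      ... | yes p = u , inj₁ (p , refl)
      ... | no p  = v , inj₂ (p , refl)
      rep-inj : ∀ {v v′ w} → leaf? T′ v ≡ true → leaf? T′ v′ ≡ true → Replaces y u v w → Replaces y u v′ w → v ≡ v′
      rep-inj _ _ (inj₁ (p , _)) (inj₁ (q , _)) = trans p (≡.sym q)
      rep-inj _ l′ (inj₁ (_ , refl)) (inj₂ (q , refl)) = ⊥-elim (gone q (T-leaf T′ l′))
      rep-inj l _ (inj₂ (p , refl)) (inj₁ (_ , refl)) = ⊥-elim (gone p (T-leaf T′ l))
      rep-inj _ _ (inj₂ (_ , refl)) (inj₂ (_ , refl)) = refl
      rep-leaf : ∀ {v w} → leaf? T′ v ≡ true → Replaces y u v w → Leaf T w
      rep-leaf l (inj₁ (_ , refl)) = lu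
      rep-leaf l (inj₂ (p , refl)) = old (T-leaf T′ l) p

    leaves-≤ : ℓ T′ ≤ ℓ T
    leaves-≤ = cnt-inj (Replaces y u) (λ {v} l k → k (proj₁ (rep v) , leaf-T T (rep-leaf l (proj₂ (rep v))) , proj₂ (rep v))) rep-inj

    leaves-< : ∀ {w} → Leaf T w → w ≢ u → ¬ Leaf T′ w → ℓ T′ < ℓ T
    leaves-< {w} lw w≢u nlw = subst (ℓ T′ <_) (≡.sym (cnt-remove (leaf? T) w (leaf-T T lw))) (s≤s
      (cnt-inj (Replaces y u) (λ {v} l k → k (proj₁ (rep v) ,
         ∖-intro (leaf? T) (leaf-T T (rep-leaf l (proj₂ (rep v)))) (avoid l (proj₂ (rep v))) , proj₂ (rep v))) rep-inj))
      where
      avoid : ∀ {v w′} → leaf? T′ v ≡ true → Replaces y u v w′ → w′ ≢ w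
      avoid l (inj₁ (_ , refl)) e = w≢u (≡.sym e)
      avoid l (inj₂ (_ , refl)) refl = nlw (T-leaf T′ l)

  leaves-⊂ : ∀ {T T′ w} → (∀ {v} → Leaf T′ v → Leaf T v) → Leaf T w → ¬ Leaf T′ w → ℓ T′ < ℓ T
  leaves-⊂ {T} {T′} {w} sub lw nlw = subst (ℓ T′ <_) (≡.sym (cnt-remove (leaf? T) w (leaf-T T lw))) (s≤s
    (cnt-mono λ v l → ∖-intro (leaf? T) (leaf-T T (sub (T-leaf T′ l))) (λ { refl → nlw (T-leaf T′ l) })))

  Min-≤ : ∀ {T T′} → Min T → ℓ T′ ≤ ℓ T → Min T′
  Min-≤ m h T″ = ≤-trans h (m T″)

  module _ {T T′ : Tree} {a b c d : V} (S : Swapped T a b c d T′) where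
    open Swapped S

    cut-keep : ∀ {p q f} → Cut T p q f → f a ≡ f b → Cut T′ p q f
    cut-keep {p} {q} {f} k fab = record { lo = lo k ; hi = hi k ; flat = fl }
      where
      fl : ∀ {x y} → Edge T′ x y → ¬ Same x y p q → f x ≡ f y
      fl e ns with inv e
      ... | inj₁ (e′ , _) = flat k e′ ns
      ... | inj₂ (inj₁ (refl , refl)) = fab
      ... | inj₂ (inj₂ (refl , refl)) = ≡.sym fab

    side-keep : ∀ {p q} → Edge T p q → ¬ Same p q c d → side T p q a ≡ side T p q b →
      ∀ v → side T′ p q v ≡ side T p q v
    side-keep pq ns h = cut-unique T′ (scut T′ (keep pq ns)) (cut-keep (scut T pq) h)

    flat-keep : ∀ {x f} → Flat T x f → (a ≢ x → b ≢ x → f a ≡ f b) → Flat T′ x f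
    flat-keep fl h e v≢x w≢x with inv e
    ... | inj₁ (e′ , _) = fl e′ v≢x w≢x
    ... | inj₂ (inj₁ (refl , refl)) = h v≢x w≢x
    ... | inj₂ (inj₂ (refl , refl)) = ≡.sym (h w≢x v≢x)

    untouched : ∀ {v} → v ≢ a → v ≢ b → v ≢ c → v ≢ d → degree T′ v ≡ degree T v
    untouched {v} p q r s = begin
      degree T′ v                     ≡⟨ ≡.sym (+-identityʳ _) ⟩
      degree T′ v + 0                 ≡⟨ cong (degree T′ v +_) (≡.sym (cong₂ _+_ (δ-diff r) (δ-diff s))) ⟩
      degree T′ v + (δ v c + δ v d)   ≡⟨ deg-eq v ⟩
      degree T v + (δ v a + δ v b)    ≡⟨ cong (degree T v +_) (cong₂ _+_ (δ-diff p) (δ-diff q)) ⟩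
      degree T v + 0                  ≡⟨ +-identityʳ _ ⟩
      degree T v ∎
      where open ≡.≡-Reasoning

    deg-at : ∀ {v i j} → δ v c + δ v d ≡ i → δ v a + δ v b ≡ j → degree T′ v + i ≡ degree T v + j
    deg-at {v} refl refl = deg-eq v

  δ-10 : ∀ {v a b : V} → v ≡ a → v ≢ b → δ v a + δ v b ≡ 1
  δ-10 {v} refl q = cong₂ _+_ (δ-same v) (δ-diff q)

  δ-01 : ∀ {v a b : V} → v ≢ a → v ≡ b → δ v a + δ v b ≡ 1
  δ-01 {v} p refl = cong₂ _+_ (δ-diff p) (δ-same v)

  δ-00 : ∀ {v a b : V} → v ≢ a → v ≢ b → δ v a + δ v b ≡ 0
  δ-00 p q = cong₂ _+_ (δ-diff p) (δ-diff q)

  +1-inj : ∀ {x y} → x + 1 ≡ y + 1 → x ≡ y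
  +1-inj {x} {y} = +-cancelʳ-≡ 1 x y

  +0-1 : ∀ {x y} → x + 0 ≡ y + 1 → x ≡ suc y
  +0-1 {x} {y} h = trans (≡.sym (+-identityʳ x)) (trans h (+-comm y 1))

  +1-0 : ∀ {x y} → x + 1 ≡ y + 0 → suc x ≡ y
  +1-0 h = ≡.sym (+0-1 (≡.sym h))

  -- The leaf u is joined to x, and the first edge x y from x towards u is deleted: y replaces u among the leaves.
  record Rotated (T : Tree) (u x y : V) (T′ : Tree) : Set where
    field
      swapped : Swapped T x u x y T′
      min′    : Min T′
      ℓ≤      : ℓ T′ ≤ ℓ T
      deg-y   : degree T y ≡ 2
      leaf-y  : Leaf T′ y
      deg-u   : degree T′ u ≡ 2
      rest    : ∀ {v} → v ≢ u → v ≢ y → degree T′ v ≡ degree T v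
    open Swapped swapped public

    Leaf-keep : ∀ {v} → Leaf T v → v ≢ u → Leaf T′ v
    Leaf-keep l v≢u = trans (rest v≢u (λ { refl → 1≢2 (trans (≡.sym l) deg-y) })) l

    Br-keep : Leaf T u → ∀ {v} → Br T v → Br T′ v
    Br-keep lu {v} b = subst (3 ≤_) (≡.sym (rest (λ { refl → leaf-¬Br T lu b }) (λ { refl → two-¬Br T deg-y b }))) b

    Br-back : ∀ {v} → Br T′ v → Br T v
    Br-back {v} b = subst (3 ≤_) (rest (λ { refl → two-¬Br T′ deg-u b }) (λ { refl → leaf-¬Br T′ leaf-y b })) b

  opaque
    -- Minimality forces `y` to have degree two. If `y` were a branch vertex, the exchange would
    -- destroy the leaf `u` without creating a leaf; and `y` is no leaf, since `u` lies beyond it.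
    rotate : ∀ {T u x y} → Min T → Leaf T u → Adj G x u → ¬ Edge T x u → Edge T x y → side T x y u ≡ true →
      ∃[ T′ ] Rotated T u x y T′
    rotate {T} {u} {x} {y} min lu gxu nxu xy su = T′ , record
      { swapped = S ; min′ = Min-≤ min le ; ℓ≤ = le ; deg-y = dy
      ; leaf-y = suc-injective (trans (deg-y′) dy) ; deg-u = trans deg-u′ (cong suc lu) ; rest = rest }
      where
      u≢y : u ≢ y
      u≢y refl = nxu xy
      x≢y : x ≢ y
      x≢y = eirr T xy
      x≢u : x ≢ u
      x≢u = girr gxu
      sw : ∃[ T′ ] Swapped T x u x y T′
      sw = swap T xy (slo T xy) su gxu (λ p → u≢y (proj₂ p))
      T′ : Tree
      T′ = proj₁ sw
      S : Swapped T x u x y T′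
      S = proj₂ sw
      deg-y′ : suc (degree T′ y) ≡ degree T y
      deg-y′ = +1-0 (deg-at S (δ-01 (x≢y ∘ ≡.sym) refl) (δ-00 (x≢y ∘ ≡.sym) (u≢y ∘ ≡.sym)))
      deg-u′ : degree T′ u ≡ suc (degree T u)
      deg-u′ = +0-1 (deg-at S (δ-00 (x≢u ∘ ≡.sym) u≢y) (δ-01 (x≢u ∘ ≡.sym) refl))
      rest : ∀ {v} → v ≢ u → v ≢ y → degree T′ v ≡ degree T v
      rest {v} p q with v ≟ x
      ... | yes refl = +1-inj (deg-at S (δ-10 refl x≢y) (δ-10 refl x≢u))
      ... | no r = untouched S r p r q
      leaf-u : ¬ Leaf T′ u
      leaf-u l = 1≢2 (trans (≡.sym l) (trans deg-u′ (cong suc lu)))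
      old : ∀ {v} → Leaf T′ v → v ≢ y → Leaf T v
      old {v} l v≢y = trans (≡.sym (rest (λ { refl → leaf-u l }) v≢y)) l
      le : ℓ T′ ≤ ℓ T
      le = leaves-≤ {T} {T′} old lu (λ _ → leaf-u)
      ¬br : ¬ Br T y
      ¬br b = <-irrefl refl (≤-trans (leaves-⊂ {T} {T′} sub lu leaf-u) (min T′))
        where
        sub : ∀ {v} → Leaf T′ v → Leaf T v
        sub l = old l (λ { refl → contradiction (≤-trans b (≤-reflexive (trans (≡.sym deg-y′) (cong suc l)))) (λ { (s≤s (s≤s ())) }) })
      ¬ly : ¬ Leaf T y
      ¬ly l = u≢y (leaf-side T l xy su)
      dy : degree T y ≡ 2
      dy = ≤-antisym (≤-pred (≰⇒> ¬br)) (¬leaf-2 T (esym T xy) ¬ly)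

  -- side T z y is the leaf-branch path of u, and z is the branch vertex at its end.
  record Owner (T : Tree) (u z y : V) : Set where
    field
      zy   : Edge T z y
      brz  : Br T z
      in-u : side T z y u ≡ true
      bare : Bare T (side T z y)
      path : ∀ {v} → side T z y v ≡ true → v ≡ u ⊎ degree T v ≡ 2

    only : ∀ {v} → side T z y v ≡ true → Leaf T v → v ≡ u
    only s l with path s
    ... | inj₁ p = p
    ... | inj₂ q with trans (≡.sym l) q
    ...   | ()

  owner-unique : ∀ {T u z y z′ y′ g} → Owner T u z y → Edge T z′ y′ → Cut T z′ y′ g → Br T z′ → Bare T g → g u ≡ true →
    z ≡ z′ × y ≡ y′
  owner-unique {T} {u} {z} {y} {z′} {y′} o e k br ba gu with (z ≟ z′) ×-dec (y ≟ y′)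
  ... | yes p = p
  ... | no ne = ⊥-elim (disjoint T zy e (scut T zy) k (bare br) (ba brz) ne in-u gu)
    where open Owner o

  module Minimal (twoBr : ∀ T (x : V) → ∃[ b ] (Br T b × b ≢ x)) where

    opaque
      owner : ∀ {T u} → Leaf T u → ∃[ z ] ∃[ y ] Owner T u z y
      owner {T} {u} lu with cnt-pick (edge T u) (≤-reflexive (≡.sym lu))
      ... | p , up with twoBr T u
      ...   | b , br , b≢u with climb T (esym T up) br (¬T→F (λ s → b≢u (leaf-side T lu (esym T up) s)))
      ...     | climbed {z} {y} zy brz ⊆ ⊇ = z , y , record
        { zy = zy ; brz = brz ; in-u = ⊆ (shi T (esym T up)) ; bare = λ br′ → ¬T→F λ s → ba br′ (pth s) ; path = pth }
        where
        pth : ∀ {v} → side T z y v ≡ true → v ≡ u ⊎ degree T v ≡ 2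
        pth s with ⊇ s
        ... | inj₁ s′ = inj₁ (leaf-side T lu (esym T up) s′)
        ... | inj₂ d = inj₂ d
        ba : ∀ {v} → Br T v → v ≡ u ⊎ degree T v ≡ 2 → ⊥
        ba b (inj₁ refl) = leaf-¬Br T lu b
        ba b (inj₂ d) = two-¬Br T d b

    opaque
      -- Otherwise the edge `u′ u` replaces the edge `z y` by which the leaf-branch path of `u`
      -- hangs. The branch vertex `z` does not become a leaf, only `y` can, and two leaves are lost.
      leaves-independent : ∀ {T u u′} → Min T → Leaf T u → Leaf T u′ → u ≢ u′ → ¬ Adj G u u′
      leaves-independent {T} {u} {u′} min lu lu′ u≢u′ g with owner {T} {u} lu
      ... | z , y , o = <-irrefl refl (≤-trans (leaves-< {T} {T′} old lu gone lu′ (u≢u′ ∘ ≡.sym) nlu′) (min T′))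
        where
        open Owner o
        u′∉ : side T z y u′ ≡ false
        u′∉ = ¬T→F λ s → u≢u′ (≡.sym (only s lu′))
        z≢ : ∀ {v} → Leaf T v → v ≢ z
        z≢ l refl = leaf-¬Br T l brz
        sw : ∃[ T′ ] Swapped T u′ u z y T′
        sw = swap T zy u′∉ in-u (gsym g) (λ p → z≢ lu′ (proj₁ p))
        T′ : Tree
        T′ = proj₁ sw
        S : Swapped T u′ u z y T′
        S = proj₂ sw
        u′≢y : u′ ≢ y
        u′≢y refl = T≢F (shi T zy) u′∉
        two : ∀ {v} → Leaf T v → degree T′ v ≡ suc (degree T v) → ¬ Leaf T′ v
        two l h l′ with trans (≡.sym l′) (trans h (cong suc l))
        ... | ()
        nlu′ : ¬ Leaf T′ u′
        nlu′ = two lu′ (+0-1 (deg-at S (δ-00 (z≢ lu′) u′≢y) (δ-10 refl (u≢u′ ∘ ≡.sym))))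
        gone : u ≢ y → ¬ Leaf T′ u
        gone u≢y = two lu (+0-1 (deg-at S (δ-00 (z≢ lu) u≢y) (δ-01 u≢u′ refl)))
        old : ∀ {v} → Leaf T′ v → v ≢ y → Leaf T v
        old {v} l v≢y with v ≟ z | v ≟ u | v ≟ u′
        ... | yes refl | _ | _ = contradiction brz (λ b → lem (≤-trans b (≤-reflexive
                (trans (≡.sym (+1-0 (deg-at S (δ-10 refl v≢y) (δ-00 (z≢ lu′ ∘ ≡.sym) (z≢ lu ∘ ≡.sym))))) (cong suc l)))))
          where lem : ¬ (3 ≤ 2)
                lem (s≤s (s≤s ()))
        ... | no _ | yes refl | _ = lu
        ... | no _ | no _ | yes refl = lu′
        ... | no p | no q | no r = trans (≡.sym (untouched S r q p v≢y)) l

    -- After the rotation `y` and `u′` are both leaves of a tree with the fewest leaves, and leaves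
    -- are independent there.
    rotated-leaf : ∀ {T u x y T′ u′} → Rotated T u x y T′ → Leaf T u′ → u′ ≢ u → ¬ Adj G y u′
    rotated-leaf {T} {y = y} R l ne = leaves-independent min′ leaf-y (Leaf-keep l ne) λ { refl → 1≢2 (trans (≡.sym l) deg-y) }
      where
      open Rotated R

    next-no-leaf : ∀ {T u x y u′} → Min T → Leaf T u → Adj G x u → ¬ Edge T x u → Edge T x y → side T x y u ≡ true →
      Leaf T u′ → u′ ≢ u → ¬ Adj G y u′
    next-no-leaf min lu gxu nxu xy su = rotated-leaf (proj₂ (rotate min lu gxu nxu xy su))

    triangle : ∀ T {x y z} → Edge T x y → Edge T x z → y ≢ z → ¬ Edge T y z
    triangle T xy xz y≢z yz with crossing T (scut T xy) (esym T yz) (other-side T xz xy (y≢z ∘ ≡.sym) (shi T xz)) (shi T xy)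
    ... | p , _ = eirr T xz (≡.sym p)

    -- After a rotation at x the former neighbour y is a leaf, and an edge y z to another tree neighbour z of x
    -- allows a second rotation, which turns x itself into a leaf.
    opaque
      rotate-twice : ∀ {T u x y z T′} → Rotated T u x y T′ → Adj G x u → Edge T x y → side T x y u ≡ true → Edge T x z → y ≢ z → Adj G y z →
        ∃[ T″ ] Rotated T′ y z x T″
      rotate-twice {T} {u} {x} {y} {z} {T′} R gxu xy su xz y≢z gyz =
        rotate min′ leaf-y (gsym gyz) nzy (esym T′ xz′) sy
        where
        open Rotated R
        xz′ : Edge T′ x z
        xz′ = keep xz λ { (inj₁ (_ , p)) → y≢z (≡.sym p) ; (inj₂ (p , _)) → eirr T xy p }
        nzy : ¬ Edge T′ z y
        nzy e with inv e
        ... | inj₁ (e′ , _) = triangle T xy xz y≢z (esym T e′)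
        ... | inj₂ (inj₁ (p , _)) = eirr T xz (≡.sym p)
        ... | inj₂ (inj₂ (_ , p)) = eirr T xy (≡.sym p)
        zx : Edge T z x
        zx = esym T xz
        sy : side T′ z x y ≡ true
        sy = trans (side-keep swapped zx (λ { (inj₁ (p , _)) → eirr T xz (≡.sym p) ; (inj₂ (p , _)) → y≢z (≡.sym p) })
                     (trans (shi T zx) (≡.sym (side-rev-T T xz (other-side T xy xz y≢z su)))) y)
                   (side-rev-T T xz (other-side T xy xz y≢z (shi T xy)))

  -- Induced stars, stem insertions, and the number of leaves that a vertex sees

  star : K14Free G → ∀ {c a b d e} → Adj G c a → Adj G c b → Adj G c d → Adj G c e →
    a ≢ b → a ≢ d → a ≢ e → b ≢ d → b ≢ e → d ≢ e →
    ¬ Adj G a b → ¬ Adj G a d → ¬ Adj G a e → ¬ Adj G b d → ¬ Adj G b e → ¬ Adj G d e → ⊥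
  star free {c} {a} {b} {d} {e} ca cb cd ce ab ad ae bd be de ab′ ad′ ae′ bd′ be′ de′ =
    free c xs refl
      ((ab ∷ ad ∷ ae ∷ []) ∷ (bd ∷ be ∷ []) ∷ (de ∷ []) ∷ [] ∷ [])
      (λ x x∈ → All.lookup (ca ∷ cb ∷ cd ∷ ce ∷ []) x∈)
      (λ x y x∈ y∈ → All.lookup (All.lookup pairs x∈) y∈)
    where
    xs = a ∷ b ∷ d ∷ e ∷ []
    na : ∀ {u v} → ¬ Adj G u v → adj G u v ≡ false
    na = ¬T→F
    an : ∀ {u v} → ¬ Adj G u v → adj G v u ≡ false
    an h = ¬T→F (h ∘ gsym)
    ii = λ v → Graph.irrefl G v
    pairs : All (λ x → All (λ y → adj G x y ≡ false) xs) xs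
    pairs = (ii a ∷ na ab′ ∷ na ad′ ∷ na ae′ ∷ []) ∷ (an ab′ ∷ ii b ∷ na bd′ ∷ na be′ ∷ [])
          ∷ (an ad′ ∷ an bd′ ∷ ii d ∷ na de′ ∷ []) ∷ (an ae′ ∷ an be′ ∷ an de′ ∷ ii e ∷ []) ∷ []

  Branchy : Tree → (V → Bool) → Set
  Branchy T f = ∃[ b ] (Br T b × f b ≡ true)

  bare-or-branchy : ∀ T f → Bare T f ⊎ Branchy T f
  bare-or-branchy T f with any? (λ b → (3 ≤? degree T b) ×-dec (f b ≟ᵇ true))
  ... | yes r = inj₂ r
  ... | no ¬r = inj₁ λ {b} br → ¬T→F λ s → ¬r (b , br , s)

  ¬bare-branchy : ∀ T {f} → Bare T f → ¬ Branchy T f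
  ¬bare-branchy T ba (b , br , s) = T≢F s (ba br)

  -- The vertices of leaf-branch paths. `OnStem` is the complement in positive form: whichever edge
  -- leads into `x`, a branch vertex lies at or beyond `x`.
  Twig : Tree → V → Set
  Twig T x = ∃[ d ] (Edge T d x × Bare T (side T d x))

  OnStem : Tree → V → Set
  OnStem T x = ∀ {d} → Edge T d x → Branchy T (side T d x)

  twig-or-stem : ∀ T x → Twig T x ⊎ OnStem T x
  twig-or-stem T x with any? (λ d → (edge T d x ≟ᵇ true) ×-dec all? (λ b → (3 ≤? degree T b) →-dec (side T d x b ≟ᵇ false)))
  ... | yes (d , e , h) = inj₁ (d , e , λ {b} → h b)
  ... | no ¬r = inj₂ on-stem
    where
    on-stem : OnStem T x
    on-stem {d} e with bare-or-branchy T (side T d x)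
    ... | inj₁ ba = ⊥-elim (¬r (d , e , λ b br → ba br))
    ... | inj₂ by = by

  -- A path-free form of lying strictly inside the tree path between two branch vertices. Since `f`
  -- is arbitrary, the property is carried through an exchange by checking the new edge only.
  record Splits (T : Tree) (v : V) : Set where
    constructor splits
    field
      {f}     : V → Bool
      {b₁ b₂} : V
      flat-f  : Flat T v f
      br₁     : Br T b₁
      br₂     : Br T b₂
      b₁≢v    : b₁ ≢ v
      b₂≢v    : b₂ ≢ v
      f-b₁    : f b₁ ≡ true
      f-b₂    : f b₂ ≡ false

  Stem : Tree → V → Set
  Stem T v = Br T v ⊎ Splits T v

  leaf-¬Stem : ∀ {T u} → Leaf T u → ¬ Stem T u
  leaf-¬Stem {T} lu (inj₁ b) = leaf-¬Br T lu b
  leaf-¬Stem {T} {u} lu (inj₂ (splits fl br₁ br₂ n₁ n₂ f₁ f₂)) with cnt-pick (edge T u) (≤-reflexive (≡.sym lu))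
  ... | p , up = T≢F (trans (≡.sym (bypass T (scut T pu) (shi T pu) fl
        (¬T→F (n₁ ∘ leaf-side T lu pu)) (¬T→F (n₂ ∘ leaf-side T lu pu)))) f₁) f₂
    where pu = esym T up

  -- Otherwise u could be inserted into the stem edge x y, which lengthens the stem.
  NoInsert : Tree → Set
  NoInsert T = ∀ {u x y} → Leaf T u → Edge T x y → Branchy T (side T y x) → Branchy T (side T x y) →
    Adj G x u → ¬ Adj G y u

  record Inserted (T : Tree) (u : V) (T′ : Tree) : Set where
    field
      min′   : Min T′
      ℓ≤     : ℓ T′ ≤ ℓ T
      deg-br : ∀ {v} → Br T v → degree T′ v ≡ degree T v
      keeps  : ∀ {v} → Splits T v → v ≢ u → Splits T′ v
      gains  : Splits T′ u

  ∖-at : ∀ (P : V → Bool) a → (P ∖ a) a ≡ false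
  ∖-at P a = ¬T→F λ h → proj₂ (∖-elim P h) refl

  ∖-off : ∀ (P : V → Bool) {a v} → v ≢ a → (P ∖ a) v ≡ P v
  ∖-off P {a} {v} ne with bool (P v)
  ... | inj₁ p = trans (∖-intro P p ne) (≡.sym p)
  ... | inj₂ p = trans (¬T→F λ h → T≢F (proj₁ (∖-elim P h)) p) (≡.sym p)

  opaque
    -- Two rotations: `x u` replaces `x y`, and then `u y` replaces `u v`, where `v` is the old tree
    -- neighbour of `u`. The net effect is that `u` subdivides the stem edge `x y` and `v` takes its
    -- place as a leaf.
    insert : ∀ {T u x y} → Min T → Leaf T u → Edge T x y → side T x y u ≡ true →
      Branchy T (side T y x) → Branchy T (side T x y) → Adj G x u → Adj G y u → ∃[ T′ ] Inserted T u T′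
    insert {T} {u} {x} {y} min lu xy su (bx , brx , sx) (by , bry , sy) gxu gyu
      with cnt-pick (edge T u) (≤-reflexive (≡.sym lu))
    ... | v , uv = T₂ , record
      { min′ = R₂.min′ ; ℓ≤ = ≤-trans R₂.ℓ≤ R₁.ℓ≤
      ; deg-br = λ b → trans (R₂.rest (λ { refl → two-¬Br T R₁.deg-y b }) (λ { refl → two-¬Br T₁ R₂.deg-y (R₁.Br-keep lu b) }))
                              (R₁.rest (λ { refl → leaf-¬Br T lu b }) (λ { refl → two-¬Br T R₁.deg-y b }))
      ; keeps = keeps
      ; gains = splits flat-u (br2 bry) (br2 brx) (br≢ bry) (br≢ brx) sy (¬T→F λ s → T≢F sx (side-rev-F T xy s)) }
      where
      br≢ : ∀ {b} → Br T b → b ≢ u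
      br≢ b refl = leaf-¬Br T lu b
      x≢u : x ≢ u
      x≢u = girr gxu
      y≢u : y ≢ u
      y≢u = girr gyu
      nxu : ¬ Edge T x u
      nxu e = y≢u (next-unique T xy e su (shi T e))
      r₁ : ∃[ T′ ] Rotated T u x y T′
      r₁ = rotate min lu gxu nxu xy su
      T₁ : Tree
      T₁ = proj₁ r₁
      module R₁ = Rotated (proj₂ r₁)
      v≢x : v ≢ x
      v≢x refl = nxu (esym T uv)
      -- By the first rotation `y` has degree two. If `u` were its second neighbour, no branch
      -- vertex could lie on the side of `y`.
      v≢y : v ≢ y
      v≢y refl with next T {y} {by} (λ { refl → two-¬Br T R₁.deg-y bry })
      ... | w , yw , s with two-nbrs T R₁.deg-y (esym T xy) (esym T uv) (x≢u ∘ ≡.sym) yw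
      ...   | inj₁ refl = T≢F sy (side-rev-F T yw s)
      ...   | inj₂ refl = br≢ bry (leaf-side T lu yw s)
      v≢u : v ≢ u
      v≢u = eirr T uv ∘ ≡.sym
      nsame : ¬ Same u v x y
      nsame (inj₁ (p , _)) = x≢u (≡.sym p)
      nsame (inj₂ (p , _)) = y≢u (≡.sym p)
      -- After the first rotation the side of `u v` is the old side of `x y` without `u`.
      f : V → Bool
      f = side T x y ∖ u
      u-only : ∀ {p q} → Edge T p q → ¬ Same p q u v → p ≢ u × q ≢ u
      u-only e ns = (λ { refl → ns (inj₁ (refl , leaf-unique T lu e uv)) })
                  , (λ { refl → ns (inj₂ (leaf-unique T lu (esym T e) uv , refl)) })
      cut₁ : Cut T₁ u v f
      cut₁ = record { lo = ∖-at (side T x y) u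
                    ; hi = trans (∖-off (side T x y) v≢u) (trans (≡.sym (flat (scut T xy) uv nsame)) su)
                    ; flat = fl }
        where
        fx≡fu : f x ≡ f u
        fx≡fu = trans (∖-off (side T x y) x≢u) (trans (slo T xy) (≡.sym (∖-at (side T x y) u)))
        fl : ∀ {p q} → Edge T₁ p q → ¬ Same p q u v → f p ≡ f q
        fl {p} {q} e ns with R₁.inv e
        ... | inj₂ (inj₁ (refl , refl)) = fx≡fu
        ... | inj₂ (inj₂ (refl , refl)) = ≡.sym fx≡fu
        ... | inj₁ (e′ , ns′) = let (p≢ , q≢) = u-only e′ ns in
          trans (∖-off (side T x y) p≢) (trans (flat (scut T xy) e′ ns′) (≡.sym (∖-off (side T x y) q≢)))
      uv₁ : Edge T₁ u v
      uv₁ = R₁.keep uv nsame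
      sy₁ : side T₁ u v y ≡ true
      sy₁ = trans (cut-unique T₁ (scut T₁ uv₁) cut₁ y) (∖-intro (side T x y) (shi T xy) y≢u)
      nuy₁ : ¬ Edge T₁ u y
      nuy₁ e with R₁.inv e
      ... | inj₁ (e′ , _) = v≢y (leaf-unique T lu uv e′)
      ... | inj₂ (inj₁ (p , _)) = x≢u (≡.sym p)
      ... | inj₂ (inj₂ (_ , p)) = eirr T xy (≡.sym p)
      r₂ : ∃[ T′ ] Rotated T₁ y u v T′
      r₂ = rotate R₁.min′ R₁.leaf-y (gsym gyu) nuy₁ uv₁ sy₁
      T₂ : Tree
      T₂ = proj₁ r₂
      module R₂ = Rotated (proj₂ r₂)
      br2 : ∀ {b} → Br T b → Br T₂ b
      br2 b = R₂.Br-keep R₁.leaf-y (R₁.Br-keep lu b)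
      data Edge₂ (p q : V) : Set where
        old : Edge T p q → p ≢ u → q ≢ u → ¬ Same p q x y → Edge₂ p q
        ux  : Same p q x u → Edge₂ p q
        uy  : Same p q u y → Edge₂ p q
      inv₂ : ∀ {p q} → Edge T₂ p q → Edge₂ p q
      inv₂ e with R₂.inv e
      ... | inj₂ s = uy s
      ... | inj₁ (e′ , ns) with R₁.inv e′
      ...   | inj₁ (e″ , ns′) = let (p≢ , q≢) = u-only e″ ns in old e″ p≢ q≢ ns′
      ...   | inj₂ s = ux s
      flat-u : Flat T₂ u (side T x y)
      flat-u e p≢u q≢u with inv₂ e
      ... | old e′ _ _ ns = flat (scut T xy) e′ ns
      ... | ux (inj₁ (_ , q)) = ⊥-elim (q≢u q)
      ... | ux (inj₂ (p , _)) = ⊥-elim (p≢u p)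
      ... | uy (inj₁ (p , _)) = ⊥-elim (p≢u p)
      ... | uy (inj₂ (_ , q)) = ⊥-elim (q≢u q)
      keeps : ∀ {c} → Splits T c → c ≢ u → Splits T₂ c
      keeps {c} (splits {h} fl br₁ br₂ n₁ n₂ f₁ f₂) c≢u =
        splits {f = g} fl′ (br2 br₁) (br2 br₂) n₁ n₂ (trans (g-off (br≢ br₁)) f₁) (trans (g-off (br≢ br₂)) f₂)
        where
        -- The inserted vertex `u` lies between `x` and `y`. It takes the value of `x`, or that of
        -- `y` when `x` is the deleted vertex `c`.
        g : V → Bool
        g p = if does (p ≟ u) then (if does (c ≟ x) then h y else h x) else h p
        g-off : ∀ {p} → p ≢ u → g p ≡ h p
        g-off {p} ne = cong (λ b → if b then (if does (c ≟ x) then h y else h x) else h p) (dec-false (p ≟ u) ne)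
        g-u : g u ≡ (if does (c ≟ x) then h y else h x)
        g-u = cong (λ b → if b then (if does (c ≟ x) then h y else h x) else h u) (dec-true (u ≟ u) refl)
        gx : c ≢ x → g x ≡ g u
        gx ne = trans (g-off x≢u) (≡.sym (trans g-u (cong (λ b → if b then h y else h x) (dec-false (c ≟ x) ne))))
        gy : c ≢ y → g u ≡ g y
        gy ne = at (c ≟ x)
          where
          at : Dec (c ≡ x) → g u ≡ g y
          at (yes p) = trans g-u (trans (cong (λ b → if b then h y else h x) (dec-true (c ≟ x) p)) (≡.sym (g-off y≢u)))
          at (no p) = trans (≡.sym (gx p)) (trans (g-off x≢u) (trans (fl xy (p ∘ ≡.sym) (ne ∘ ≡.sym)) (≡.sym (g-off y≢u))))
        fl′ : Flat T₂ c g
        fl′ e p≢c q≢c with inv₂ e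
        ... | old e′ p≢ q≢ _ = trans (g-off p≢) (trans (fl e′ p≢c q≢c) (≡.sym (g-off q≢)))
        ... | ux (inj₁ (refl , refl)) = gx (p≢c ∘ ≡.sym)
        ... | ux (inj₂ (refl , refl)) = ≡.sym (gx (q≢c ∘ ≡.sym))
        ... | uy (inj₁ (refl , refl)) = gy (q≢c ∘ ≡.sym)
        ... | uy (inj₂ (refl , refl)) = ≡.sym (gy (p≢c ∘ ≡.sym))

  no-insertion : ∀ {T} → Min T → (∀ {u T′} → Leaf T u → Inserted T u T′ → ⊥) → NoInsert T
  no-insertion {T} min stuck {u} {x} {y} lu xy bx by gxu gyu with bool (side T x y u)
  ... | inj₁ s = stuck lu (proj₂ (insert min lu xy s bx by gxu gyu))
  ... | inj₂ s = stuck lu (proj₂ (insert min lu (esym T xy) (side-rev-T T xy s) by bx gyu gxu))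

  module Claws (free : K14Free G) (twoBr : ∀ T (x : V) → ∃[ b ] (Br T b × b ≢ x)) where
    open Minimal twoBr public

    module _ {T : Tree} (min : Min T) where

      ¬nbr-leaf : ∀ {x y u u′} → Edge T x y → side T x y u ≡ true → side T x y u′ ≡ true → u ≢ u′ → Leaf T u → ¬ Edge T x u
      ¬nbr-leaf xy su su′ ne lu e with next-unique T xy e su (shi T e)
      ... | refl = ne (≡.sym (leaf-side T lu xy su′))

      opaque
        -- From `z` the way to `u` leads through `x`, so joining `z` to `u` makes `x` the new leaf.
        -- This is impossible if `x` is a branch vertex or sees another leaf.
        behind : ∀ {x z u} → Leaf T u → Edge T x z → side T x z u ≡ false → u ≢ x → Adj G z u → ∃[ T′ ] Rotated T u z x T′
        behind {x} {z} {u} lu xz su u≢x gzu = rotate min lu gzu nzu (esym T xz) (side-rev-T T xz su)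
          where
          nzu : ¬ Edge T z u
          nzu e = u≢x (proj₁ (crossing T (scut T xz) (esym T e) su (shi T xz)))

      opaque
        -- Otherwise `u₁`, `u₂`, `y`, `z` form an induced star at `x`. An edge from `y` to one of
        -- the leaves is excluded by rotating the other leaf, which turns `y` into a leaf. An edge
        -- from `z` to a leaf or to `y` would allow rotations that turn `x` into a leaf, although
        -- `x` sees another leaf.
        same-direction : ∀ {x y z u₁ u₂} → Leaf T u₁ → Leaf T u₂ → u₁ ≢ u₂ → Adj G x u₁ → Adj G x u₂ →
          Edge T x y → side T x y u₁ ≡ true → side T x y u₂ ≡ true → Edge T x z → z ≢ y → ⊥
        same-direction {x} {y} {z} {u₁} {u₂} l₁ l₂ ne g₁ g₂ xy s₁ s₂ xz z≢y =
          star free g₁ g₂ (E⇒G T xy) (E⇒G T xz) ne (u≢y e₁) (u≢z s₁) (u≢y e₂) (u≢z s₂) (z≢y ∘ ≡.sym)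
            (leaves-independent min l₁ l₂ ne) (next-no-leaf min l₂ g₂ e₂ xy s₂ l₁ ne ∘ gsym) (far l₁ l₂ ne g₂ s₁ g₁)
            (rotated-leaf R l₂ (ne ∘ ≡.sym) ∘ gsym) (far l₂ l₁ (ne ∘ ≡.sym) g₁ s₂ g₂) y≁z
          where
          e₁ : ¬ Edge T x u₁
          e₁ = ¬nbr-leaf xy s₁ s₂ ne l₁
          e₂ : ¬ Edge T x u₂
          e₂ = ¬nbr-leaf xy s₂ s₁ (ne ∘ ≡.sym) l₂
          u≢y : ∀ {u} → ¬ Edge T x u → u ≢ y
          u≢y h refl = h xy
          sz : ∀ {u} → side T x y u ≡ true → side T x z u ≡ false
          sz = other-side T xy xz (z≢y ∘ ≡.sym)
          u≢z : ∀ {u} → side T x y u ≡ true → u ≢ z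
          u≢z s refl = T≢F (shi T xz) (sz s)
          r : ∃[ T′ ] Rotated T u₁ x y T′
          r = rotate min l₁ g₁ e₁ xy s₁
          R : Rotated T u₁ x y (proj₁ r)
          R = proj₂ r
          far : ∀ {u u′} → Leaf T u → Leaf T u′ → u ≢ u′ → Adj G x u′ → side T x y u ≡ true → Adj G x u → ¬ Adj G u z
          far lu lu′ ne gxu′ s gxu guz =
            rotated-leaf (proj₂ (behind lu xz (sz s) (girr gxu ∘ ≡.sym) (gsym guz))) lu′ (ne ∘ ≡.sym) gxu′
          y≁z : ¬ Adj G y z
          y≁z g = rotated-leaf (proj₂ (rotate-twice R g₁ xy s₁ xz (z≢y ∘ ≡.sym) g)) (Rotated.Leaf-keep R l₂ (ne ∘ ≡.sym))
            (λ { refl → ⊥-elim (1≢2 (trans (≡.sym l₂) (Rotated.deg-y R))) }) g₂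

      stem-deg≥2 : ∀ {x y} → OnStem T x → Edge T x y → 2 ≤ degree T x
      stem-deg≥2 {x} st xy = ¬leaf-2 T xy λ l → let (b , br , s) = st (esym T xy) in
        leaf-¬Br T (subst (Leaf T) (≡.sym (leaf-side T l (esym T xy) s)) l) br

      opaque
        -- By `same-direction` the two leaves lie in different directions `y₁` and `y₂`. If a branch
        -- vertex lay in direction `y₁`, then `NoInsert` would keep `y₁` from seeing `u₁`, and `u₁`,
        -- `u₂`, `y₁` would belong to an induced star at `x`. Its fourth leaf is a third neighbour
        -- if `x` is a branch vertex, and `y₂` if `x` has degree two.
        stem-pair : NoInsert T → ∀ {x u₁ u₂} → OnStem T x → Leaf T u₁ → Leaf T u₂ → u₁ ≢ u₂ → Adj G x u₁ → Adj G x u₂ →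
          Br T x × ∃[ y ] (Edge T x y × side T x y u₁ ≡ true × Bare T (side T x y))
        stem-pair noins {x} {u₁} {u₂} st l₁ l₂ ne g₁ g₂ with next T (girr g₁) | next T (girr g₂)
        ... | y₁ , xy₁ , s₁ | y₂ , xy₂ , s₂ = brx , y₁ , xy₁ , s₁ , bare₁
          where
          y₁≢y₂ : y₁ ≢ y₂
          y₁≢y₂ refl with other-nbr T (stem-deg≥2 st xy₁) y₁
          ... | z , xz , z≢y = same-direction l₁ l₂ ne g₁ g₂ xy₁ s₁ s₂ xz z≢y
          module Rich {u y u′ y′} (lu : Leaf T u) (lu′ : Leaf T u′) (ne : u ≢ u′) (gu : Adj G x u) (gu′ : Adj G x u′)
            (xy : Edge T x y) (s : side T x y u ≡ true) (xy′ : Edge T x y′) (s′ : side T x y′ u′ ≡ true)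
            (y≢y′ : y ≢ y′) (by : Branchy T (side T x y)) where
            nxu : ¬ Edge T x u
            nxu e with next-unique T xy e s (shi T e)
            ... | refl = leaf-¬Br T (subst (Leaf T) (≡.sym (leaf-side T lu xy (proj₂ (proj₂ by)))) lu) (proj₁ (proj₂ by))
            u≢y : u ≢ y
            u≢y refl = nxu xy
            y≁u : ¬ Adj G y u
            y≁u = noins lu xy (st (esym T xy)) by gu
            r : ∃[ T′ ] Rotated T u x y T′
            r = rotate min lu gu nxu xy s
            R : Rotated T u x y (proj₁ r)
            R = proj₂ r
            y≁u′ : ¬ Adj G y u′
            y≁u′ = rotated-leaf R lu′ (ne ∘ ≡.sym)
            u′≢y : u′ ≢ y
            u′≢y refl = y≢y′ (next-unique T xy xy′ (shi T xy) s′)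
            y≁ : ∀ {z} → Edge T x z → y ≢ z → Adj G y z → ∃[ T″ ] Rotated (proj₁ r) y z x T″
            y≁ xz y≢z g = rotate-twice R gu xy s xz y≢z g
            deg-r : degree (proj₁ r) x ≡ degree T x
            deg-r = Rotated.rest R (girr gu) (eirr T xy)
            keep′ : Leaf (proj₁ r) u′
            keep′ = Rotated.Leaf-keep R lu′ (ne ∘ ≡.sym)
          contra : Branchy T (side T x y₁) → ⊥
          contra by₁ with 3 ≤? degree T x
          ... | yes br with third-nbr T br y₁ y₂
          ...   | w , xw , w≢y₁ , w≢y₂ =
            star free g₁ g₂ (E⇒G T xy₁) (E⇒G T xw) ne A.u≢y (u≢w l₁ xy₁ s₁ w≢y₁) A.u′≢y (u≢w l₂ xy₂ s₂ w≢y₂) (w≢y₁ ∘ ≡.sym)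
              (leaves-independent min l₁ l₂ ne) (A.y≁u ∘ gsym) (far l₁ xy₁ s₁ w≢y₁ g₁) (A.y≁u′ ∘ gsym) (far l₂ xy₂ s₂ w≢y₂ g₂)
              (λ g → two-¬Br (proj₁ A.r) (Rotated.deg-y (proj₂ (A.y≁ xw (w≢y₁ ∘ ≡.sym) g))) (subst (3 ≤_) (≡.sym A.deg-r) br))
            where
            module A = Rich l₁ l₂ ne g₁ g₂ xy₁ s₁ xy₂ s₂ y₁≢y₂ by₁
            u≢w : ∀ {u y} → Leaf T u → Edge T x y → side T x y u ≡ true → w ≢ y → u ≢ w
            u≢w lu xy s w≢y refl = w≢y (next-unique T xw xy (shi T xw) s)
            far : ∀ {u y} → Leaf T u → Edge T x y → side T x y u ≡ true → w ≢ y → Adj G x u → ¬ Adj G u w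
            far lu xy s w≢y gu g =
              two-¬Br T (Rotated.deg-y (proj₂ (behind lu xw (other-side T xy xw (w≢y ∘ ≡.sym) s) (girr gu ∘ ≡.sym) (gsym g)))) br
          contra by₁ | no ¬br =
            star free g₁ g₂ (E⇒G T xy₁) (E⇒G T xy₂) ne A.u≢y B.u′≢y A.u′≢y B.u≢y y₁≢y₂
              (leaves-independent min l₁ l₂ ne) (A.y≁u ∘ gsym) (B.y≁u′ ∘ gsym) (A.y≁u′ ∘ gsym) (B.y≁u ∘ gsym)
              (λ g → rotated-leaf (proj₂ (A.y≁ xy₂ y₁≢y₂ g)) A.keep′ (A.u′≢y) g₂)
            where
            two : degree T x ≡ 2
            two = ≤-antisym (≤-pred (≰⇒> ¬br)) (stem-deg≥2 st xy₁)
            by₂ : Branchy T (side T x y₂)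
            by₂ with st (esym T xy₁)
            ... | b , br , s with next T {x} {b} (λ { refl → ¬br br })
            ...   | y , xy , s′ with two-nbrs T two xy₁ xy₂ (y₁≢y₂ ∘ ≡.sym) xy
            ...     | inj₁ refl = ⊥-elim (T≢F s (side-rev-F T xy s′))
            ...     | inj₂ refl = b , br , s′
            module A = Rich l₁ l₂ ne g₁ g₂ xy₁ s₁ xy₂ s₂ y₁≢y₂ by₁
            module B = Rich l₂ l₁ (ne ∘ ≡.sym) g₂ g₁ xy₂ s₂ xy₁ s₁ (y₁≢y₂ ∘ ≡.sym) by₂
          bare₁ : Bare T (side T x y₁)
          bare₁ with bare-or-branchy T (side T x y₁)
          ... | inj₁ ba = ba
          ... | inj₂ by = ⊥-elim (contra by)
          brx : Br T x
          brx with 3 ≤? degree T x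
          ... | yes br = br
          ... | no ¬br with st (esym T xy₂)
          ...   | b , br , s with next T {x} {b} (λ { refl → ¬br br })
          ...     | y , xy , s′ with two-nbrs T (≤-antisym (≤-pred (≰⇒> ¬br)) (stem-deg≥2 st xy₁)) xy₁ xy₂ (y₁≢y₂ ∘ ≡.sym) xy
          ...       | inj₁ refl = ⊥-elim (T≢F s′ (bare₁ br))
          ...       | inj₂ refl = ⊥-elim (T≢F s (side-rev-F T xy s′))

      opaque
        -- By `stem-pair` each of the leaves lies in a direction without branch vertices. The
        -- neighbour of `x` towards another branch vertex therefore completes an induced star.
        stem-triple : NoInsert T → ∀ {x u₁ u₂ u₃} → OnStem T x → Leaf T u₁ → Leaf T u₂ → Leaf T u₃ →
          u₁ ≢ u₂ → u₁ ≢ u₃ → u₂ ≢ u₃ → Adj G x u₁ → Adj G x u₂ → Adj G x u₃ → ⊥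
        stem-triple noins {x} {u₁} {u₂} {u₃} st l₁ l₂ l₃ n₁₂ n₁₃ n₂₃ g₁ g₂ g₃
          with stem-pair noins st l₁ l₂ n₁₂ g₁ g₂ | stem-pair noins st l₂ l₁ (n₁₂ ∘ ≡.sym) g₂ g₁
             | stem-pair noins st l₃ l₁ (n₁₃ ∘ ≡.sym) g₃ g₁ | twoBr T x
        ... | br , y₁ , p₁ | _ , y₂ , p₂ | _ , y₃ , p₃ | b , brb , b≢x with next T {x} {b} (b≢x ∘ ≡.sym)
        ...   | w , xw , sw =
          star free g₁ g₂ g₃ (E⇒G T xw) n₁₂ n₁₃ (u≢w p₁) n₂₃ (u≢w p₂) (u≢w p₃)
            (leaves-independent min l₁ l₂ n₁₂) (leaves-independent min l₁ l₃ n₁₃) (far l₁ p₁ g₁)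
            (leaves-independent min l₂ l₃ n₂₃) (far l₂ p₂ g₂) (far l₃ p₃ g₃)
          where
          Dir : V → V → Set
          Dir u y = Edge T x y × side T x y u ≡ true × Bare T (side T x y)
          w≢y : ∀ {u y} → Dir u y → w ≢ y
          w≢y (xy , s , ba) refl = T≢F sw (ba brb)
          u≢w : ∀ {u y} → Dir u y → u ≢ w
          u≢w (xy , s , ba) refl = w≢y (xy , s , ba) (next-unique T xw xy (shi T xw) s)
          far : ∀ {u y} → Leaf T u → Dir u y → Adj G x u → ¬ Adj G u w
          far lu (xy , s , ba) gu g =
            two-¬Br T (Rotated.deg-y (proj₂ (behind lu xw (other-side T xy xw (w≢y (xy , s , ba) ∘ ≡.sym) s) (girr gu ∘ ≡.sym) (gsym g)))) br

      module _ {u z y} (lu : Leaf T u) (o : Owner T u z y) where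
        open Owner o

        outward : ∀ {x q r v} → side T z y x ≡ true → Edge T x q → side T z y r ≡ false → side T x q r ≡ true →
          side T z y v ≡ false → side T x q v ≡ true
        outward sx xq sr sqr sv = trans (≡.sym (bypass T (scut T zy) sx (flat-side T xq) sr sv)) sqr

        opaque
          -- Every leaf other than `u` lies off the limb, hence in direction `q`. If `u` did too,
          -- the direction of another neighbour of `x` would hold no leaf.
          inward : ∀ {x q r} → side T z y x ≡ true → x ≢ u → Edge T x q → side T z y r ≡ false → side T x q r ≡ true →
            side T x q u ≡ false
          inward {x} {q} sx x≢u xq r∉ sr = ¬T→F back
            where
            back : side T x q u ≡ true → ⊥
            back su with other-nbr T (¬leaf-2 T xq λ lx → x≢u (only sx lx)) q
            ... | w , xw , w≢q with side-leaf T xw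
            ...   | u′ , lu′ , su′ = w≢q (next-unique T xw xq su′ (outward sx xq r∉ sr
                    (¬T→F λ s → w≢q (next-unique T xw xq su′ (subst (λ v → side T x q v ≡ true) (≡.sym (only s lu′)) su)))))

          -- Seen from a vertex of the limb, everything off the limb lies in one direction, so
          -- `same-direction` applies.
          twig-pair : ∀ {x u₁ u₂} → side T z y x ≡ true → Leaf T u₁ → Leaf T u₂ → u₁ ≢ u → u₂ ≢ u → u₁ ≢ u₂ →
            Adj G x u₁ → Adj G x u₂ → ⊥
          twig-pair {x} {u₁} {u₂} sx l₁ l₂ n₁ n₂ ne g₁ g₂ with next T {x} {z} (side-≢ T zy sx)
          ... | q , xq , sq with other-nbr T (¬leaf-2 T xq λ lx → leaves-independent min lx l₁ (girr g₁) g₁) q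
          ...   | w , xw , w≢q = same-direction l₁ l₂ ne g₁ g₂ xq (out l₁ n₁) (out l₂ n₂) xw w≢q
            where
            out : ∀ {v} → Leaf T v → v ≢ u → side T x q v ≡ true
            out lv ne = outward sx xq (slo T zy) sq (¬T→F λ s → ne (only s lv))

    opaque
      twig-owner : ∀ {T x} → Twig T x → ∃[ u ] ∃[ z ] ∃[ y ] (Leaf T u × Owner T u z y × side T z y x ≡ true)
      twig-owner {T} {x} (d , dx , ba) with twoBr T x
      ... | b , br , _ with climb T dx br (ba br)
      ...   | climbed {z} {y} zy brz ⊆ ⊇ with side-leaf T zy
      ...     | u , lu , su with owner {T} {u} lu
      ...       | z′ , y′ , o with owner-unique o zy (scut T zy) brz bare′ su
        where
        bare′ : Bare T (side T z y)
        bare′ br′ = ¬T→F λ s → [ (λ s′ → T≢F s′ (ba br′)) , (λ d → two-¬Br T d br′) ]′ (⊇ s)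
      ...         | refl , refl = u , z′ , y′ , lu , o , ⊆ (shi T dx)

  -- The leaves of the reducible stem, and its only vertex when there is just one branch vertex.
  StemEnd : Tree → V → Set
  StemEnd T w = Br T w × ∃[ p ] (Edge T w p × (∀ {y} → Edge T w y → y ≢ p → Bare T (side T w y)))

  Owns : Tree → V → V → Set
  Owns T w u = StemEnd T w × Leaf T u × ∃[ y ] (Edge T w y × Bare T (side T w y) × side T w y u ≡ true)

  owns-two : ∀ {T w} → StemEnd T w → ∃[ u ] ∃[ u′ ] (Owns T w u × Owns T w u′ × u′ ≢ u)
  owns-two {T} {w} end@(br , p , wp , ba) with third-nbr T br p p
  ... | y , wy , y≢p , _ with third-nbr T br p y
  ...   | y′ , wy′ , y′≢p , y′≢y with side-leaf T wy | side-leaf T wy′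
  ...     | u , lu , su | u′ , lu′ , su′ =
    u , u′ , (end , lu , y , wy , ba wy y≢p , su) , (end , lu′ , y′ , wy′ , ba wy′ y′≢p , su′)
    , λ { refl → y′≢y (next-unique T wy′ wy su′ su) }

  owns-unique : ∀ {T w w′ u} → Owns T w u → Owns T w′ u → w ≡ w′
  owns-unique {T} {w} {w′} ((br , _) , _ , y , wy , ba , s) ((br′ , _) , _ , y′ , wy′ , ba′ , s′) with w ≟ w′
  ... | yes p = p
  ... | no ne = ⊥-elim (disjoint T wy wy′ (scut T wy) (scut T wy′) (ba br′) (ba′ br) (ne ∘ proj₁) s s′)

  opaque
    -- The set `P` is a parameter so that a leaf owned by no stem end can be left out of the count.
    stem-ends-bound : ∀ {T χ} → Indicates (StemEnd T) χ → (P : V → Bool) → (∀ {w u} → Owns T w u → P u ≡ true) →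
      cnt χ + cnt χ ≤ cnt P
    stem-ends-bound {T} {χ} iχ P owned = ≤-stable λ k → ¬¬-All (λ w → indicator (Owns T w)) λ own → k (bound own)
      where
      bound : (∀ w → ∃[ ω ] Indicates (Owns T w) ω) → cnt χ + cnt χ ≤ cnt P
      bound own = double-count (λ w → proj₁ (own w)) χ P
        (λ {w} e → let (u , u′ , o , o′ , ne) = owns-two (to iχ e) in
          cnt≥2 (proj₁ (own w)) (from (proj₂ (own w)) o) (from (proj₂ (own w)) o′) ne)
        (λ {w} h → owned (to (proj₂ (own w)) h))
        (λ {w} {w′} h h′ → owns-unique (to (proj₂ (own w)) h) (to (proj₂ (own w′)) h′))

  -- Consequences of the assumption that every tree has more than `k` stem ends

  module NoGood (k : ℕ) (3≤k : 3 ≤ k)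
    (noGood : ∀ T (χ : V → Bool) → (∀ w → StemEnd T w → χ w ≡ true) → cnt χ ≤ k → ⊥) where

    ends>k : ∀ {T χ} → Indicates (StemEnd T) χ → k < cnt χ
    ends>k {T} {χ} iχ = ≰⇒> (noGood T χ (λ w → from iχ))

    leaves-bound : ∀ T → 2 + (k + k) ≤ ℓ T
    leaves-bound T = ≤-stable λ few → indicator (StemEnd T) λ { (χ , iχ) →
      <⇒≱ (ends>k iχ) (half (≤-trans (stem-ends-bound iχ (leaf? T) (λ o → leaf-T T (proj₁ (proj₂ o)))) (≤-pred (≰⇒> few)))) }

    ends≤ : ∀ {T χ} → Indicates (StemEnd T) χ → ℓ T ≤ 2 + (k + k) → cnt χ ≤ suc k
    ends≤ {T} {χ} iχ h with cnt χ ≤? suc k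
    ... | yes p = p
    ... | no ¬p = ⊥-elim (<-irrefl refl (≤-trans (s≤s h) (≤-trans (lem k)
       (≤-trans (+-mono-≤ (≰⇒> ¬p) (≰⇒> ¬p)) (stem-ends-bound iχ (leaf? T) (λ o → leaf-T T (proj₁ (proj₂ o))))))))
      where lem : ∀ k → 3 + (k + k) ≤ (2 + k) + (2 + k)
            lem k = ≤-trans (n≤1+n _) (≤-reflexive (cong (λ j → suc (suc j)) (≡.sym (trans (+-suc k (suc k)) (cong suc (+-suc k k))))))

    -- The hypothesis `3 ≤ k` enters here: there are at least four stem ends.
    avoid-three : ∀ T a b c → ¬ ¬ (∃[ w ] (StemEnd T w × w ≢ a × w ≢ b × w ≢ c))
    avoid-three T a b c none = indicator (StemEnd T) λ { (χ , iχ) →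
      let (w , e , p , q , r) = cnt-fourth χ (≤-trans (s≤s 3≤k) (ends>k iχ)) a b c in none (w , to iχ e , p , q , r) }

    twoBr : ∀ T (x : V) → ∃[ b ] (Br T b × b ≢ x)
    twoBr T x = decidable-stable (any? λ b → (3 ≤? degree T b) ×-dec ¬? (b ≟ x)) λ none →
      avoid-three T x x x λ { (w , (br , _) , w≢x , _) → none (w , br , w≢x) }

    opaque
      -- More than k stem ends own two leaves each, which uses up all 2k + 2 leaves; here the leaf behind q is spare.
      loose : ∀ {T x q g} → ℓ T ≤ 2 + (k + k) → Edge T x q → Cut T x q g → Bare T g → Splits T x → ⊥
      loose {T} {x} {q} {g} few xq cg bare (splits {f} {b₁} {b₂} fl br₁ br₂ n₁ n₂ f₁ f₂) with side-leaf T xq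
      ... | u , lu , su = indicator (StemEnd T) λ { (χ , iχ) →
          <⇒≱ (ends>k iχ) (half (≤-trans (stem-ends-bound iχ (leaf? T ∖ u) unowned)
            (≤-pred (≤-trans (≤-reflexive (≡.sym (cnt-remove (leaf? T) u (leaf-T T lu)))) few)))) }
        where
        gu : g u ≡ true
        gu = trans (cut-unique T cg (scut T xq) u) su
        same : f b₁ ≢ f b₂
        same e = T≢F (trans (≡.sym e) f₁) f₂
        not-u : ∀ {w} → Owns T w u → ⊥
        not-u {w} ((brw , p , wp , ends) , _ , y , wy , ba , s) with w ≟ x | bool (side T w y x)
        -- At a stem end all other branch vertices lie in the direction of `p`, so deleting it
        -- separates no two of them.
        ... | yes refl | _ = same (bypass′ T (scut T wp) (slo T wp) fl (toward br₁ n₁) (toward br₂ n₂))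
          where
          toward : ∀ {b} → Br T b → b ≢ w → side T w p b ≡ true
          toward {b} br ne with next T (ne ∘ ≡.sym)
          ... | y′ , wy′ , s′ with y′ ≟ p
          ...   | yes refl = s′
          ...   | no y′≢p = ⊥-elim (T≢F s′ (ends wy′ y′≢p br))
        ... | no _ | inj₁ sx = same (bypass T (scut T wy) sx fl (ba br₁) (ba br₂))
        ... | no ne | inj₂ sx = disjoint T wy xq (scut T wy) cg sx (bare brw) (ne ∘ proj₁) s gu
        unowned : ∀ {w v} → Owns T w v → (leaf? T ∖ u) v ≡ true
        unowned o = ∖-intro (leaf? T) (leaf-T T (proj₁ (proj₂ o))) (λ { refl → not-u o })

  -- Charging the degree sum on leaf-branch paths

  module Limbs (free : K14Free G) (twoBr : ∀ T (x : V) → ∃[ b ] (Br T b × b ≢ x)) where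
    open Claws free twoBr public

    OnLimb : Tree → V → V → Set
    OnLimb T u x = Leaf T u × ∃[ z ] ∃[ y ] (Owner T u z y × side T z y x ≡ true)

    Top : Tree → V → Set
    Top T x = ∃[ z ] (Edge T z x × Br T z × Bare T (side T z x))

    module _ {T : Tree} where

      same-top : ∀ {u z y z′ y′ x} → Owner T u z y → side T z y x ≡ true → Edge T z′ y′ → Br T z′ → Bare T (side T z′ y′) →
        side T z′ y′ x ≡ true → z ≡ z′ × y ≡ y′
      same-top {z = z} {y} {z′} {y′} o s e br ba s′ with (z ≟ z′) ×-dec (y ≟ y′)
      ... | yes p = p
      ... | no ne = ⊥-elim (disjoint T zy e (scut T zy) (scut T e) (bare br) (ba brz) ne s s′)
        where open Owner o

      limb-unique : ∀ {u u′ x} → OnLimb T u x → OnLimb T u′ x → u ≡ u′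
      limb-unique (lu , z , y , o , s) (lu′ , z′ , y′ , o′ , s′) with same-top o s (Owner.zy o′) (Owner.brz o′) (Owner.bare o′) s′
      ... | refl , refl = Owner.only o′ (Owner.in-u o) lu

      limb-owner : ∀ {u x z y} → OnLimb T u x → Owner T u z y → side T z y x ≡ true
      limb-owner (lu , z , y , o , s) o′ with same-top o (Owner.in-u o) (Owner.zy o′) (Owner.brz o′) (Owner.bare o′) (Owner.in-u o′)
      ... | refl , refl = s

      ¬limb-owner : ∀ {u x z y} → Leaf T u → Owner T u z y → ¬ OnLimb T u x → side T z y x ≡ false
      ¬limb-owner lu o h = ¬T→F λ s → h (lu , _ , _ , o , s)

      twig-limb : ∀ {x} → Twig T x → ∃[ u ] OnLimb T u x
      twig-limb tw with twig-owner tw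
      ... | u , z , y , lu , o , s = u , lu , z , y , o , s

      side-twig : ∀ {z y x} → Edge T z y → Bare T (side T z y) → side T z y x ≡ true → Twig T x
      side-twig {z} {y} {x} zy bare s with next T {x} {z} (side-≢ T zy s)
      ... | d , xd , sd = d , esym T xd , λ br → side-rev-F T xd
        (trans (≡.sym (bypass T (scut T zy) s (flat-side T xd) (slo T zy) (bare br))) sd)

      limb-twig : ∀ {u x} → OnLimb T u x → Twig T x
      limb-twig (lu , z , y , o , s) = side-twig (Owner.zy o) (Owner.bare o) s

      stem-limb : ∀ {u x} → OnStem T x → ¬ OnLimb T u x
      stem-limb st l with limb-twig l
      ... | d , dx , ba = ¬bare-branchy T ba (st dx)

    -- The set `S` is abstract because the estimate serves twice, for leaves alone and for the
    -- leaves together with a hub. The branch vertex `r` only orients the limbs: `side T x q r` says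
    -- that `q` follows `x` on the way to the stem.
    module TwigSum {T : Tree} (min : Min T) {r : V} (brr : Br T r) (S : V → Bool)
      (one-foreign : ∀ {x v v′} → Twig T x → S v ≡ true → S v′ ≡ true → v ≢ v′ → Adj G v x → Adj G v′ x →
        ¬ OnLimb T v x → ¬ OnLimb T v′ x → ⊥)
      (top-foreign : ∀ {x v} → Top T x → S v ≡ true → Adj G v x → ¬ OnLimb T v x → ⊥)
      (shifted-foreign : ∀ {x q u v} → OnLimb T u x → OnLimb T u q → Edge T x q → side T x q r ≡ true → S u ≡ true → Adj G u q →
        S v ≡ true → Adj G v x → ¬ OnLimb T v x → ⊥) where

      -- An edge from u to a vertex of its own limb is charged to the predecessor of that vertex, every other edge to
      -- its endpoint. Then a limb vertex is charged at most once and the top of a limb never.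
      Own Shifted Foreign : V → Set
      Own x = ∃[ u ] (S u ≡ true × OnLimb T u x × Adj G u x)
      Shifted x = ∃[ u ] ∃[ q ] (S u ≡ true × Adj G u q × Edge T x q × side T x q r ≡ true × OnLimb T u x × OnLimb T u q)
      Foreign x = Twig T x × ∃[ v ] (S v ≡ true × Adj G v x × ¬ OnLimb T v x)

      shift : ∀ {x} → Own x → ∃[ q ] (Shifted q × (Edge T q x × side T q x r ≡ true))
      shift {x} (u , Su , (lu , z , y , o , sx) , gux) with next T {x} {u} (girr gux ∘ ≡.sym)
      ... | q , xq , sq = q , (u , x , Su , gux , esym T xq , sr , (lu , z , y , o , sq′) , (lu , z , y , o , sx)) , (esym T xq , sr)
        where
        open Owner o
        sq′ : side T z y q ≡ true
        sq′ = ¬F→T λ f → lem (crossing T (scut T zy) (esym T xq) f sx)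
          where lem : q ≡ z × x ≡ y → ⊥
                lem (refl , refl) = T≢F in-u (side-rev-F T xq sq)
        sr : side T q x r ≡ true
        sr = side-rev-T T xq (¬T→F λ s → T≢F sq (inward min lu o sx (girr gux ∘ ≡.sym) xq (bare brr) s))

      own≤shifted : ∀ {a a′} → Indicates Own a → Indicates Shifted a′ → cnt a ≤ cnt a′
      own≤shifted ia ia′ = cnt-inj (λ x q → Edge T q x × side T q x r ≡ true)
        (λ h no → let (q , sh , p) = shift (to ia h) in no (q , from ia′ sh , p))
        (λ _ _ (e , s) (e′ , s′) → next-unique T e e′ s s′)

      leaves≤tops : ∀ {t} → Indicates (Top T) t → ℓ T ≤ cnt t
      leaves≤tops it = cnt-inj (λ u y → Leaf T u × ∃[ z ] Owner T u z y)
        (λ h no → let lu = T-leaf T h ; (z , y , o) = owner {T} lu in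
           no (y , from it (z , Owner.zy o , Owner.brz o , Owner.bare o) , lu , z , o))
        (λ _ _ (lu , z , o) (lu′ , z′ , o′) → limb-unique
           (lu , z , _ , o , shi T (Owner.zy o)) (lu′ , z′ , _ , o′ , shi T (Owner.zy o′)))

      -- From the top of a limb the next vertex towards `r` is the branch vertex, which is off the
      -- limb, while a shifted charge has `q` on the limb.
      shifted-not-top : ∀ {x} → Shifted x → Top T x → ⊥
      shifted-not-top {x} (u , q , _ , _ , xq , sr , (lu , z , y , o , sx) , lq) (z′ , zx , brz′ , ba)
        with same-top o sx zx brz′ ba (shi T zx)
      ... | refl , refl with next-unique T xq (esym T zx) sr (side-rev-T T zx (ba brr))
      ...   | refl = T≢F (limb-owner lq o) (slo T zx)

      module _ {tw : V → Bool} (itw : Indicates (Twig T) tw) where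

        off : V → ℕ
        off x = weight (not (tw x)) (hits G S x)

        at-twig : ∀ {a c x} → Indicates Own a → Indicates Foreign c → Twig T x → hits G S x ≤ ind (a x) + ind (c x)
        at-twig {a} {c} {x} ia ic tx = ≤-stable λ no → indicator (λ v → OnLimb T v x) λ { (o , io) → no (begin
          hits G S x                                       ≡⟨ cnt-split P o ⟩
          cnt (λ v → P v ∧ o v) + cnt (λ v → P v ∧ not (o v))
            ≤⟨ +-mono-≤
                 (cnt≤ind (λ v → P v ∧ o v) (λ {w} h → from ia (w , ∧-T₁ (∧-T₁ h) , to io (∧-T₂ {P w} h) , ∧-T₂ {S w} (∧-T₁ h)))
                   (λ {w} {w′} h h′ → limb-unique (to io (∧-T₂ {P w} h)) (to io (∧-T₂ {P w′} h′))))
                 (cnt≤ind (λ v → P v ∧ not (o v)) (λ {w} h → from ic (tx , w , ∧-T₁ (∧-T₁ h) , ∧-T₂ {S w} (∧-T₁ h) , off-limb io (∧-T₂ {P w} h)))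
                   (λ {w} {w′} h h′ → same io h h′)) ⟩
          ind (a x) + ind (c x)                            ∎) }
          where
          open ≤-Reasoning
          P : V → Bool
          P v = S v ∧ adj G v x
          off-limb : ∀ {o v} → Indicates (λ v → OnLimb T v x) o → not (o v) ≡ true → ¬ OnLimb T v x
          off-limb io h l = T≢F (from io l) (not-T h)
          same : ∀ {o w w′} → Indicates (λ v → OnLimb T v x) o → P w ∧ not (o w) ≡ true → P w′ ∧ not (o w′) ≡ true → w ≡ w′
          same {o} {w} {w′} io h h′ with w ≟ w′
          ... | yes p = p
          ... | no ne = ⊥-elim (one-foreign tx (∧-T₁ (∧-T₁ h)) (∧-T₁ (∧-T₁ h′)) ne (∧-T₂ {S w} (∧-T₁ h)) (∧-T₂ {S w′} (∧-T₁ h′))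
                          (off-limb io (∧-T₂ {P w} h)) (off-limb io (∧-T₂ {P w′} h′)))

        per-vertex : ∀ {a c} → Indicates Own a → Indicates Foreign c → ∀ x → hits G S x ≤ ind (a x) + (ind (c x) + off x)
        per-vertex {a} {c} ia ic x with bool (tw x)
        ... | inj₁ t = ≤-trans (at-twig ia ic (to itw t)) (+-monoʳ-≤ (ind (a x)) (m≤m+n (ind (c x)) (off x)))
        ... | inj₂ f = ≤-trans (≤-reflexive (≡.sym (cong (λ b → weight (not b) (hits G S x)) f)))
                         (≤-trans (m≤n+m (off x) (ind (c x))) (m≤n+m (ind (c x) + off x) (ind (a x))))

        -- The three kinds of marks exclude one another at a vertex. Summed over a limb this is the
        -- bound by its length minus one, the top being kept free.
        capacity : ∀ {a′ c t} → Indicates Shifted a′ → Indicates Foreign c → Indicates (Top T) t → ∀ x →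
          ind (a′ x) + (ind (c x) + ind (t x)) ≤ ind (tw x)
        capacity {a′} {c} {t} ia ic it x = at-most-one (a′ x) (c x) (t x) (tw x)
          (λ h → let (_ , _ , _ , _ , _ , _ , l , _) = to ia h in from itw (limb-twig l))
          (λ h → from itw (proj₁ (to ic h)))
          (λ h → let (z , zx , br , ba) = to it h in from itw (side-twig zx ba (shi T zx)))
          (λ p q → let (u , y , Su , g , e , s , l , l′) = to ia p ; (_ , v , Sv , g′ , nl) = to ic q in
                   shifted-foreign l l′ e s Su g Sv g′ nl)
          (λ p q → shifted-not-top (to ia p) (to it q))
          (λ p q → let (_ , v , Sv , g′ , nl) = to ic p in top-foreign (to it q) Sv g′ nl)
          where
          at-most-one : ∀ a b c d → (a ≡ true → d ≡ true) → (b ≡ true → d ≡ true) → (c ≡ true → d ≡ true) →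
            (a ≡ true → b ≡ true → ⊥) → (a ≡ true → c ≡ true → ⊥) → (b ≡ true → c ≡ true → ⊥) →
            ind a + (ind b + ind c) ≤ ind d
          at-most-one false false false d p q r u v w = z≤n
          at-most-one true  false false d p q r u v w rewrite p refl = ≤-refl
          at-most-one false true  false d p q r u v w rewrite q refl = ≤-refl
          at-most-one false false true  d p q r u v w rewrite r refl = ≤-refl
          at-most-one true  true  c     d p q r u v w = ⊥-elim (u refl refl)
          at-most-one true  false true  d p q r u v w = ⊥-elim (v refl refl)
          at-most-one false true  true  d p q r u v w = ⊥-elim (w refl refl)

        sum3 : ∀ (f g h : V → ℕ) → sum (λ x → f x + (g x + h x)) ≡ sum f + (sum g + sum h)
        sum3 f g h = trans (∑-distrib-+ f (λ x → g x + h x)) (cong (sum f +_) (∑-distrib-+ g h))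

        opaque
          -- The term `ℓ T` is the saving of one vertex on each limb, namely its top.
          twig-sum : sum (hits G S) + ℓ T ≤ cnt tw + sum off
          twig-sum = ≤-stable λ no → indicator Own λ { (a , ia) → indicator Shifted λ { (a′ , ia′) → indicator Foreign λ { (c , ic) →
            indicator (Top T) λ { (t , it) → no (begin
              sum (hits G S) + ℓ T
                ≤⟨ +-mono-≤ (sum-mono (per-vertex ia ic)) (leaves≤tops it) ⟩
              sum (λ x → ind (a x) + (ind (c x) + off x)) + cnt t
                ≡⟨ cong (_+ cnt t) (trans (sum3 (ind ∘ a) (ind ∘ c) off) (≡.sym (cong₂ (λ i j → i + (j + sum off)) (cnt-sum a) (cnt-sum c)))) ⟩
              cnt a + (cnt c + sum off) + cnt t
                ≤⟨ +-monoˡ-≤ (cnt t) (+-monoˡ-≤ (cnt c + sum off) (own≤shifted ia ia′)) ⟩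
              cnt a′ + (cnt c + sum off) + cnt t
                ≡⟨ lem (cnt a′) (cnt c) (sum off) (cnt t) ⟩
              cnt a′ + (cnt c + cnt t) + sum off
                ≤⟨ +-monoˡ-≤ (sum off) (begin
                     cnt a′ + (cnt c + cnt t)     ≡⟨ cong₂ (λ i j → i + j) (cnt-sum a′) (cong₂ _+_ (cnt-sum c) (cnt-sum t)) ⟩
                     sum (ind ∘ a′) + (sum (ind ∘ c) + sum (ind ∘ t)) ≡⟨ sum3 (ind ∘ a′) (ind ∘ c) (ind ∘ t) ⟨
                     sum (λ x → ind (a′ x) + (ind (c x) + ind (t x))) ≤⟨ sum-mono (capacity ia′ ic it) ⟩
                     sum (ind ∘ tw)               ≡⟨ cnt-sum tw ⟨
                     cnt tw                       ∎) ⟩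
              cnt tw + sum off ∎) } } } }
            where
            open ≤-Reasoning
            lem : ∀ a c s t → a + (c + s) + t ≡ a + (c + t) + s
            lem = solve-∀

  -- Degree sums of leaves only

  module ManyLeaves (free : K14Free G) (twoBr : ∀ T (x : V) → ∃[ b ] (Br T b × b ≢ x)) where
    open Limbs free twoBr public

    module _ {T : Tree} (min : Min T) where

      limb-leaf-exit : ∀ {x v u z y} → Leaf T v → Leaf T u → Owner T u z y → side T z y x ≡ true → v ≢ u → ¬ Edge T x v
      limb-leaf-exit {x} {v} lv lu o sx v≢u xv with crossing T (scut T (Owner.zy o)) (esym T xv) (¬T→F λ s → v≢u (Owner.only o s lv)) sx
      ... | refl , _ = leaf-¬Br T lv (Owner.brz o)

      -- Joining `x` to `v` would delete the edge `x z`, and a rotation allows this only if `z` has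
      -- degree two.
      top-leaf : ∀ {x v} → Top T x → Leaf T v → Adj G v x → ¬ OnLimb T v x → ⊥
      top-leaf {x} {v} (z , zx , brz , ba) lv g nl = two-¬Br T (Rotated.deg-y (proj₂ (rotate min lv (gsym g) nxv (esym T zx) sv))) brz
        where
        out : side T z x v ≡ false
        out with owner {T} lv
        ... | z′ , y′ , o = ¬T→F λ s → nl (lv , z′ , y′ , o , inside o s (owner-unique o zx (scut T zx) brz ba s))
          where
          inside : ∀ {z′ y′} → Owner T v z′ y′ → side T z x v ≡ true → z′ ≡ z × y′ ≡ x → side T z′ y′ x ≡ true
          inside o s (refl , refl) = shi T zx
        nxv : ¬ Edge T x v
        nxv e with crossing T (scut T zx) (esym T e) out (shi T zx)
        ... | refl , _ = leaf-¬Br T lv brz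
        sv : side T x z v ≡ true
        sv = side-rev-T T zx out

      foreign-leaves : ∀ {x v v′} → Twig T x → Leaf T v → Leaf T v′ → v ≢ v′ → Adj G v x → Adj G v′ x →
        ¬ OnLimb T v x → ¬ OnLimb T v′ x → ⊥
      foreign-leaves tw lv lv′ ne g g′ nl nl′ with twig-limb {T} tw
      ... | u , l@(lu , z , y , o , s) = twig-pair min lu o s lv lv′ (λ { refl → nl l }) (λ { refl → nl′ l }) ne (gsym g) (gsym g′)

      -- The leaf `v` lies in direction `q` from `x`. Rotating it to `x` turns `q` into a leaf,
      -- which must not see the leaf `u`.
      shifted-leaf : ∀ {r} → Br T r → ∀ {x q u v} → OnLimb T u x → Edge T x q → side T x q r ≡ true → Adj G u q →
        Leaf T v → Adj G v x → ¬ OnLimb T v x → ⊥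
      shifted-leaf brr {x} {q} {u} {v} l@(lu , z , y , o , s) xq sr guq lv gvx nl =
        next-no-leaf min lv (gsym gvx) (limb-leaf-exit lv lu o s v≢u) xq
          (outward min lu o s xq (Owner.bare o brr) sr (¬T→F λ s′ → v≢u (Owner.only o s′ lv))) lu (v≢u ∘ ≡.sym) (gsym guq)
        where
        v≢u : v ≢ u
        v≢u refl = nl l

    module _ {T : Tree} (min : Min T) (noins : NoInsert T) {r : V} (brr : Br T r) where

      leaf-owner-at : ∀ {x u u′} → OnStem T x → Leaf T u → Leaf T u′ → u ≢ u′ → Adj G x u → Adj G x u′ →
        ∃[ y ] Owner T u x y
      leaf-owner-at st lu lu′ ne g g′ with stem-pair min noins st lu lu′ ne g g′ | owner {T} lu
      ... | br , y , xy , s , ba | z , y′ , o with owner-unique o xy (scut T xy) br ba s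
      ...   | refl , refl = y , o

      opaque
        -- A stem vertex sees at most two vertices of `S`. If it sees two, their leaf-branch paths
        -- both hang from it, so these vertices use up disjoint pairs of `S`, and there are at most
        -- `m` of them. Each costs one unit beyond the one that every stem vertex may spend.
        many-leaves : ∀ {m} (S : V → Bool) → (∀ {v} → S v ≡ true → Leaf T v) → cnt S ≤ suc (m + m) →
          sum (hits G S) + ℓ T ≤ n + m
        many-leaves {m} S leaf size = ≤-stable λ no → indicator (Twig T) λ { (tw , itw) →
          indicator (λ x → OnStem T x × 2 ≤ hits G S x) λ { (e , ie) →
          ¬¬-All (λ x → indicator (λ u → S u ≡ true × ∃[ y ] Owner T u x y)) λ own → no (begin
            sum (hits G S) + ℓ T          ≤⟨ twig-sum itw ⟩
            cnt tw + sum (off itw)        ≤⟨ +-monoʳ-≤ (cnt tw) (sum-mono (stem itw ie)) ⟩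
            cnt tw + sum (λ x → ind (not (tw x)) + ind (e x))
              ≡⟨ cong (cnt tw +_) (trans (∑-distrib-+ (ind ∘ not ∘ tw) (ind ∘ e)) (≡.sym (cong₂ _+_ (cnt-sum (not ∘ tw)) (cnt-sum e)))) ⟩
            cnt tw + (cnt (not ∘ tw) + cnt e)   ≡⟨ +-assoc (cnt tw) _ _ ⟨
            cnt tw + cnt (not ∘ tw) + cnt e     ≡⟨ cong (_+ cnt e) (cnt-not tw) ⟩
            n + cnt e                           ≤⟨ +-monoʳ-≤ n (half (≤-trans (pairs ie own) size)) ⟩
            n + m                               ∎) } }
          where
          open ≤-Reasoning
          open TwigSum min brr S (λ tw s s′ → foreign-leaves min tw (leaf s) (leaf s′)) (λ t s → top-leaf min t (leaf s))
            (λ l l′ e s Su g Sv → shifted-leaf min brr l e s g (leaf Sv))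
          stem : ∀ {tw e} (itw : Indicates (Twig T) tw) → Indicates (λ x → OnStem T x × 2 ≤ hits G S x) e → ∀ x →
            off itw x ≤ ind (not (tw x)) + ind (e x)
          stem {tw} {e} itw ie x with bool (tw x)
          ... | inj₁ t = subst (λ b → weight (not b) (hits G S x) ≤ ind (not b) + ind (e x)) (≡.sym t) z≤n
          ... | inj₂ f = subst (λ b → weight (not b) (hits G S x) ≤ ind (not b) + ind (e x)) (≡.sym f) bound
            where
            st : OnStem T x
            st with twig-or-stem T x
            ... | inj₁ t = ⊥-elim (T≢F (from itw t) f)
            ... | inj₂ s = s
            P : V → Bool
            P v = S v ∧ adj G v x
            bound : hits G S x ≤ 1 + ind (e x)
            bound with 2 ≤? hits G S x
            ... | no ¬2 = ≤-trans (≤-pred (≰⇒> ¬2)) (s≤s z≤n)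
            ... | yes 2≤ with 3 ≤? hits G S x
            ...   | no ¬3 = ≤-trans (≤-pred (≰⇒> ¬3)) (≤-reflexive (≡.sym (cong (λ b → suc (ind b)) (from ie (st , 2≤)))))
            ...   | yes 3≤ with cnt-pick3 P 3≤
            ...     | a , b , c , pa , pb , pc , ab , ac , bc = ⊥-elim (stem-triple min noins st (leaf (∧-T₁ pa)) (leaf (∧-T₁ pb))
                        (leaf (∧-T₁ pc)) ab ac bc (gsym (∧-T₂ {S a} pa)) (gsym (∧-T₂ {S b} pb)) (gsym (∧-T₂ {S c} pc)))
          pairs : ∀ {e} → Indicates (λ x → OnStem T x × 2 ≤ hits G S x) e →
            (∀ x → ∃[ ω ] Indicates (λ u → S u ≡ true × ∃[ y ] Owner T u x y) ω) → cnt e + cnt e ≤ cnt S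
          pairs {e} ie own = double-count ω e S two (λ {x} h → proj₁ (to (iω x) h)) λ {x} {x′} h h′ →
            let (_ , y , o) = to (iω x) h ; (_ , y′ , o′) = to (iω x′) h′ in
            proj₁ (owner-unique o (Owner.zy o′) (scut T (Owner.zy o′)) (Owner.brz o′) (Owner.bare o′) (Owner.in-u o′))
            where
            ω : V → V → Bool
            ω x = proj₁ (own x)
            iω : ∀ x → Indicates (λ u → S u ≡ true × ∃[ y ] Owner T u x y) (ω x)
            iω x = proj₂ (own x)
            two : ∀ {x} → e x ≡ true → 2 ≤ cnt (ω x)
            two {x} t with to ie t
            ... | st , 2≤ with cnt-pick2 (λ v → S v ∧ adj G v x) 2≤
            ...   | a , b , pa , pb , b≢a = cnt≥2 (ω x)
                (from (iω x) (∧-T₁ pa , leaf-owner-at st (leaf (∧-T₁ pa)) (leaf (∧-T₁ pb)) (b≢a ∘ ≡.sym) (gsym (∧-T₂ {S a} pa)) (gsym (∧-T₂ {S b} pb))))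
                (from (iω x) (∧-T₁ pb , leaf-owner-at st (leaf (∧-T₁ pb)) (leaf (∧-T₁ pa)) b≢a (gsym (∧-T₂ {S b} pb)) (gsym (∧-T₂ {S a} pa)))) b≢a

  -- The branch vertices that are not stem ends.
  Hub : Tree → V → Set
  Hub T s = Br T s × Splits T s

  -- Trees with exactly `2k + 2` leaves: what a hub sees on leaf-branch paths

  module Hubs (free : K14Free G) (k : ℕ) (3≤k : 3 ≤ k)
    (noGood : ∀ T (χ : V → Bool) → (∀ w → StemEnd T w → χ w ≡ true) → cnt χ ≤ k → ⊥) where
    open NoGood k 3≤k noGood public
    open ManyLeaves free twoBr public

    -- By leaves-bound such a tree has exactly 2k + 2 leaves.
    Few : Tree → Set
    Few T = ℓ T ≤ 2 + (k + k)

    few-min : ∀ {T} → Few T → Min T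
    few-min few T′ = ≤-trans few (leaves-bound T′)

    1≢3+ : ∀ {j} → 3 ≤ suc j → j ≢ 1
    1≢3+ (s≤s (s≤s ())) refl

    module _ {T : Tree} (few : Few T) where

      opaque
        -- Hanging the end of a bare side on x makes the side a bare direction of x.
        attach : ∀ {z y g q x f b₁ b₂} → Edge T z y → Cut T z y g → Br T z → Bare T g → g q ≡ true → Leaf T q ⊎ q ≡ y →
          g x ≡ false → x ≢ z → Adj G x q → Flat T x f → Br T b₁ → Br T b₂ → b₁ ≢ x → b₂ ≢ x → b₁ ≢ z → b₂ ≢ z →
          f b₁ ≡ true → f b₂ ≡ false → ⊥
        attach {z} {y} {g} {q} {x} {f} {b₁} {b₂} zy cg brz ba gq lq gx x≢z gxq fl br₁ br₂ n₁ n₂ m₁ m₂ f₁ f₂ =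
          loose (≤-trans le few) new cut* bare* (splits (flat-keep S fl (λ p → ⊥-elim (p refl))) (br* br₁ n₁ m₁) (br* br₂ n₂ m₂) n₁ n₂ f₁ f₂)
          where
          on-side : ∀ v → side T z y v ≡ g v
          on-side = cut-unique T (scut T zy) cg
          sw : ∃[ T′ ] Swapped T x q z y T′
          sw = swap T zy (trans (on-side x) gx) (trans (on-side q) gq) gxq (x≢z ∘ proj₁)
          T* : Tree
          T* = proj₁ sw
          S : Swapped T x q z y T*
          S = proj₂ sw
          open Swapped S
          apart : ∀ {v w} → g v ≡ true → g w ≡ false → v ≢ w
          apart gv gw refl = T≢F gv gw
          q≢x : q ≢ x
          q≢x = apart gq gx
          q≢z : q ≢ z
          q≢z = apart gq (lo cg)
          y≢x : y ≢ x
          y≢x = apart (hi cg) gx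
          y≢z : y ≢ z
          y≢z = apart (hi cg) (lo cg)
          deg-z : suc (degree T* z) ≡ degree T z
          deg-z = +1-0 (deg-at S (δ-10 refl (y≢z ∘ ≡.sym)) (δ-00 (x≢z ∘ ≡.sym) (q≢z ∘ ≡.sym)))
          deg-x : degree T* x ≡ suc (degree T x)
          deg-x = +0-1 (deg-at S (δ-00 x≢z (y≢x ∘ ≡.sym)) (δ-10 refl (q≢x ∘ ≡.sym)))
          deg-qy : q ≡ y → degree T* y ≡ degree T y
          deg-qy refl = +1-inj (deg-at S (δ-01 y≢z refl) (δ-01 q≢x refl))
          deg-y : q ≢ y → suc (degree T* y) ≡ degree T y
          deg-y ne = +1-0 (deg-at S (δ-01 y≢z refl) (δ-00 y≢x (ne ∘ ≡.sym)))
          deg-q : q ≢ y → degree T* q ≡ suc (degree T q)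
          deg-q ne = +0-1 (deg-at S (δ-00 q≢z ne) (δ-01 q≢x refl))
          leaf-q : q ≢ y → Leaf T q
          leaf-q ne = [ id , ⊥-elim ∘ ne ]′ lq
          two-q : q ≢ y → degree T* q ≡ 2
          two-q ne = trans (deg-q ne) (cong suc (leaf-q ne))
          old : ∀ {v} → Leaf T* v → v ≢ y → Leaf T v
          old {v} l v≢y with v ≟ z | v ≟ x | v ≟ q
          ... | yes refl | _ | _ = ⊥-elim (1≢3+ (subst (3 ≤_) (≡.sym deg-z) brz) l)
          ... | no _ | yes refl | _ = ⊥-elim (lem (≤-trans (deg≥1 T (proj₁ (proj₂ (next T x≢z)))) (≤-reflexive (suc-injective (trans (≡.sym deg-x) l)))))
            where lem : ¬ (1 ≤ 0)
                  lem ()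
          ... | no _ | no _ | yes refl = leaf-q v≢y
          ... | no a | no b | no c = trans (≡.sym (untouched S b c a v≢y)) l
          le : ℓ T* ≤ ℓ T
          -- If `q` is `y`, the limb is moved as it stands. If `q` is its leaf, the limb is reversed
          -- and `y` becomes the leaf.
          le with q ≟ y
          ... | yes q≡y = cnt-mono λ v h → leaf-T T (all (T-leaf T* h))
            where
            all : ∀ {v} → Leaf T* v → Leaf T v
            all {v} l with v ≟ y
            ... | yes refl = trans (≡.sym (deg-qy q≡y)) l
            ... | no v≢y = old l v≢y
          ... | no q≢y = leaves-≤ {T} {T*} old (leaf-q q≢y) λ _ l → 1≢2 (trans (≡.sym l) (two-q q≢y))
          br* : ∀ {b} → Br T b → b ≢ x → b ≢ z → Br T* b
          br* {b} br b≢x b≢z = subst (3 ≤_) (≡.sym (untouched S b≢x (off gq) b≢z (off (hi cg)))) br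
            where
            off : ∀ {v} → g v ≡ true → b ≢ v
            off gv refl = T≢F gv (ba br)
          cut* : Cut T* x q g
          cut* = record { lo = gx ; hi = gq ; flat = fl* }
            where
            fl* : ∀ {p r} → Edge T* p r → ¬ Same p r x q → g p ≡ g r
            fl* e ns with inv e
            ... | inj₁ (e′ , ns′) = flat cg e′ ns′
            ... | inj₂ s = ⊥-elim (ns s)
          bare* : Bare T* g
          bare* {b} br = ¬T→F λ gb → contra gb
            where
            contra : g b ≡ true → ⊥
            contra gb with b ≟ y | q ≟ y
            ... | yes refl | yes q≡y = T≢F gb (ba (subst (3 ≤_) (deg-qy q≡y) br))
            ... | yes refl | no q≢y = T≢F gb (ba (≤-trans br (≤-trans (n≤1+n _) (≤-reflexive (deg-y q≢y)))))
            ... | no b≢y | q≟y with b ≟ q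
            ...   | yes refl = two-¬Br T* (two-q b≢y) br
            ...   | no b≢q = T≢F gb (ba (subst (3 ≤_) (untouched S (apart gb gx) b≢q (apart gb (lo cg)) b≢y) br))

      hub-branchy : ∀ {s y} → Hub T s → Edge T s y → Branchy T (side T s y)
      hub-branchy {s} {y} (br , sp) sy with bare-or-branchy T (side T s y)
      ... | inj₁ ba = ⊥-elim (loose few sy (scut T sy) ba sp)
      ... | inj₂ by = by

    -- A separation at the hub `s` that survives an exchange at `v` and `w`: both lie on the same
    -- side, and `v`, which may lose an edge, is not one of the two branch vertices.
    record Away (T : Tree) (s v w : V) : Set where
      field
        {f} : V → Bool
        {b₁ b₂} : V
        flat-f : Flat T s f
        br₁ : Br T b₁
        br₂ : Br T b₂
        b₁≢s : b₁ ≢ s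
        b₂≢s : b₂ ≢ s
        b₁≢v : b₁ ≢ v
        b₂≢v : b₂ ≢ v
        f-b₁ : f b₁ ≡ true
        f-b₂ : f b₂ ≡ false
        f-v : f v ≡ false
        f-w : f w ≡ false

    opaque
      -- A hub has at least three directions, each with a branch vertex by `hub-branchy`. The
      -- direction used for `f` avoids both `v` and `w`, and a further one avoids `v`.
      away : ∀ {T s v} → Few T → Hub T s → v ≢ s → ∀ w → Away T s v w
      away {T} {s} {v} few h@(br , _) v≢s w with next T (v≢s ∘ ≡.sym) | toward w
        where
        toward : ∀ w → ∃[ y ] (∀ {y′} → Edge T s y′ → y′ ≢ y → side T s y′ w ≡ false)
        toward w with s ≟ w
        ... | yes refl = s , λ e _ → slo T e
        ... | no ne with next T ne
        ...   | y , sy , sw = y , λ e y′≢y → other-side T sy e (y′≢y ∘ ≡.sym) sw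
      ... | y , sy , sv | y′ , off with third-nbr T br y y′
      ...   | y₁ , sy₁ , y₁≢y , y₁≢y′ with third-nbr T br y y₁
      ...     | y₂ , sy₂ , y₂≢y , y₂≢y₁ with hub-branchy few h sy₁ | hub-branchy few h sy₂
      ...       | b₁ , br₁ , s₁ | b₂ , br₂ , s₂ = record
        { flat-f = flat-side T sy₁ ; br₁ = br₁ ; br₂ = br₂ ; b₁≢s = side-≢ T sy₁ s₁ ; b₂≢s = side-≢ T sy₂ s₂
        ; b₁≢v = λ { refl → y₁≢y (next-unique T sy₁ sy s₁ sv) } ; b₂≢v = λ { refl → y₂≢y (next-unique T sy₂ sy s₂ sv) }
        ; f-b₁ = s₁ ; f-b₂ = other-side T sy₂ sy₁ y₂≢y₁ s₂ ; f-v = other-side T sy sy₁ (y₁≢y ∘ ≡.sym) sv ; f-w = off sy₁ y₁≢y′ }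

    module _ {T : Tree} (few : Few T) {s : V} (hub : Hub T s) where

      private
        brs = proj₁ hub
        min = few-min few

      hub-limb : ∀ {z y g q} → Edge T z y → Cut T z y g → Br T z → Bare T g → g q ≡ true → Leaf T q ⊎ q ≡ y → ¬ Adj G s q
      hub-limb {z} {y} {g} zy cg brz ba gq lq gsq with s ≟ z
      ... | yes refl = loose few zy cg ba (proj₂ hub)
      ... | no s≢z = attach few zy cg brz ba gq lq (ba brs) s≢z gsq flat-f br₁ br₂ b₁≢s b₂≢s b₁≢v b₂≢v f-b₁ f-b₂
        where open Away (away few hub (s≢z ∘ ≡.sym) z)

      hub-owner : ∀ {u z y} → Owner T u z y → s ≢ z
      hub-owner o refl = ¬bare-branchy T (Owner.bare o) (hub-branchy few hub (Owner.zy o))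

      hub-leaf : ∀ {u} → Leaf T u → ¬ Adj G s u
      hub-leaf lu with owner {T} lu
      ... | z , y , o = hub-limb zy (scut T zy) brz bare in-u (inj₁ lu)
        where open Owner o

      hub-top : ∀ {x} → Top T x → ¬ Adj G s x
      hub-top (z , zx , brz , ba) = hub-limb zx (scut T zx) brz ba (shi T zx) (inj₂ refl)

      hub-rotate : ∀ {u x y T′} → Leaf T u → Rotated T u x y T′ → Hub T′ s
      hub-rotate {u} {x} {y} {T′} lu R = Br-keep lu brs
        , splits (flat-keep swapped flat-f (λ _ _ → trans f-w (≡.sym f-v))) (Br-keep lu br₁) (Br-keep lu br₂) b₁≢s b₂≢s f-b₁ f-b₂
        where
        open Rotated R
        u≢s : u ≢ s
        u≢s refl = leaf-¬Br T lu brs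
        open Away (away few hub u≢s x)

    few-rotate : ∀ {T u x y T′} → Few T → Rotated T u x y T′ → Few T′
    few-rotate few R = ≤-trans (Rotated.ℓ≤ R) few

    module _ {T : Tree} (few : Few T) {s : V} (hub : Hub T s) where

      private
        brs = proj₁ hub
        min = few-min few

      hub-rotated : ∀ {u x y T′} → Leaf T u → Rotated T u x y T′ → ¬ Adj G s y
      hub-rotated lu R = hub-leaf (few-rotate few R) (hub-rotate few hub lu R) (Rotated.leaf-y R)

      opaque
        -- Joining `q` to `u` and deleting `q x` turns `x` into a leaf, and a hub sees no leaf.
        shifted-hub : ∀ {x q u} → OnLimb T u x → OnLimb T u q → Edge T x q → side T x q s ≡ true → Adj G u q → ¬ Adj G s x
        shifted-hub {x} {q} {u} (lu , z , y , o , sx) lq xq sr guq gsx with x ≟ u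
        ... | yes refl = hub-leaf few hub lu gsx
        ... | no x≢u = hub-rotated lu (proj₂ (rotate min lu (gsym guq) nqu (esym T xq) su)) gsx
          where
          su : side T q x u ≡ true
          su = side-rev-T T xq (inward min lu o sx x≢u xq (Owner.bare o brs) sr)
          nqu : ¬ Edge T q u
          nqu e = x≢u (≡.sym (next-unique T e (esym T xq) (shi T e) su))

        -- If `v` saw `q`, the edge `v q` could replace the top edge `z t`. Then `q` is a branch
        -- vertex, and the outer part of the limb is a limb with top `p` hanging from `q`. As `s`
        -- sees `p`, it could be attached to `s`.
        detour : ∀ {u z t p q v} → Leaf T u → Owner T u z t → side T z t p ≡ true → side T z t q ≡ true → Edge T p q →
          side T p q s ≡ true → Adj G s p → Leaf T v → v ≢ u → ¬ Adj G v q
        detour {u} {z} {t} {p} {q} {v} lu o sp sq pq sr gsp lv v≢u gvq with q ≟ t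
        ... | yes refl = top-leaf min (z , Owner.zy o , Owner.brz o , Owner.bare o) lv gvq
                           (λ l → v≢u (limb-unique {T} l (lu , z , t , o , sq)))
        ... | no q≢t = attach (≤-trans le few) qp₁ cut₁ brq bare₁ (shi T qp) (inj₂ refl) (side-rev-F T pq sr) s≢q gsp
              (flat-keep S flat-f (λ _ _ → trans f-w (≡.sym f-q))) (br′ br₁ b₁≢v) (br′ br₂ b₂≢v) b₁≢s b₂≢s (≢q br₁) (≢q br₂) f-b₁ f-b₂
          where
          open Owner o
          v∉ : side T z t v ≡ false
          v∉ = ¬T→F λ s′ → v≢u (only s′ lv)
          v≢z : v ≢ z
          v≢z refl = leaf-¬Br T lv brz
          sw : ∃[ T′ ] Swapped T v q z t T′
          sw = swap T zy v∉ sq gvq (v≢z ∘ proj₁)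
          T₁ : Tree
          T₁ = proj₁ sw
          S : Swapped T v q z t T₁
          S = proj₂ sw
          open Swapped S
          open Away (away few hub (hub-owner few hub o ∘ ≡.sym) v)
          apart : ∀ {a b} → side T z t a ≡ true → side T z t b ≡ false → a ≢ b
          apart ga gb refl = T≢F ga gb
          qp : Edge T q p
          qp = esym T pq
          p≢u : p ≢ u
          p≢u refl = hub-leaf few hub lu gsp
          q≢u : q ≢ u
          q≢u refl = T≢F (shi T pq) (inward min lu o sp p≢u pq (bare brs) sr)
          q≢v : q ≢ v
          q≢v = apart sq v∉
          q≢z : q ≢ z
          q≢z = apart sq (slo T zy)
          t≢z : t ≢ z
          t≢z = apart (shi T zy) (slo T zy)
          t≢v : t ≢ v
          t≢v = apart (shi T zy) v∉
          s≢q : s ≢ q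
          s≢q = apart sq (bare brs) ∘ ≡.sym
          deg-q : degree T q ≡ 2
          deg-q = [ ⊥-elim ∘ q≢u , id ]′ (path sq)
          brq : Br T₁ q
          brq = ≤-reflexive (≡.sym (trans (+0-1 (deg-at S (δ-00 q≢z q≢t) (δ-01 q≢v refl))) (cong suc deg-q)))
          deg-v : degree T₁ v ≡ 2
          deg-v = trans (+0-1 (deg-at S (δ-00 v≢z (t≢v ∘ ≡.sym)) (δ-10 refl (q≢v ∘ ≡.sym)))) (cong suc lv)
          deg-z : suc (degree T₁ z) ≡ degree T z
          deg-z = +1-0 (deg-at S (δ-10 refl (t≢z ∘ ≡.sym)) (δ-00 (v≢z ∘ ≡.sym) (q≢z ∘ ≡.sym)))
          deg-t : suc (degree T₁ t) ≡ degree T t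
          deg-t = +1-0 (deg-at S (δ-01 t≢z refl) (δ-00 t≢v (q≢t ∘ ≡.sym)))
          le : ℓ T₁ ≤ ℓ T
          le = leaves-≤ {T} {T₁} old lv λ _ l → 1≢2 (trans (≡.sym l) deg-v)
            where
            old : ∀ {w} → Leaf T₁ w → w ≢ t → Leaf T w
            old {w} l w≢t with w ≟ z | w ≟ v | w ≟ q
            ... | yes refl | _ | _ = ⊥-elim (1≢3+ (subst (3 ≤_) (≡.sym deg-z) brz) l)
            ... | no _ | yes refl | _ = lv
            ... | no _ | no _ | yes refl = ⊥-elim (leaf-¬Br T₁ l brq)
            ... | no a | no b | no c = trans (≡.sym (untouched S b c a w≢t)) l
          qp₁ : Edge T₁ q p
          qp₁ = keep qp λ { (inj₁ (e , _)) → q≢z e ; (inj₂ (e , _)) → q≢t e }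
          beyond : ∀ {w} → side T z t w ≡ false → side T q p w ≡ false
          beyond sw′ = side-rev-F T pq (outward min lu o sp pq (bare brs) sr sw′)
          cut₁ : Cut T₁ q p (side T q p)
          cut₁ = cut-keep S (scut T qp) (trans (beyond v∉) (≡.sym (slo T qp)))
          bare₁ : Bare T₁ (side T q p)
          bare₁ {b} br with b ≟ v | b ≟ q | b ≟ z | b ≟ t
          ... | yes refl | _ | _ | _ = beyond v∉
          ... | no _ | yes refl | _ | _ = slo T qp
          ... | no _ | no _ | yes refl | _ = beyond (slo T zy)
          ... | no _ | no _ | no _ | yes refl = beyond (bare (≤-trans br (≤-trans (n≤1+n _) (≤-reflexive deg-t))))
          ... | no a | no c | no d | no e = beyond (bare (subst (3 ≤_) (untouched S a c d e) br))
          ≢q : ∀ {b} → Br T b → b ≢ q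
          ≢q br refl = two-¬Br T deg-q br
          br′ : ∀ {b} → Br T b → b ≢ z → Br T₁ b
          br′ br b≢z = subst (3 ≤_) (≡.sym (untouched S (λ { refl → leaf-¬Br T lv br }) (≢q br) b≢z
                         (λ { refl → T≢F (shi T zy) (bare br) }))) br
          f-q : f q ≡ false
          f-q = trans (bypass′ T (scut T zy) (bare brs) flat-f sq (shi T zy))
                  (trans (≡.sym (flat-f zy (hub-owner few hub o ∘ ≡.sym) (λ { refl → T≢F (shi T zy) (bare brs) }))) f-v)

        -- Otherwise the neighbours `p` and `q` of `x` on the limb, together with `s` and `v`, form
        -- an induced star at `x`. The pairs `p s` and `q v` are excluded by `detour`, the pair
        -- `s v` by `hub-leaf`, and the others by rotations after which the hub would see a leaf.
        hub-foreign : ∀ {x v} → Twig T x → Leaf T v → Adj G v x → ¬ OnLimb T v x → ¬ Adj G s x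
        hub-foreign {x} {v} tw lv gvx nl gsx with twig-limb {T} tw
        ... | u , l@(lu , z , t , o , sx) with next T {x} {u} (λ { refl → leaves-independent min lu lv (λ { refl → nl l }) (gsym gvx) })
                                             | next T {x} {s} (girr gsx ∘ ≡.sym)
        ...   | p , xp , sp | q , xq , sr = star free (E⇒G T xp) (E⇒G T xq) (gsym gsx) (gsym gvx)
                p≢q (in≢ sp′ s∉) (in≢ sp′ v∉) (in≢ sq′ s∉) (in≢ sq′ v∉) (λ { refl → leaf-¬Br T lv brs })
                p≁q (p≁s ∘ gsym) p≁v (hub-rotated lv R ∘ gsym) (detour lu o sx sq′ xq sr gsx lv v≢u ∘ gsym) (hub-leaf few hub lv)
          where
          open Owner o
          v≢u : v ≢ u
          v≢u refl = nl l
          x≢u : x ≢ u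
          x≢u refl = leaves-independent min lu lv (v≢u ∘ ≡.sym) (gsym gvx)
          s∉ : side T z t s ≡ false
          s∉ = bare brs
          v∉ : side T z t v ≡ false
          v∉ = ¬T→F λ s′ → v≢u (only s′ lv)
          in≢ : ∀ {a b} → side T z t a ≡ true → side T z t b ≡ false → a ≢ b
          in≢ ga gb refl = T≢F ga gb
          sv : side T x q v ≡ true
          sv = outward min lu o sx xq s∉ sr v∉
          p≢q : p ≢ q
          p≢q refl = T≢F sp (inward min lu o sx x≢u xq (Owner.bare o brs) sr)
          stays : ∀ {w} → Edge T x w → w ≢ z → side T z t w ≡ true
          stays xw w≢z = ¬F→T λ f → w≢z (proj₁ (crossing T (scut T zy) (esym T xw) f sx))
          p≢z : p ≢ z
          p≢z refl = p≢q (next-unique T xp xq (shi T xp) (outward min lu o sx xq s∉ sr (slo T zy)))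
          q≢z : q ≢ z
          q≢z refl = top-leaf min (q , esym T xq , brz , top-bare (proj₂ (crossing T (scut T zy) (esym T xq) (slo T zy) sx))) lv gvx nl
            where
            top-bare : x ≡ t → Bare T (side T q x)
            top-bare refl = bare
          sp′ : side T z t p ≡ true
          sp′ = stays xp p≢z
          sq′ : side T z t q ≡ true
          sq′ = stays xq q≢z
          r : ∃[ T′ ] Rotated T v x q T′
          r = rotate min lv (gsym gvx) (limb-leaf-exit min lv lu o sx v≢u) xq sv
          R : Rotated T v x q (proj₁ r)
          R = proj₂ r
          p≁q : ¬ Adj G p q
          p≁q g = hub-rotated-again (proj₂ (rotate-twice R (gsym gvx) xq sv xp (p≢q ∘ ≡.sym) (gsym g))) gsx
            where
            hub-rotated-again : ∀ {T″} → Rotated (proj₁ r) q p x T″ → ¬ Adj G s x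
            hub-rotated-again R′ = hub-leaf (few-rotate (few-rotate few R) R′)
              (hub-rotate (few-rotate few R) (hub-rotate few hub lv R) (Rotated.leaf-y R) R′) (Rotated.leaf-y R′)
          p≁v : ¬ Adj G p v
          p≁v g = hub-rotated lv (proj₂ (behind min lv xp (other-side T xq xp (p≢q ∘ ≡.sym) sv) (girr gvx) g)) gsx
          p≁s : ¬ Adj G s p
          p≁s g = detour lu o sp′ sx (esym T xp) (side-rev-T T xp (other-side T xq xp (p≢q ∘ ≡.sym) sr)) g lv v≢u gvx

  -- The branch of the stem ending in w, cut off at its attachment vertex t, seen from s.
  record Spur (T : Tree) (s w t a : V) : Set where
    field
      ta   : Edge T t a
      brt  : Br T t
      brw  : Br T w
      in-w : side T t a w ≡ true
      sole : ∀ {b} → Br T b → side T t a b ≡ true → b ≡ w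
      s∉   : side T t a s ≡ false

  -- Stem vertices seen by the hub, and the stem vertices that see nothing

  module Spurs (free : K14Free G) (k : ℕ) (3≤k : 3 ≤ k)
    (noGood : ∀ T (χ : V → Bool) → (∀ w → StemEnd T w → χ w ≡ true) → cnt χ ≤ k → ⊥) where
    open Hubs free k 3≤k noGood public

    module _ {T : Tree} (few : Few T) {s : V} (hub : Hub T s) where

      private
        brs = proj₁ hub
        min = few-min few

      hub-not-end : ∀ {w} → StemEnd T w → s ≢ w
      hub-not-end (br , p , wp , ba) refl with third-nbr T br p p
      ... | y , sy , y≢p , _ = ¬bare-branchy T (ba sy y≢p) (hub-branchy few hub sy)

      end-or-hub : ∀ {x} → Br T x → x ≢ s → StemEnd T x ⊎ Hub T x
      end-or-hub {x} br x≢s with next T x≢s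
      ... | p , xp , sp with any? (λ y → (edge T x y ≟ᵇ true) ×-dec (¬? (y ≟ p) ×-dec any? (λ b → (3 ≤? degree T b) ×-dec (side T x y b ≟ᵇ true))))
      ...   | yes (y , xy , y≢p , b , brb , sb) = inj₂ (br , splits (flat-side T xy) brb brs (side-≢ T xy sb) (x≢s ∘ ≡.sym) sb
                                                     (other-side T xp xy (y≢p ∘ ≡.sym) sp))
      ...   | no none = inj₁ (br , p , xp , λ {y} xy y≢p {b} brb → ¬T→F λ sb → none (y , xy , y≢p , b , brb , sb))

      end-toward : ∀ {w p} → StemEnd T w → Edge T w p → side T w p s ≡ true → ∀ {y} → Edge T w y → y ≢ p → Bare T (side T w y)
      end-toward {w} {p} (br , p′ , wp′ , ba) wp sp {y} wy y≢p with p ≟ p′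
      ... | yes refl = ba wy y≢p
      ... | no p≢p′ = ⊥-elim (T≢F sp (ba wp p≢p′ brs))

      inner-branchy : ∀ {x y} → OnStem T x → ¬ StemEnd T x → x ≢ s → Edge T x y → Branchy T (side T x y)
      inner-branchy {x} {y} st ne x≢s xy with 3 ≤? degree T x
      ... | yes br = [ ⊥-elim ∘ ne , (λ h → hub-branchy few h xy) ]′ (end-or-hub br x≢s)
      ... | no ¬br with other-nbr T (stem-deg≥2 min st xy) y
      ...   | d , xd , d≢y with st (esym T xd)
      ...     | b , brb , sb with next T {x} {b} (λ { refl → ¬br brb })
      ...       | y′ , xy′ , sy′ with two-nbrs T (≤-antisym (≤-pred (≰⇒> ¬br)) (stem-deg≥2 min st xy)) xy xd d≢y xy′
      ...         | inj₁ refl = b , brb , sy′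
      ...         | inj₂ refl = ⊥-elim (T≢F sb (side-rev-F T xd sy′))

      hub-stem : OnStem T s
      hub-stem ds = s , brs , shi T ds

      stem-out : ∀ {x u z y} → OnStem T x → Leaf T u → Owner T u z y → side T z y x ≡ false
      stem-out st lu o = ¬limb-owner {T} lu o (stem-limb st)

      opaque
        owner-ahead : ∀ {x x′ u z t} → OnStem T x → Edge T x x′ → Leaf T u → side T x x′ u ≡ true → Owner T u z t → z ≢ x → side T x x′ z ≡ true
        owner-ahead {x} {x′} st xx′ lu su o z≢x = ¬F→T λ f →
          disjoint T (Owner.zy o) xx′ (scut T (Owner.zy o)) (scut T xx′) (stem-out st lu o) f (z≢x ∘ proj₁) (Owner.in-u o) su

        -- Rotating `u` to `c` deletes `c c′` and turns the stem path from `p` to `c′` into a limb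
        -- at `w` with top `p`. But `p` is seen by `s`, and a hub sees no top.
        far-spur : ∀ {w p u y c c′} → Br T w → Edge T w p → Adj G s p → Leaf T u → Owner T u w y → y ≢ p →
          Edge T c c′ → side T c c′ u ≡ true → side T c c′ w ≡ true → (∀ {b} → Br T b → side T c c′ b ≡ true → b ≡ w) →
          side T w p c ≡ true → ¬ Adj G c u
        far-spur {w} {p} {u} {y} {c} {c′} brw wp gsp lu o y≢p cc′ su sw sole sc gcu =
          hub-limb (few-rotate few R) (hub-rotate few hub lu R) wp₁ cut₁ (Br-keep lu brw) bare₁ (hi cut₁) (inj₂ refl) gsp
          where
          w≢c : w ≢ c
          w≢c refl = T≢F sw (slo T cc′)
          ncu : ¬ Edge T c u
          ncu e = w≢c (≡.sym (proj₁ (crossing T (scut T (Owner.zy o)) e (other-side T wp (Owner.zy o) (y≢p ∘ ≡.sym) sc) (Owner.in-u o))))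
          r : ∃[ T′ ] Rotated T u c c′ T′
          r = rotate min lu gcu ncu cc′ su
          T₁ : Tree
          T₁ = proj₁ r
          R : Rotated T u c c′ T₁
          R = proj₂ r
          open Rotated R
          w≢c′ : w ≢ c′
          w≢c′ refl = two-¬Br T deg-y brw
          ns : ¬ Same w p c c′
          ns (inj₁ (e , _)) = w≢c e
          ns (inj₂ (e , _)) = w≢c′ e
          wp₁ : Edge T₁ w p
          wp₁ = keep wp ns
          -- The new limb consists of the vertices beyond `c c′` that lie in direction `p` from `w`.
          g : V → Bool
          g v = side T c c′ v ∧ side T w p v
          ∧-F₁ : ∀ {a b} → a ≡ false → a ∧ b ≡ false
          ∧-F₁ refl = refl
          ∧-F₂ : ∀ a {b} → b ≡ false → a ∧ b ≡ false
          ∧-F₂ true  h = h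
          ∧-F₂ false h = refl
          g-u : g u ≡ false
          g-u = ∧-F₂ (side T c c′ u) (other-side T (Owner.zy o) wp y≢p (Owner.in-u o))
          g-c : g c ≡ false
          g-c = ∧-F₁ (slo T cc′)
          cut₁ : Cut T₁ w p g
          cut₁ = record { lo = ∧-F₂ (side T c c′ w) (slo T wp)
                        ; hi = ∧-T (trans (≡.sym (flat (scut T cc′) wp ns)) sw) (shi T wp) ; flat = fl }
            where
            fl : ∀ {x z} → Edge T₁ x z → ¬ Same x z w p → g x ≡ g z
            fl e ns′ with inv e
            ... | inj₁ (e′ , ns″) = cong₂ _∧_ (flat (scut T cc′) e′ ns″) (flat (scut T wp) e′ ns′)
            ... | inj₂ (inj₁ (refl , refl)) = trans g-c (≡.sym g-u)
            ... | inj₂ (inj₂ (refl , refl)) = trans g-u (≡.sym g-c)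
          bare₁ : Bare T₁ g
          bare₁ {b} br = ¬T→F λ h → T≢F (subst (λ v → side T w p v ≡ true) (sole (Br-back br) (∧-T₁ h)) (∧-T₂ {side T c c′ b} h)) (slo T wp)

      -- The stem vertices that see neither a leaf nor `s`; they pay for those that see too many.
      Inner : V → Set
      Inner x = OnStem T x × ¬ StemEnd T x × x ≢ s × (∀ {u} → Leaf T u → ¬ Adj G u x) × ¬ Adj G s x

      opaque
        -- Joining `u` to `x` turns `x′` into a leaf, so `x′` sees neither `s` nor a leaf other than
        -- `u`; `NoInsert` excludes `u`. The hub does not lie in direction `x′`, since otherwise the
        -- limb of `u` could be attached to `x`, which separates `s` from a branch vertex in another
        -- direction.
        inner-shadow : NoInsert T → ∀ {x u} → OnStem T x → ¬ StemEnd T x → x ≢ s → Adj G s x → Leaf T u → Adj G u x →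
          ∃[ x′ ] (Edge T x x′ × side T x x′ u ≡ true × side T x′ x s ≡ true × Inner x′)
        inner-shadow noins {x} {u} st ne x≢s gsx lu gux with next T {x} {u} (girr gux ∘ ≡.sym)
        ... | x′ , xx′ , su = x′ , xx′ , su , sr , st′ , (λ { (br , _) → two-¬Br T deg-y br }) , (λ { refl → two-¬Br T deg-y brs })
            , no-leaf , hub-rotated few hub lu R
          where
          branchy : ∀ {y} → Edge T x y → Branchy T (side T x y)
          branchy = inner-branchy st ne x≢s
          nxu : ¬ Edge T x u
          nxu e with branchy e
          ... | b , br , sb = leaf-¬Br T lu (subst (Br T) (leaf-side T lu e sb) br)
          r : ∃[ T′ ] Rotated T u x x′ T′
          r = rotate min lu (gsym gux) nxu xx′ su
          R : Rotated T u x x′ (proj₁ r)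
          R = proj₂ r
          open Rotated R
          no-leaf : ∀ {u′} → Leaf T u′ → ¬ Adj G u′ x′
          no-leaf {u′} lu′ g with u′ ≟ u
          ... | yes refl = noins lu xx′ (st (esym T xx′)) (branchy xx′) (gsym gux) (gsym g)
          ... | no u′≢u = rotated-leaf R lu′ u′≢u (gsym g)
          sr : side T x′ x s ≡ true
          sr = side-rev-T T xx′ (¬T→F λ s₁ → ahead s₁)
            where
            ahead : side T x x′ s ≡ true → ⊥
            ahead s₁ with other-nbr T (stem-deg≥2 min st xx′) x′ | owner {T} lu
            ... | d , xd , d≢x′ | z , t , o with branchy xd
            ...   | b , brb , sb = attach few zy (scut T zy) brz bare in-u (inj₁ lu) (stem-out st lu o) (z≢x ∘ ≡.sym) (gsym gux)
                      (flat-side T xx′) brs brb (x≢s ∘ ≡.sym) (side-≢ T xd sb) (hub-owner few hub o)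
                      (λ { refl → T≢F sz (other-side T xd xx′ d≢x′ sb) }) s₁ (other-side T xd xx′ d≢x′ sb)
              where
              open Owner o
              z≢x : z ≢ x
              z≢x refl = ¬bare-branchy T bare (branchy zy)
              sz : side T x x′ z ≡ true
              sz = owner-ahead st xx′ lu su o z≢x
          st′ : OnStem T x′
          st′ {d} dx′ with d ≟ x
          ... | yes refl = branchy dx′
          ... | no d≢x = s , brs , side-rev-T T (esym T dx′) (other-side T (esym T xx′) (esym T dx′) (d≢x ∘ ≡.sym) sr)

      opaque
        -- A hub has no direction without branch vertices, so `w` is a stem end. In the star at `w`
        -- on `u₁`, `u₂`, `s`, `p` the only pair that can be adjacent is `s p`.
        crowded-end : NoInsert T → ∀ {w u₁ u₂} → OnStem T w → Leaf T u₁ → Leaf T u₂ → u₁ ≢ u₂ → Adj G w u₁ → Adj G w u₂ → Adj G s w →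
          StemEnd T w × ∃[ p ] (Edge T w p × side T w p s ≡ true × (p ≢ s → Adj G s p))
        crowded-end noins {w} {u₁} {u₂} st l₁ l₂ ne g₁ g₂ gsw
          with stem-pair min noins st l₁ l₂ ne g₁ g₂ | stem-pair min noins st l₂ l₁ (ne ∘ ≡.sym) g₂ g₁ | next T {w} {s} (girr gsw ∘ ≡.sym)
        ... | br , y₁ , wy₁ , s₁ , ba₁ | _ , y₂ , wy₂ , s₂ , ba₂ | p , wp , sp = end , p , wp , sp , joined
          where
          end : StemEnd T w
          end with end-or-hub br (girr gsw ∘ ≡.sym)
          ... | inj₁ e = e
          ... | inj₂ h = ⊥-elim (¬bare-branchy T ba₁ (hub-branchy few h wy₁))
          out : ∀ {u y} → Edge T w y → side T w y u ≡ true → Bare T (side T w y) → side T w p u ≡ false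
          out wy su ba = other-side T wy wp (λ { refl → T≢F sp (ba brs) }) su
          ≢p : ∀ {u} → side T w p u ≡ false → u ≢ p
          ≢p f refl = T≢F (shi T wp) f
          ≁p : ∀ {u} → Leaf T u → Adj G w u → side T w p u ≡ false → ¬ Adj G u p
          ≁p lu g f g′ = two-¬Br T (Rotated.deg-y (proj₂ (behind min lu wp f (girr g ∘ ≡.sym) (gsym g′)))) br
          joined : p ≢ s → Adj G s p
          joined p≢s = ¬F→T λ f → star free g₁ g₂ (gsym gsw) (E⇒G T wp) ne (λ { refl → leaf-¬Br T l₁ brs }) (≢p (out wy₁ s₁ ba₁))
            (λ { refl → leaf-¬Br T l₂ brs }) (≢p (out wy₂ s₂ ba₂)) (p≢s ∘ ≡.sym)
            (leaves-independent min l₁ l₂ ne) (hub-leaf few hub l₁ ∘ gsym) (≁p l₁ g₁ (out wy₁ s₁ ba₁))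
            (hub-leaf few hub l₂ ∘ gsym) (≁p l₂ g₂ (out wy₂ s₂ ba₂)) (λ g → T≢F g f)

        spur-of : ∀ {w p} → StemEnd T w → Edge T w p → side T w p s ≡ true →
          ∃[ t ] ∃[ a ] (Spur T s w t a × (a ≢ w → degree T a ≡ 2 × side T w p a ≡ true × side T w p t ≡ true × p ≢ s))
        spur-of {w} {p} end wp sp with climb T (esym T wp) brs (side-rev-F T wp sp)
        ... | climbed {t} {a} ta brt ⊆ ⊇ = t , a , spur , rest
          where
          w≢s : w ≢ s
          w≢s = hub-not-end end ∘ ≡.sym
          sole : ∀ {b} → Br T b → side T t a b ≡ true → b ≡ w
          sole {b} br sb with ⊇ sb
          ... | inj₂ two = ⊥-elim (two-¬Br T two br)
          ... | inj₁ sb′ with w ≟ b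
          ...   | yes w≡b = ≡.sym w≡b
          ...   | no w≢b with next T w≢b
          ...     | y , wy , sy with y ≟ p
          ...       | yes refl = ⊥-elim (T≢F sb′ (side-rev-F T wy sy))
          ...       | no y≢p = ⊥-elim (T≢F sy (end-toward end wp sp wy y≢p br))
          spur : Spur T s w t a
          spur = record { ta = ta ; brt = brt ; brw = proj₁ end ; in-w = ⊆ (shi T (esym T wp)) ; sole = sole
                        ; s∉ = ¬T→F λ s′ → w≢s (≡.sym (sole brs s′)) }
          t∉ : side T p w t ≡ false
          t∉ = ¬T→F λ s′ → T≢F (⊆ s′) (slo T ta)
          rest : a ≢ w → degree T a ≡ 2 × side T w p a ≡ true × side T w p t ≡ true × p ≢ s
          rest a≢w = [ ⊥-elim ∘ a∉ , id ]′ (⊇ (shi T ta)) , side-rev-T T (esym T wp) (¬T→F a∉) , side-rev-T T (esym T wp) t∉ , p≢s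
            where
            a∉ : ¬ (side T p w a ≡ true)
            a∉ s′ = a≢w (proj₂ (crossing T (scut T (esym T wp)) ta t∉ s′))
            p≢s : p ≢ s
            p≢s refl = a≢w (≡.sym (proj₂ (crossing T (scut T ta) (esym T wp) (Spur.s∉ spur) (Spur.in-w spur))))

      module _ {w t a p : V} (end : StemEnd T w) (sp : Spur T s w t a) (a≢w : a ≢ w) (deg-a : degree T a ≡ 2)
        (wp : Edge T w p) (gsp : Adj G s p) (ws : side T w p s ≡ true) (wa : side T w p a ≡ true) (wt : side T w p t ≡ true) where
        open Spur sp

        private
          w≢s : w ≢ s
          w≢s = hub-not-end end ∘ ≡.sym
          at : Edge T a t
          at = esym T ta
          ts : side T a t s ≡ true
          ts = side-rev-T T ta s∉
          tw : side T a t w ≡ false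
          tw = side-rev-F T ta in-w

        owner-dir : ∀ {u y} → Owner T u w y → y ≢ p
        owner-dir o refl = T≢F ws (Owner.bare o brs)

        spur-stem : OnStem T a
        spur-stem {d} da with d ≟ t
        ... | yes refl = w , brw , in-w
        ... | no d≢t = s , brs , side-rev-T T (esym T da) (other-side T at (esym T da) (d≢t ∘ ≡.sym) ts)

        opaque
          -- The limb of `u` hangs beyond `a`, where `w` is the only branch vertex; so `far-spur`
          -- applies with `t a` as the deleted edge.
          spur-top-leaf : ∀ {u} → OnStem T t → t ≢ w → Leaf T u → side T t a u ≡ true → ¬ (∃[ y ] Bare T (side T t y) × Edge T t y) → ¬ Adj G t u
          spur-top-leaf {u} st t≢w lu su inner gtu with owner {T} lu
          ... | z , y , o with sole (Owner.brz o) (owner-ahead st ta lu su o (λ { refl → inner (y , Owner.bare o , Owner.zy o) }))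
          ...   | refl = far-spur brw wp gsp lu o (owner-dir o) ta su in-w sole wt gtu

          -- If the limb of `u` does not hang from `w`, it could be attached to `a`, which separates
          -- `w` from `s`. If it hangs from `w`, then `far-spur` applies.
          spur-leaf : ∀ {u} → Leaf T u → ¬ Adj G a u
          spur-leaf {u} lu gau with owner {T} lu
          ... | z , y , o with w ≟ z
          ...   | no w≢z = attach few (Owner.zy o) (scut T (Owner.zy o)) (Owner.brz o) (Owner.bare o) (Owner.in-u o) (inj₁ lu)
                    (stem-out spur-stem lu o) (λ { refl → two-¬Br T deg-a (Owner.brz o) }) gau
                    (λ e v≢a w≢a → flat (scut T ta) e λ { (inj₁ (_ , q)) → w≢a q ; (inj₂ (q , _)) → v≢a q })
                    brw brs (a≢w ∘ ≡.sym) (λ { refl → two-¬Br T deg-a brs }) w≢z (hub-owner few hub o) in-w s∉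
          ...   | yes refl with next T {a} {u} (girr gau)
          ...     | c , ac , sc = far-spur brw wp gsp lu o (owner-dir o) ac sc sw′ sole′ wa gau
            where
            u-in : side T t a u ≡ true
            u-in = ¬F→T λ f → disjoint T (Owner.zy o) at (scut T (Owner.zy o)) (scut T at) (stem-out spur-stem lu o) tw
                     (a≢w ∘ ≡.sym ∘ proj₁) (Owner.in-u o) (side-rev-T T ta f)
            c≢t : c ≢ t
            c≢t refl = T≢F u-in (side-rev-F T ac sc)
            sw′ : side T a c w ≡ true
            sw′ with next T a≢w
            ... | c′ , ac′ , s′ with two-nbrs T deg-a at ac c≢t ac′
            ...   | inj₁ refl = ⊥-elim (T≢F s′ tw)
            ...   | inj₂ refl = s′
            sole′ : ∀ {b} → Br T b → side T a c b ≡ true → b ≡ w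
            sole′ br sb = sole br (side-rev-T T at (other-side T ac at c≢t sb))

  ∨-T₁ : ∀ {a b} → a ≡ true → a ∨ b ≡ true
  ∨-T₁ refl = refl

  ∨-T₂ : ∀ {a b} → b ≡ true → a ∨ b ≡ true
  ∨-T₂ {true}  _ = refl
  ∨-T₂ {false} h = h

  ∨-F : ∀ {a b} → a ≡ false → b ≡ false → a ∨ b ≡ false
  ∨-F refl refl = refl

  ∨-elim : ∀ {a b} → a ∨ b ≡ true → a ≡ true ⊎ b ≡ true
  ∨-elim {true}  h = inj₁ h
  ∨-elim {false} h = inj₂ h

  -- The degree sum of all leaves and a hub of largest degree

  module TightTrees (free : K14Free G) (k : ℕ) (3≤k : 3 ≤ k)
    (noGood : ∀ T (χ : V → Bool) → (∀ w → StemEnd T w → χ w ≡ true) → cnt χ ≤ k → ⊥) where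
    open Spurs free k 3≤k noGood public

    module _ {T : Tree} (few : Few T) {s : V} (hub : Hub T s) where

      private
        brs = proj₁ hub
        min = few-min few

      opaque
        -- Exchange: s a and s y are replaced by a y and s w, which turns the stem end w into an interior branch vertex.
        spread : ∀ {w a y} → StemEnd T w → Spur T s w s a → Adj G s w → Edge T s y → y ≢ a → 4 ≤ degree T s → ¬ Adj G a y
        spread {w} {a} {y} end spur gsw sy y≢a 4≤ gay with owns-two end | hub-branchy few hub sy
        ... | _ , _ , (_ , _ , y′ , wy′ , ba , _) , _ | b , brb , sb = finish
          where
          open Spur spur renaming (ta to sa)
          s≢w : s ≢ w
          s≢w = hub-not-end few hub end
          s≢a : s ≢ a
          s≢a = eirr T sa
          s≢y : s ≢ y
          s≢y = eirr T sy
          a∉y : ∀ {v} → side T s a v ≡ true → side T s y v ≡ false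
          a∉y = other-side T sa sy (y≢a ∘ ≡.sym)
          w≢y : w ≢ y
          w≢y refl = T≢F (shi T sy) (a∉y in-w)
          b≢w : b ≢ w
          b≢w refl = T≢F sb (a∉y in-w)
          b≢a : b ≢ a
          b≢a refl = T≢F sb (a∉y (shi T sa))
          b≢s : b ≢ s
          b≢s = side-≢ T sy sb
          g : V → Bool
          g = side T w y′
          g-s : g s ≡ false
          g-s = ba brs
          g-nbr : ∀ {v} → Edge T s v → g v ≡ false
          g-nbr sv = ¬T→F λ h → s≢w (proj₁ (crossing T (scut T wy′) sv g-s h))
          sw₁ : ∃[ T′ ] Swapped T a y s y T′
          sw₁ = swap T sy (a∉y (shi T sa)) (shi T sy) gay (λ p → s≢a (≡.sym (proj₁ p)))
          T₁ : Tree
          T₁ = proj₁ sw₁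
          S₁ : Swapped T a y s y T₁
          S₁ = proj₂ sw₁
          module S₁ = Swapped S₁
          s₁ : suc (degree T₁ s) ≡ degree T s
          s₁ = +1-0 (deg-at S₁ (δ-10 refl s≢y) (δ-00 s≢a s≢y))
          a₁ : degree T₁ a ≡ suc (degree T a)
          a₁ = +0-1 (deg-at S₁ (δ-00 (s≢a ∘ ≡.sym) (y≢a ∘ ≡.sym)) (δ-10 refl (y≢a ∘ ≡.sym)))
          rest₁ : ∀ {v} → v ≢ s → v ≢ a → degree T₁ v ≡ degree T v
          rest₁ {v} p q with v ≟ y
          ... | yes refl = +1-inj (deg-at S₁ (δ-01 p refl) (δ-01 q refl))
          ... | no r = untouched S₁ q r p r
          wy₁ : Edge T₁ w y′
          wy₁ = S₁.keep wy′ λ { (inj₁ (e , _)) → s≢w (≡.sym e) ; (inj₂ (e , _)) → w≢y e }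
          fewer : ∀ {T′} → suc (degree T′ s) ≡ degree T s → degree T′ w ≡ suc (degree T w) → (∀ {v} → v ≢ s → v ≢ w → degree T′ v ≡ degree T v) →
            Few T′
          fewer {T′} es ew rest = ≤-trans (cnt-mono λ v h → leaf-T T (old (T-leaf T′ h))) few
            where
            old : ∀ {v} → Leaf T′ v → Leaf T v
            old {v} l with v ≟ s | v ≟ w
            ... | yes refl | _ = ⊥-elim (1≢3+ (subst (3 ≤_) (≡.sym es) brs) l)
            ... | no _ | yes refl = ⊥-elim (1≢3+ (s≤s (s≤s (≤-trans (s≤s z≤n) brw))) (trans (≡.sym ew) l))
            ... | no p | no q = trans (≡.sym (rest p q)) l
          br-s : ∀ {T′} → suc (degree T′ s) ≡ degree T s → Br T′ s
          br-s es = ≤-pred (subst (4 ≤_) (≡.sym es) 4≤)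
          bare : ∀ {T′} → (∀ {v} → v ≢ s → v ≢ w → degree T′ v ≡ degree T v) → Bare T′ g
          bare rest {c} br = ¬T→F λ h → T≢F h (ba (subst (3 ≤_)
            (rest (λ { refl → T≢F h g-s }) (λ { refl → T≢F h (slo T wy′) })) br))
          finish : ⊥
          finish with a ≟ w
          -- When the spur is the single edge `s w`, replacing `s y` by `w y` is enough.
          ... | yes refl = loose (fewer s₁ a₁ rest₁) wy₁ (cut-keep S₁ (scut T wy′) (trans (slo T wy′) (≡.sym (g-nbr sy)))) (bare rest₁)
                  (splits {f = side T s y} fl (subst (3 ≤_) (≡.sym (rest₁ b≢s b≢w)) brb) (br-s s₁) b≢w s≢w sb (slo T sy))
            where
            fl : Flat T₁ w (side T s y)
            fl e p≢ q≢ with S₁.inv e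
            ... | inj₁ (e′ , ns) = flat (scut T sy) e′ ns
            ... | inj₂ (inj₁ (p , _)) = ⊥-elim (p≢ p)
            ... | inj₂ (inj₂ (_ , q)) = ⊥-elim (q≢ q)
          ... | no a≢w = loose (fewer s₂ w₂ rest₂) (S₂.keep wy₁ λ { (inj₁ (e , _)) → s≢w (≡.sym e) ; (inj₂ (e , _)) → a≢w (≡.sym e) })
                  (cut-keep S₂ (cut-keep S₁ (scut T wy′) (trans (g-nbr sa) (≡.sym (g-nbr sy)))) (trans g-s (≡.sym (slo T wy′)))) (bare rest₂)
                  (splits {f = f} fl (subst (3 ≤_) (≡.sym (rest₂ b≢s b≢w)) brb) (br-s s₂) b≢w s≢w (∨-T₂ sb) (∨-F (slo T sa) (slo T sy)))
            where
            -- After the first exchange `y` hangs from `a`, so the side of `s a` is the union of two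
            -- old sides.
            f : V → Bool
            f v = side T s a v ∨ side T s y v
            f-new : f a ≡ f y
            f-new = trans (∨-T₁ (shi T sa)) (≡.sym (∨-T₂ {side T s a y} (shi T sy)))
            sa₁ : Edge T₁ s a
            sa₁ = S₁.keep sa λ { (inj₁ (_ , e)) → y≢a (≡.sym e) ; (inj₂ (e , _)) → s≢y e }
            cut₁ : Cut T₁ s a f
            cut₁ = record { lo = ∨-F (slo T sa) (slo T sy) ; hi = ∨-T₁ (shi T sa) ; flat = fl₁ }
              where
              fl₁ : ∀ {p q} → Edge T₁ p q → ¬ Same p q s a → f p ≡ f q
              fl₁ e ns with S₁.inv e
              ... | inj₁ (e′ , ns′) = cong₂ _∨_ (flat (scut T sa) e′ ns) (flat (scut T sy) e′ ns′)
              ... | inj₂ (inj₁ (refl , refl)) = f-new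
              ... | inj₂ (inj₂ (refl , refl)) = ≡.sym f-new
            sw₂ : ∃[ T′ ] Swapped T₁ s w s a T′
            sw₂ = swap T₁ sa₁ (slo T₁ sa₁) (trans (cut-unique T₁ (scut T₁ sa₁) cut₁ w) (∨-T₁ in-w)) gsw (λ p → a≢w (≡.sym (proj₂ p)))
            T₂ : Tree
            T₂ = proj₁ sw₂
            S₂ : Swapped T₁ s w s a T₂
            S₂ = proj₂ sw₂
            module S₂ = Swapped S₂
            s₂ : suc (degree T₂ s) ≡ degree T s
            s₂ = trans (cong suc (+1-inj (deg-at S₂ (δ-10 refl s≢a) (δ-10 refl s≢w)))) s₁
            w₂ : degree T₂ w ≡ suc (degree T w)
            w₂ = trans (+0-1 (deg-at S₂ (δ-00 (s≢w ∘ ≡.sym) (a≢w ∘ ≡.sym)) (δ-01 (s≢w ∘ ≡.sym) refl)))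
                       (cong suc (rest₁ (s≢w ∘ ≡.sym) (a≢w ∘ ≡.sym)))
            rest₂ : ∀ {v} → v ≢ s → v ≢ w → degree T₂ v ≡ degree T v
            rest₂ {v} p q with v ≟ a
            ... | yes refl = suc-injective (trans (+1-0 (deg-at S₂ (δ-01 p refl) (δ-00 p q))) a₁)
            ... | no r = trans (untouched S₂ p q p r) (rest₁ p r)
            fl : Flat T₂ w f
            fl e p≢ q≢ with S₂.inv e
            ... | inj₂ (inj₁ (_ , q)) = ⊥-elim (q≢ q)
            ... | inj₂ (inj₂ (p , _)) = ⊥-elim (p≢ p)
            ... | inj₁ (e′ , ns) = flat cut₁ e′ ns

        -- Replacing `t a` by `s a` creates no leaf, keeps `s` a hub and raises its degree, which
        -- was the largest.
        reattach : (∀ {T′ s′} → Few T′ → Hub T′ s′ → degree T′ s′ ≤ degree T s) → ∀ {w t a} → Spur T s w t a → Adj G s a → t ≡ s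
        reattach maxdeg {w} {t} {a} spur gsa with t ≟ s
        ... | yes e = e
        ... | no t≢s = ⊥-elim (<-irrefl refl (≤-trans (≤-reflexive (≡.sym deg-s)) (maxdeg (≤-trans le few) hub′)))
          where
          open Spur spur
          s≢a : s ≢ a
          s≢a = girr gsa
          t≢a : t ≢ a
          t≢a = eirr T ta
          sw : ∃[ T′ ] Swapped T s a t a T′
          sw = swap T ta s∉ (shi T ta) gsa (t≢s ∘ ≡.sym ∘ proj₁)
          T₁ : Tree
          T₁ = proj₁ sw
          S : Swapped T s a t a T₁
          S = proj₂ sw
          deg-s : degree T₁ s ≡ suc (degree T s)
          deg-s = +0-1 (deg-at S (δ-00 (t≢s ∘ ≡.sym) s≢a) (δ-10 refl s≢a))
          deg-t : suc (degree T₁ t) ≡ degree T t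
          deg-t = +1-0 (deg-at S (δ-10 refl t≢a) (δ-00 t≢s t≢a))
          rest : ∀ {v} → v ≢ s → v ≢ t → degree T₁ v ≡ degree T v
          rest {v} p q with v ≟ a
          ... | yes refl = +1-inj (deg-at S (δ-01 q refl) (δ-01 p refl))
          ... | no r = untouched S p r q r
          le : ℓ T₁ ≤ ℓ T
          le = cnt-mono λ v h → leaf-T T (old (T-leaf T₁ h))
            where
            old : ∀ {v} → Leaf T₁ v → Leaf T v
            old {v} l with v ≟ s | v ≟ t
            ... | yes refl | _ = ⊥-elim (1≢3+ (s≤s (s≤s (≤-trans (s≤s z≤n) brs))) (trans (≡.sym deg-s) l))
            ... | no _ | yes refl = ⊥-elim (1≢3+ (subst (3 ≤_) (≡.sym deg-t) brt) l)
            ... | no p | no q = trans (≡.sym (rest p q)) l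
          open Away (away few hub t≢s t)
          hub′ : Hub T₁ s
          hub′ = ≤-trans brs (≤-trans (n≤1+n _) (≤-reflexive (≡.sym deg-s)))
               , splits (flat-keep S flat-f (λ p → ⊥-elim (p refl))) (subst (3 ≤_) (≡.sym (rest b₁≢s b₁≢v)) br₁)
                        (subst (3 ≤_) (≡.sym (rest b₂≢s b₂≢v)) br₂) b₁≢s b₂≢s f-b₁ f-b₂

      -- The stem ends to which no paying vertex on their spur is assigned, because `s` sees its
      -- vertex `a` next to the attachment.
      Close : V → Set
      Close w = StemEnd T w × Adj G s w × ∃[ t ] ∃[ a ] (Spur T s w t a × Adj G s a)

      opaque
        -- By `reattach` the three spurs hang from `s`, and a fourth stem end lies in a fourth
        -- direction `y`. Now `s` has degree at least four, so `spread` excludes all edges among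
        -- `a₁`, `a₂`, `a₃`, `y`.
        three-close : (∀ {T′ s′} → Few T′ → Hub T′ s′ → degree T′ s′ ≤ degree T s) → ∀ {w₁ w₂ w₃} → w₁ ≢ w₂ → w₁ ≢ w₃ → w₂ ≢ w₃ →
          Close w₁ → Close w₂ → Close w₃ → ⊥
        three-close maxdeg {w₁} {w₂} {w₃} n₁₂ n₁₃ n₂₃ (e₁ , g₁ , t₁ , a₁ , sp₁ , h₁) (e₂ , g₂ , t₂ , a₂ , sp₂ , h₂) (e₃ , g₃ , t₃ , a₃ , sp₃ , h₃)
          with reattach maxdeg sp₁ h₁ | reattach maxdeg sp₂ h₂ | reattach maxdeg sp₃ h₃
        ... | refl | refl | refl = avoid-three T w₁ w₂ w₃ λ { (b , end , n₁ , n₂ , n₃) → fourth end n₁ n₂ n₃ (next T (hub-not-end few hub end)) }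
          where
          ≢a : ∀ {w w′ a a′} → w ≢ w′ → Spur T s w s a → Spur T s w′ s a′ → a ≢ a′
          ≢a ne sp sp′ refl = ne (Spur.sole sp′ (Spur.brw sp) (Spur.in-w sp))
          fourth : ∀ {b} → StemEnd T b → b ≢ w₁ → b ≢ w₂ → b ≢ w₃ → ∃[ y ] (Edge T s y × side T s y b ≡ true) → ⊥
          fourth {b} end n₁ n₂ n₃ (y , sy , sb) = star free h₁ h₂ h₃ (E⇒G T sy) a₁₂ a₁₃ (y≢ n₁ sp₁ ∘ ≡.sym) a₂₃ (y≢ n₂ sp₂ ∘ ≡.sym) (y≢ n₃ sp₃ ∘ ≡.sym)
              (spread e₁ sp₁ g₁ (Spur.ta sp₂) (a₁₂ ∘ ≡.sym) 4≤) (spread e₁ sp₁ g₁ (Spur.ta sp₃) (a₁₃ ∘ ≡.sym) 4≤) (spread e₁ sp₁ g₁ sy (y≢ n₁ sp₁) 4≤)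
              (spread e₂ sp₂ g₂ (Spur.ta sp₃) (a₂₃ ∘ ≡.sym) 4≤) (spread e₂ sp₂ g₂ sy (y≢ n₂ sp₂) 4≤) (spread e₃ sp₃ g₃ sy (y≢ n₃ sp₃) 4≤)
            where
            y≢ : ∀ {w a} → b ≢ w → Spur T s w s a → y ≢ a
            y≢ ne sp refl = ne (Spur.sole sp (proj₁ end) sb)
            a₁₂ : a₁ ≢ a₂
            a₁₂ = ≢a n₁₂ sp₁ sp₂
            a₁₃ : a₁ ≢ a₃
            a₁₃ = ≢a n₁₃ sp₁ sp₃
            a₂₃ : a₂ ≢ a₃
            a₂₃ = ≢a n₂₃ sp₂ sp₃
            4≤ : 4 ≤ degree T s
            4≤ = cnt≥4 (edge T s) (Spur.ta sp₁) (Spur.ta sp₂) (Spur.ta sp₃) sy (a₁₂ ∘ ≡.sym) (a₁₃ ∘ ≡.sym) (y≢ n₁ sp₁)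
                   (a₂₃ ∘ ≡.sym) (y≢ n₂ sp₂) (y≢ n₃ sp₃)

    module _ {T : Tree} (few : Few T) (noins : NoInsert T) {s : V} (hub : Hub T s)
      (maxdeg : ∀ {T′ s′} → Few T′ → Hub T′ s′ → degree T′ s′ ≤ degree T s) where

      private
        brs = proj₁ hub
        min = few-min few

        S : V → Bool
        S v = leaf? T v ∨ does (v ≟ s)

        S-elim : ∀ {v} → S v ≡ true → Leaf T v ⊎ v ≡ s
        S-elim {v} h with ∨-elim {leaf? T v} h
        ... | inj₁ l = inj₁ (T-leaf T l)
        ... | inj₂ d = inj₂ (does⇒ (v ≟ s) d)

        size : cnt S ≡ 3 + (k + k)
        size = trans (cnt-remove S s (∨-T₂ {leaf? T s} (dec-true (s ≟ s) refl)))
                 (cong suc (trans (cnt-cong same) (≤-antisym few (leaves-bound T))))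
          where
          same : ∀ v → (S ∖ s) v ≡ leaf? T v
          same v with bool (leaf? T v)
          ... | inj₁ t = trans (∖-intro S (∨-T₁ t) (λ { refl → leaf-¬Br T (T-leaf T t) brs })) (≡.sym t)
          ... | inj₂ f = trans (¬T→F λ h → let (h′ , v≢s) = ∖-elim S h in
                    [ (λ l → T≢F (leaf-T T l) f) , v≢s ]′ (S-elim h′)) (≡.sym f)

        independent : ∀ {u v} → S u ≡ true → S v ≡ true → ¬ Adj G u v
        independent {u} {v} hu hv g with S-elim hu | S-elim hv
        ... | inj₁ lu | inj₁ lv = leaves-independent min lu lv (girr g) g
        ... | inj₂ refl | inj₁ lv = hub-leaf few hub lv g
        ... | inj₁ lu | inj₂ refl = hub-leaf few hub lu (gsym g)
        ... | inj₂ refl | inj₂ refl = girr g refl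

        opaque
          one-foreign : ∀ {x v v′} → Twig T x → S v ≡ true → S v′ ≡ true → v ≢ v′ → Adj G v x → Adj G v′ x →
            ¬ OnLimb T v x → ¬ OnLimb T v′ x → ⊥
          one-foreign tw hv hv′ ne g g′ nl nl′ with S-elim hv | S-elim hv′
          ... | inj₁ lv | inj₁ lv′ = foreign-leaves min tw lv lv′ ne g g′ nl nl′
          ... | inj₁ lv | inj₂ refl = hub-foreign few hub tw lv g nl g′
          ... | inj₂ refl | inj₁ lv′ = hub-foreign few hub tw lv′ g′ nl′ g
          ... | inj₂ refl | inj₂ refl = ne refl

          top-foreign : ∀ {x v} → Top T x → S v ≡ true → Adj G v x → ¬ OnLimb T v x → ⊥
          top-foreign top hv g nl with S-elim hv
          ... | inj₁ lv = top-leaf min top lv g nl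
          ... | inj₂ refl = hub-top few hub top g

          shifted-foreign : ∀ {x q u v} → OnLimb T u x → OnLimb T u q → Edge T x q → side T x q s ≡ true → S u ≡ true → Adj G u q →
            S v ≡ true → Adj G v x → ¬ OnLimb T v x → ⊥
          shifted-foreign l l′ xq sr _ g hv g′ nl with S-elim hv
          ... | inj₁ lv = shifted-leaf min brs l xq sr g lv g′ nl
          ... | inj₂ refl = shifted-hub few hub l l′ xq sr g g′

        open TwigSum min brs S one-foreign top-foreign shifted-foreign

        D : V → ℕ
        D = hits G S

        P : V → V → Bool
        P x v = S v ∧ adj G v x

        leaf-of : ∀ {x v} → (P x ∖ s) v ≡ true → Leaf T v × Adj G x v
        leaf-of {x} {v} h with ∖-elim (P x) h
        ... | h′ , v≢s = [ id , ⊥-elim ∘ v≢s ]′ (S-elim (∧-T₁ h′)) , gsym (∧-T₂ {S v} h′)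

        D-split : ∀ x → D x ≤ suc (cnt (P x ∖ s)) × (¬ Adj G s x → D x ≤ cnt (P x ∖ s))
        D-split x = le , λ n → cnt-mono λ v h → ∖-intro (P x) h (λ { refl → n (∧-T₂ {S s} h) })
          where
          le : D x ≤ suc (cnt (P x ∖ s))
          le with bool (P x s)
          ... | inj₁ t = ≤-reflexive (cnt-remove (P x) s t)
          ... | inj₂ f = ≤-trans (cnt-mono λ v h → ∖-intro (P x) h (λ { refl → T≢F h f })) (n≤1+n _)

        opaque
          ≤2-leaves : ∀ {x} → OnStem T x → cnt (P x ∖ s) ≤ 2
          ≤2-leaves {x} st with cnt (P x ∖ s) ≤? 2
          ... | yes p = p
          ... | no ¬p with cnt-pick3 (P x ∖ s) (≰⇒> ¬p)
          ...   | a , b , c , pa , pb , pc , ab , ac , bc = ⊥-elim (stem-triple min noins st (proj₁ (leaf-of pa)) (proj₁ (leaf-of pb)) (proj₁ (leaf-of pc))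
                    ab ac bc (proj₂ (leaf-of pa)) (proj₂ (leaf-of pb)) (proj₂ (leaf-of pc)))

          -- A pair of leaves forces a branch vertex with a direction free of branch vertices, which
          -- no hub has.
          two-leaves-end : ∀ {x} → OnStem T x → x ≢ s → 2 ≤ cnt (P x ∖ s) → StemEnd T x
          two-leaves-end {x} st x≢s h with cnt-pick2 (P x ∖ s) h
          ... | a , b , pa , pb , b≢a
            with stem-pair min noins st (proj₁ (leaf-of pa)) (proj₁ (leaf-of pb)) (b≢a ∘ ≡.sym) (proj₂ (leaf-of pa)) (proj₂ (leaf-of pb))
          ...   | br , y , xy , _ , ba with end-or-hub few hub br x≢s
          ...     | inj₁ e = e
          ...     | inj₂ h′ = ⊥-elim (¬bare-branchy T ba (hub-branchy few h′ xy))

          D-s : D s ≡ 0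
          D-s with D s ≤? 0
          ... | yes p = n≤0⇒n≡0 p
          ... | no ¬p with cnt-pick (P s) (≰⇒> ¬p)
          ...   | v , h with S-elim (∧-T₁ h)
          ...     | inj₁ lv = ⊥-elim (hub-leaf few hub lv (gsym (∧-T₂ {S v} h)))
          ...     | inj₂ refl = ⊥-elim (girr (∧-T₂ {S v} h) refl)

          D-inner : ∀ {x} → Inner few hub x → D x ≡ 0
          D-inner {x} (_ , _ , _ , nl , ns) with D x ≤? 0
          ... | yes p = n≤0⇒n≡0 p
          ... | no ¬p with cnt-pick (P x) (≰⇒> ¬p)
          ...   | v , h with S-elim (∧-T₁ h)
          ...     | inj₁ lv = ⊥-elim (nl lv (∧-T₂ {S v} h))
          ...     | inj₂ refl = ⊥-elim (ns (∧-T₂ {S v} h))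

        -- All but two of these vertices can be matched with stem vertices that see nothing of S.
        Full Double : V → Set
        Full x = OnStem T x × x ≢ s × 3 ≤ D x
        Double x = OnStem T x × ¬ StemEnd T x × x ≢ s × 2 ≤ D x

        hub-adj : ∀ {x} j → suc j ≤ D x → cnt (P x ∖ s) ≤ j → Adj G s x
        hub-adj {x} j h le = ¬F→T λ f → <-irrefl refl (≤-trans h (≤-trans (proj₂ (D-split x) (λ g → T≢F g f)) le))

        opaque
          full-end : ∀ {x} → Full x → StemEnd T x × Adj G s x × ∃[ p ] (Edge T x p × side T x p s ≡ true × (p ≢ s → Adj G s p))
          full-end {x} (st , x≢s , h) with cnt-pick2 (P x ∖ s) (≤-pred (≤-trans h (proj₁ (D-split x))))
          ... | a , b , pa , pb , b≢a with hub-adj 2 h (≤2-leaves st)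
          ...   | gsx with crowded-end few hub noins st (proj₁ (leaf-of pa)) (proj₁ (leaf-of pb)) (b≢a ∘ ≡.sym) (proj₂ (leaf-of pa)) (proj₂ (leaf-of pb)) gsx
          ...     | e , p = e , gsx , p

          double-leaf : ∀ {x} → Double x → Adj G s x × ∃[ u ] (Leaf T u × Adj G u x)
          double-leaf {x} (st , ne , x≢s , h) with cnt-pick (P x ∖ s) (≤-pred (≤-trans h (proj₁ (D-split x))))
          ... | u , pu = hub-adj 1 h (≤-pred (≰⇒> λ 2≤ → ne (two-leaves-end st x≢s 2≤))) , u , proj₁ (leaf-of pu) , gsym (proj₂ (leaf-of pu))

          -- Every stem vertex may spend one unit and a stem end one more; `Full` and `Double`
          -- vertices each overspend by one. `Inner` vertices and `s` have `D x ≡ 0`, so their unit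
          -- is returned on the left.
          at-stem : ∀ {g e w z} → Indicates (Inner few hub) g → Indicates (StemEnd T) e → Indicates Full w → Indicates Double z →
            ∀ {x} → OnStem T x → D x + (ind (g x) + δ x s) ≤ 1 + (ind (e x) + (ind (w x) + ind (z x)))
          at-stem {g} {e} {w} {z} ig ie iw iz {x} st = by-hub (x ≟ s)
            where
            by-D : x ≢ s → ∀ d → D x ≡ d → d + (ind (g x) + 0) ≤ 1 + (ind (e x) + (ind (w x) + ind (z x)))
            by-hub : Dec (x ≡ s) → D x + (ind (g x) + δ x s) ≤ 1 + (ind (e x) + (ind (w x) + ind (z x)))
            by-hub (yes x≡s) = ≤-trans (≤-reflexive (cong₂ _+_ (trans (cong D x≡s) D-s)
              (cong₂ (λ a b → ind a + b) (¬T→F λ h → proj₁ (proj₂ (proj₂ (to ig h))) x≡s) (trans (cong (λ v → δ v s) x≡s) (δ-same s))))) (s≤s z≤n)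
            by-hub (no x≢s) = ≤-trans (≤-reflexive (cong (λ j → D x + (ind (g x) + j)) (δ-diff x≢s))) (by-D x≢s (D x) refl)
            not-inner : ∀ {j} → D x ≡ suc j → g x ≡ false
            not-inner eq = ¬T→F λ h → lem (trans (≡.sym (D-inner (to ig h))) eq)
              where lem : ∀ {j} → 0 ≡ suc j → ⊥
                    lem ()
            D≤3 : D x ≤ 3
            D≤3 = ≤-trans (proj₁ (D-split x)) (s≤s (≤2-leaves st))
            by-D x≢s 0 eq = ≤-trans (≤-reflexive (+-identityʳ _)) (≤-trans (ind≤1 (g x)) (s≤s z≤n))
            by-D x≢s 1 eq = ≤-trans (≤-reflexive (cong (λ b → 1 + (ind b + 0)) (not-inner eq))) (s≤s z≤n)
            by-D x≢s 2 eq = ≤-trans (≤-reflexive (cong (λ b → 2 + (ind b + 0)) (not-inner eq))) (s≤s (one (bool (e x))))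
              where
              one : e x ≡ true ⊎ e x ≡ false → 1 ≤ ind (e x) + (ind (w x) + ind (z x))
              one (inj₁ t) = ≤-trans (≤-reflexive (≡.sym (cong ind t))) (m≤m+n _ _)
              one (inj₂ f) = ≤-trans (≤-reflexive (≡.sym (cong ind (from iz (st , (λ h → T≢F (from ie h) f) , x≢s , ≤-reflexive (≡.sym eq))))))
                               (≤-trans (m≤n+m _ (ind (w x))) (m≤n+m _ (ind (e x))))
            by-D x≢s 3 eq = ≤-trans (≤-reflexive (cong (λ b → 3 + (ind b + 0)) (not-inner eq)))
              (s≤s (+-mono-≤ (≤-reflexive (≡.sym (cong ind (from ie (proj₁ (full-end full)))))) (≤-trans (≤-reflexive (≡.sym (cong ind (from iw full)))) (m≤m+n _ _))))
              where
              full : Full x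
              full = st , x≢s , ≤-reflexive (≡.sym eq)
            by-D x≢s (suc (suc (suc (suc j)))) eq = ⊥-elim (<⇒≱ (subst (3 <_) (≡.sym eq) (s≤s (s≤s (s≤s (s≤s z≤n))))) D≤3)

        record Detached (w a : V) : Set where
          constructor detached
          field
            {t p} : V
            end   : StemEnd T w
            spur  : Spur T s w t a
            a≢w   : a ≢ w
            deg-a : degree T a ≡ 2
            wp    : Edge T w p
            gsp   : Adj G s p
            ws    : side T w p s ≡ true
            wa    : side T w p a ≡ true
            wt    : side T w p t ≡ true
            ≁s    : ¬ Adj G s a

        Shadow : V → V → Set
        Shadow x a = OnStem T x × ¬ StemEnd T x × x ≢ s × Edge T x a × side T a x s ≡ true × ∃[ u ] (Leaf T u × side T x a u ≡ true × Adj G u x)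

        opaque
          -- If the end is not `Close`, then `s` does not see the vertex `a` of its spur. Hence `a`
          -- is not the end itself, has degree two, and sees no leaf by `spur-leaf`.
          detach : ∀ {x} → Full x → ¬ Close few hub x → ∃[ a ] (Inner few hub a × Detached x a)
          detach {x} full nc with full-end full
          ... | end , gsx , p , xp , sp , joined with spur-of few hub end xp sp
          ...   | t , a , spur , rest = a , inner (proj₁ (rest a≢x)) (proj₂ (rest a≢x))
            where
            ≁a : ¬ Adj G s a
            ≁a g = nc (end , gsx , t , a , spur , g)
            a≢x : a ≢ x
            a≢x refl = ≁a gsx
            inner : degree T a ≡ 2 → side T x p a ≡ true × side T x p t ≡ true × p ≢ s → Inner few hub a × Detached x a
            inner two (wa , wt , p≢s) =
              ( spur-stem few hub end spur a≢x two xp (joined p≢s) sp wa wt , (λ { (br , _) → two-¬Br T two br }) , (λ { refl → two-¬Br T two brs })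
              , (λ lu g → spur-leaf few hub end spur a≢x two xp (joined p≢s) sp wa wt lu (gsym g)) , ≁a )
              , detached end spur a≢x two xp (joined p≢s) sp wa wt ≁a

          shadow : ∀ {x} → Double x → ∃[ a ] (Inner few hub a × Shadow x a)
          shadow d@(st , ne , x≢s , _) with double-leaf d
          ... | gsx , u , lu , gux with inner-shadow few hub noins st ne x≢s gsx lu gux
          ...   | a , xa , su , sr , inner = a , inner , st , ne , x≢s , xa , sr , u , lu , su , gux

          detached-unique : ∀ {w w′ a} → Detached w a → Detached w′ a → w ≡ w′
          detached-unique (detached _ sp _ _ _ _ _ _ _ _) (detached _ sp′ _ _ _ _ _ _ _ _)
            with next-unique T (esym T (Spur.ta sp)) (esym T (Spur.ta sp′)) (side-rev-T T (Spur.ta sp) (Spur.s∉ sp)) (side-rev-T T (Spur.ta sp′) (Spur.s∉ sp′))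
          ... | refl = Spur.sole sp′ (Spur.brw sp) (Spur.in-w sp)

          -- In both assignments the payer `a` is followed, on the way to `s`, by a determined
          -- vertex. So `x` would be the attachment vertex of the spur, which by `spur-top-leaf`
          -- sees no leaf beyond `a`.
          detached-shadow : ∀ {w x a} → Detached w a → Shadow x a → ⊥
          detached-shadow (detached end sp a≢w two wp gsp ws wa wt _) (st , ne , x≢s , xa , sr , u , lu , su , gux)
            with next-unique T (esym T (Spur.ta sp)) (esym T xa) (side-rev-T T (Spur.ta sp) (Spur.s∉ sp)) sr
          ... | refl = spur-top-leaf few hub end sp a≢w two wp gsp ws wa wt st (λ { refl → ne end }) lu su
                         (λ { (y , ba , ty) → ¬bare-branchy T ba (inner-branchy few hub st ne x≢s ty) }) (gsym gux)

          -- Each overspending vertex that is not `Close` is sent to an `Inner` vertex: a full end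
          -- to the far end of its spur, a double vertex to its neighbour towards the leaf that it
          -- sees.
          charge : ∀ {g w z c : V → Bool} → Indicates (Inner few hub) g → Indicates Full w → Indicates Double z → Indicates (Close few hub) c →
            cnt (λ v → w v ∧ not (c v)) + cnt z ≤ cnt g
          charge {g} {w} {z} {c} ig iw iz ic = ≤-trans (≤-trans (≤-reflexive (trans (cong₂ _+_ (cnt-sum _) (cnt-sum z)) (≡.sym (∑-distrib-+ _ (ind ∘ z)))))
              (≤-trans (sum-mono λ v → disjointly (w v ∧ not (c v)) (z v) (λ h h′ → proj₁ (proj₂ (to iz h′)) (proj₁ (full-end (to iw (∧-T₁ h)))))) (≤-reflexive (≡.sym (cnt-sum wz)))))
              (cnt-inj (λ x a → Detached x a ⊎ Shadow x a) target unique)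
            where
            wz : V → Bool
            wz v = (w v ∧ not (c v)) ∨ z v
            disjointly : ∀ a b → (a ≡ true → b ≡ true → ⊥) → ind a + ind b ≤ ind (a ∨ b)
            disjointly true  true  h = ⊥-elim (h refl refl)
            disjointly true  false h = ≤-refl
            disjointly false b     h = ≤-refl
            target : ∀ {x} → wz x ≡ true → ¬ ¬ (∃[ a ] (g a ≡ true × (Detached x a ⊎ Shadow x a)))
            target {x} h none with ∨-elim {w x ∧ not (c x)} h
            ... | inj₁ h′ = let (a , i , d) = detach (to iw (∧-T₁ h′)) (λ cl → T≢F (from ic cl) (not-T (∧-T₂ {w x} h′))) in none (a , from ig i , inj₁ d)
            ... | inj₂ h′ = let (a , i , d) = shadow (to iz h′) in none (a , from ig i , inj₂ d)
            unique : ∀ {x x′ a} → wz x ≡ true → wz x′ ≡ true → Detached x a ⊎ Shadow x a → Detached x′ a ⊎ Shadow x′ a → x ≡ x′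
            unique _ _ (inj₁ d) (inj₁ d′) = detached-unique d d′
            unique _ _ (inj₁ d) (inj₂ h) = ⊥-elim (detached-shadow d h)
            unique _ _ (inj₂ h) (inj₁ d) = ⊥-elim (detached-shadow d h)
            unique _ _ (inj₂ (_ , _ , _ , xa , sr , _)) (inj₂ (_ , _ , _ , xa′ , sr′ , _)) = next-unique T (esym T xa) (esym T xa′) sr sr′

          close≤2 : ∀ {w c : V → Bool} → Indicates (Close few hub) c → cnt (λ v → w v ∧ c v) ≤ 2
          close≤2 {w} {c} ic with cnt (λ v → w v ∧ c v) ≤? 2
          ... | yes p = p
          ... | no ¬p with cnt-pick3 (λ v → w v ∧ c v) (≰⇒> ¬p)
          ...   | x , y , z , px , py , pz , xy , xz , yz =
            ⊥-elim (three-close few hub maxdeg xy xz yz (to ic (∧-T₂ {w x} px)) (to ic (∧-T₂ {w y} py)) (to ic (∧-T₂ {w z} pz)))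

      opaque
        -- The stem spends its size, `k + 1` for the stem ends and at most two unpaid units, and it
        -- gets one unit back at `s`. With the saving of `2k + 2` on the limbs, the degree sum is at
        -- most `n + (k + 1) + 2 - 1 - (2k + 2)`, which is `n - k`.
        tight : ¬ SigmaAtLeast G (3 + (k + k)) (n + 1) k
        tight σ = indicator (Twig T) λ { (tw , itw) → indicator (Inner few hub) λ { (g , ig) → indicator (StemEnd T) λ { (e , ie) →
          indicator Full λ { (w , iw) → indicator Double λ { (z , iz) → indicator (Close few hub) λ { (c , ic) →
            let
              stem-sum : sum (off itw) + (cnt g + 1) ≤ cnt (not ∘ tw) + (cnt e + (cnt w + cnt z))
              stem-sum = begin
                sum (off itw) + (cnt g + 1)
                  ≡⟨ cong (sum (off itw) +_) (cong₂ _+_ (cnt-sum g) (≡.sym (sum-δ s))) ⟩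
                sum (off itw) + (sum (ind ∘ g) + sum (λ x → δ x s))
                  ≡⟨ sum3 itw (off itw) (ind ∘ g) (λ x → δ x s) ⟨
                sum (λ x → off itw x + (ind (g x) + δ x s))
                  ≤⟨ sum-mono (per-stem itw ig ie iw iz) ⟩
                sum (λ x → ind (not (tw x)) + (ind (e x) + (ind (w x) + ind (z x))))
                  ≡⟨ sum3 itw (ind ∘ not ∘ tw) (ind ∘ e) (λ x → ind (w x) + ind (z x)) ⟩
                sum (ind ∘ not ∘ tw) + (sum (ind ∘ e) + sum (λ x → ind (w x) + ind (z x)))
                  ≡⟨ cong₂ (λ i j → i + (j + sum (λ x → ind (w x) + ind (z x)))) (≡.sym (cnt-sum (not ∘ tw))) (≡.sym (cnt-sum e)) ⟩
                cnt (not ∘ tw) + (cnt e + sum (λ x → ind (w x) + ind (z x)))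
                  ≡⟨ cong (λ i → cnt (not ∘ tw) + (cnt e + i)) (trans (∑-distrib-+ (ind ∘ w) (ind ∘ z)) (≡.sym (cong₂ _+_ (cnt-sum w) (cnt-sum z)))) ⟩
                cnt (not ∘ tw) + (cnt e + (cnt w + cnt z)) ∎
              few-double : cnt w + cnt z ≤ 2 + cnt g
              few-double = begin
                cnt w + cnt z                                                     ≡⟨ cong (_+ cnt z) (cnt-split w c) ⟩
                cnt (λ v → w v ∧ c v) + cnt (λ v → w v ∧ not (c v)) + cnt z       ≡⟨ +-assoc (cnt (λ v → w v ∧ c v)) _ _ ⟩
                cnt (λ v → w v ∧ c v) + (cnt (λ v → w v ∧ not (c v)) + cnt z)     ≤⟨ +-mono-≤ (close≤2 {w} ic) (charge ig iw iz ic) ⟩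
                2 + cnt g                                                         ∎
            in arith (sum D) (ℓ T) (cnt tw) (cnt (not ∘ tw)) (sum (off itw)) (cnt g) (cnt e) (cnt w + cnt z)
                 (twig-sum itw) stem-sum few-double (ends≤ ie few) (cnt-not tw) (leaves-bound T) (sigma-hits G σ S size independent) } } } } } }
          where
          open ≤-Reasoning
          stem-¬twig : ∀ {x} → OnStem T x → ¬ Twig T x
          stem-¬twig st (d , dx , ba) = ¬bare-branchy T ba (st dx)
          per-stem : ∀ {tw g e w z} (itw : Indicates (Twig T) tw) → Indicates (Inner few hub) g → Indicates (StemEnd T) e → Indicates Full w → Indicates Double z →
            ∀ x → off itw x + (ind (g x) + δ x s) ≤ ind (not (tw x)) + (ind (e x) + (ind (w x) + ind (z x)))
          per-stem {tw} {g} itw ig ie iw iz x with twig-or-stem T x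
          ... | inj₁ t = ≤-trans (≤-reflexive (cong₂ _+_ (cong (λ b → weight (not b) (D x)) (from itw t))
                (cong₂ (λ a b → ind a + b) (¬T→F λ h → clash (proj₁ (to ig h))) (δ-diff {v = x} {s} λ { refl → clash (hub-stem few hub) })))) z≤n
            where
            clash : OnStem T x → ⊥
            clash st = stem-¬twig st t
          ... | inj₂ st = subst (λ b → weight (not b) (D x) + _ ≤ ind (not b) + _) (≡.sym not-twig) (at-stem ig ie iw iz st)
            where
            not-twig : tw x ≡ false
            not-twig = ¬T→F λ h → stem-¬twig st (to itw h)
          arith : ∀ Σ l a b o g e wz → Σ + l ≤ a + o → o + (g + 1) ≤ b + (e + wz) → wz ≤ 2 + g → e ≤ suc k → a + b ≡ n →
            2 + (k + k) ≤ l → n + 1 ≤ Σ + k → ⊥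
          arith Σ l a b o g e wz h₁ h₂ h₃ h₄ h₅ h₆ h₇ = <-irrefl refl (begin-strict
            n + 1 + (2 + (k + k)) + (g + 1)         ≤⟨ +-monoˡ-≤ (g + 1) (+-mono-≤ h₇ h₆) ⟩
            Σ + k + l + (g + 1)                     ≡⟨ l₁ Σ k l g ⟩
            (Σ + l) + (k + (g + 1))                 ≤⟨ +-monoˡ-≤ (k + (g + 1)) h₁ ⟩
            (a + o) + (k + (g + 1))                 ≡⟨ l₂ a o k g ⟩
            (a + k) + (o + (g + 1))                 ≤⟨ +-monoʳ-≤ (a + k) h₂ ⟩
            (a + k) + (b + (e + wz))                ≤⟨ +-monoʳ-≤ (a + k) (+-monoʳ-≤ b (+-mono-≤ h₄ h₃)) ⟩
            (a + k) + (b + (suc k + (2 + g)))       ≡⟨ l₃ a k b g ⟩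
            (a + b) + (k + k + (g + 3))             ≡⟨ cong (_+ (k + k + (g + 3))) h₅ ⟩
            n + (k + k + (g + 3))                   <⟨ ≤-reflexive (l₄ n k g) ⟩
            n + 1 + (2 + (k + k)) + (g + 1)         ∎)
            where
            l₁ : ∀ Σ k l g → Σ + k + l + (g + 1) ≡ (Σ + l) + (k + (g + 1))
            l₁ = solve-∀
            l₂ : ∀ a o k g → (a + o) + (k + (g + 1)) ≡ (a + k) + (o + (g + 1))
            l₂ = solve-∀
            l₃ : ∀ a k b g → (a + k) + (b + (suc k + (2 + g))) ≡ (a + b) + (k + k + (g + 3))
            l₃ = solve-∀
            l₄ : ∀ n k g → suc (n + (k + k + (g + 3))) ≡ n + 1 + (2 + (k + k)) + (g + 1)
            l₄ = solve-∀

  -- The choice of the tree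

  -- The stem itself is never computed. Any set `χ` of stem vertices is allowed, and the pair of
  -- tree and set is maximized by the size of `χ`.
  record Grown (Q : Tree → Set) : Set where
    constructor grown
    field
      T    : Tree
      q    : Q T
      χ    : V → Bool
      stem : ∀ {v} → χ v ≡ true → Stem T v

  maximal-stem : (Q : Tree → Set) → (∀ {T} → Q T → Min T) → (∀ {T u T′} → Q T → Leaf T u → Inserted T u T′ → Q T′) →
    ∀ T → Q T → ¬ ¬ (∃[ T ] (Q T × NoInsert T))
  maximal-stem Q min grow T₀ q₀ none =
    argmin {A = Grown Q} (λ g → n ∸ cnt (Grown.χ g)) (grown T₀ q₀ (λ _ → false) λ ()) λ { (g , best) → stuck g best }
    where
    stuck : (g : Grown Q) → (∀ g′ → n ∸ cnt (Grown.χ g) ≤ n ∸ cnt (Grown.χ g′)) → ⊥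
    stuck (grown T q χ stem) best = none (T , q , no-insertion {T} (min q) contra)
      where
      contra : ∀ {u T′} → Leaf T u → Inserted T u T′ → ⊥
      contra {u} {T′} lu I = <-irrefl refl (≤-trans (∸-monoʳ-< larger (cnt≤n χ′)) (best (grown T′ (grow q lu I) χ′ stem′)))
        where
        open Inserted I
        χ′ : V → Bool
        χ′ v = χ v ∨ does (v ≟ u)
        χ-u : ∀ {v} → χ v ≡ true → v ≢ u
        χ-u h refl = leaf-¬Stem {T} lu (stem h)
        larger : cnt χ < cnt χ′
        larger = ≤-trans (s≤s (cnt-mono λ v h → ∖-intro χ′ (∨-T₁ h) (χ-u h)))
                         (≤-reflexive (≡.sym (cnt-remove χ′ u (∨-T₂ {χ u} (dec-true (u ≟ u) refl)))))
        stem′ : ∀ {v} → χ′ v ≡ true → Stem T′ v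
        stem′ {v} h with ∨-elim {χ v} h
        ... | inj₂ e with does⇒ (v ≟ u) e
        ...   | refl = inj₂ gains
        stem′ {v} h | inj₁ h′ with stem h′
        ... | inj₁ br = inj₁ (subst (3 ≤_) (≡.sym (deg-br br)) br)
        ... | inj₂ sp = inj₂ (keeps sp (χ-u h′))

  -- Existence of a spanning tree

  module _ (connected : Connected G) where

    record Connecting : Set where
      field
        e    : V → V → Bool
        csym : ∀ u v → e u v ≡ e v u
        cirr : ∀ v → e v v ≡ false
        csub : ∀ u v → e u v ≡ true → Adj G u v
        cconn : ∀ (f : V → Bool) → (∀ x y → e x y ≡ true → f x ≡ f y) → ∀ x y → f x ≡ f y

    walk-const : (f : V → Bool) → (∀ x y → Adj G x y → f x ≡ f y) → ∀ {u v vs} → Walk G u v vs → f u ≡ f v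
    walk-const f h (here u)   = refl
    walk-const f h (step e w) = trans (h _ _ e) (walk-const f h w)

    whole : Connecting
    whole = record { e = adj G ; csym = Graph.sym G ; cirr = Graph.irrefl G ; csub = λ _ _ h → h
                   ; cconn = λ f h x y → walk-const f h (proj₂ (connected x y)) }

    -- Without a cut at `c d`, a function constant along the remaining edges cannot separate `c`
    -- from `d`. So it is constant along `c d` too, and connectedness persists.
    delete : (C : Connecting) → ∀ {c d} → Connecting.e C c d ≡ true → ¬ (∃[ f ] IsCut (Connecting.e C) c d f) →
      ∃[ C′ ] (sum (λ u → cnt (Connecting.e C′ u)) < sum (λ u → cnt (Connecting.e C u)))
    delete C {c} {d} cd nocut = C′ , fewer
      where
      open Connecting C
      e′ : V → V → Bool
      e′ u v = e u v ∧ not (does (same? u v c d))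
      keep : ∀ {u v} → e u v ≡ true → ¬ Same u v c d → e′ u v ≡ true
      keep {u} {v} h ns = ∧-T h (cong not (dec-false (same? u v c d) ns))
      same-cong : ∀ u v → does (same? u v c d) ≡ does (same? v u c d)
      same-cong u v with bool (does (same? u v c d)) | bool (does (same? v u c d))
      ... | inj₁ p | inj₁ q = trans p (≡.sym q)
      ... | inj₂ p | inj₂ q = trans p (≡.sym q)
      ... | inj₁ p | inj₂ q = ⊥-elim (T≢F (dec-true (same? v u c d) (Same-sym (does⇒ (same? u v c d) p))) q)
      ... | inj₂ p | inj₁ q = ⊥-elim (T≢F (dec-true (same? u v c d) (Same-sym (does⇒ (same? v u c d) q))) p)
      cconn′ : ∀ (f : V → Bool) → (∀ x y → e′ x y ≡ true → f x ≡ f y) → ∀ x y → f x ≡ f y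
      cconn′ f h with bool (f c) | bool (f d)
      ... | inj₁ p | inj₁ q = cconn f λ x y k → across x y k (same? x y c d)
        where
        across : ∀ x y → e x y ≡ true → Dec (Same x y c d) → f x ≡ f y
        across x y k (yes (inj₁ (refl , refl))) = trans p (≡.sym q)
        across x y k (yes (inj₂ (refl , refl))) = trans q (≡.sym p)
        across x y k (no ns) = h x y (keep k ns)
      ... | inj₂ p | inj₂ q = cconn f λ x y k → across x y k (same? x y c d)
        where
        across : ∀ x y → e x y ≡ true → Dec (Same x y c d) → f x ≡ f y
        across x y k (yes (inj₁ (refl , refl))) = trans p (≡.sym q)
        across x y k (yes (inj₂ (refl , refl))) = trans q (≡.sym p)
        across x y k (no ns) = h x y (keep k ns)
      ... | inj₂ p | inj₁ q = ⊥-elim (nocut (f , record { lo = p ; hi = q ; flat = λ k ns → h _ _ (keep k ns) }))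
      ... | inj₁ p | inj₂ q = ⊥-elim (nocut (not ∘ f , record { lo = cong not p ; hi = cong not q ; flat = λ k ns → cong not (h _ _ (keep k ns)) }))
      C′ : Connecting
      C′ = record { e = e′ ; csym = λ u v → cong₂ _∧_ (csym u v) (cong not (same-cong u v))
                  ; cirr = λ v → ¬T→F λ h → T≢F (∧-T₁ h) (cirr v) ; csub = λ u v h → csub u v (∧-T₁ h) ; cconn = cconn′ }
      fewer : sum (λ u → cnt (e′ u)) < sum (λ u → cnt (e u))
      fewer = begin
        suc (sum (λ u → cnt (e′ u)))                ≡⟨ cong (_+ sum (λ u → cnt (e′ u))) (sum-δ c) ⟨
        sum (λ u → δ u c) + sum (λ u → cnt (e′ u))  ≡⟨ ∑-distrib-+ (λ u → δ u c) (λ u → cnt (e′ u)) ⟨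
        sum (λ u → δ u c + cnt (e′ u))              ≤⟨ sum-mono (λ u → row u (u ≟ c)) ⟩
        sum (λ u → cnt (e u))                       ∎
        where
        open ≤-Reasoning
        row : ∀ u → Dec (u ≡ c) → δ u c + cnt (e′ u) ≤ cnt (e u)
        row u (no ne) = subst (λ j → j + cnt (e′ u) ≤ cnt (e u)) (≡.sym (δ-diff ne)) (cnt-mono λ v → ∧-T₁)
        row u (yes refl) = subst (λ j → j + cnt (e′ u) ≤ cnt (e u)) (≡.sym (δ-same u))
          (≤-trans (s≤s (cnt-mono λ v h → ∖-intro (e u) (∧-T₁ h) (λ { refl →
              T≢F (dec-true (same? u d u d) (inj₁ (refl , refl))) (not-T (∧-T₂ {e u d} h)) })))
            (≤-reflexive (≡.sym (cnt-remove (e u) d cd))))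

    -- In a connected spanning subgraph with the fewest edges every edge is a bridge.
    spanning-tree : ¬ ¬ Tree
    spanning-tree none = argmin (λ C → sum (λ u → cnt (Connecting.e C u))) whole λ { (C , best) →
      ¬¬-All (λ c → ¬¬-All λ d → cut C best c d) λ cuts → none (tree C cuts) }
      where
      tree : (C : Connecting) → (∀ c d → Connecting.e C c d ≡ true → ∃[ f ] IsCut (Connecting.e C) c d f) → Tree
      tree C cuts = proj₁ (mkTree e csym cirr csub cuts cconn)
        where open Connecting C
      cut : ∀ C → (∀ C′ → sum (λ u → cnt (Connecting.e C u)) ≤ sum (λ u → cnt (Connecting.e C′ u))) → ∀ c d →
        ¬ ¬ (Connecting.e C c d ≡ true → ∃[ f ] IsCut (Connecting.e C) c d f)
      cut C best c d no′ = no′ λ cd → ⊥-elim (no-cut cd λ k → no′ λ _ → k)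
        where
        no-cut : Connecting.e C c d ≡ true → ¬ ¬ (∃[ f ] IsCut (Connecting.e C) c d f)
        no-cut cd nc = let (C′ , fewer) = delete C cd nc in <⇒≱ fewer (best C′)

  -- The contradiction in the two cases

  module _ (connected : Connected G) (free : K14Free G) (k : ℕ) (3≤k : 3 ≤ k) (σ : SigmaAtLeast G (3 + (k + k)) (n + 1) k)
    (noGood : ∀ T (χ : V → Bool) → (∀ w → StemEnd T w → χ w ≡ true) → cnt χ ≤ k → ⊥) where
    open TightTrees free k 3≤k noGood

    private
      a-leaf : ∀ T → ∃[ u ] Leaf T u
      a-leaf T with cnt-pick (leaf? T) (≤-trans (s≤s z≤n) (leaves-bound T))
      ... | u , h = u , T-leaf T h

      -- The first branch vertex `t` met on the way from a stem end `w` is a hub: among the branch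
      -- vertices only `w` lies in its direction, so `t` separates `w` from some further stem end
      -- `c`.
      a-hub : ∀ T → ¬ ¬ (∃[ s ] Hub T s)
      a-hub T none with a-leaf T
      ... | u , _ = avoid-three T u u u λ { (w , (brw , p , wp , ba) , _) → from-end wp ba brw (twoBr T w) }
        where
        from-end : ∀ {w p} → Edge T w p → (∀ {y} → Edge T w y → y ≢ p → Bare T (side T w y)) → Br T w → ∃[ b ] (Br T b × b ≢ w) → ⊥
        from-end {w} {p} wp ba brw (b , brb , b≢w) with climb T (esym T wp) brb (outside brb b≢w)
          where
          outside : ∀ {c} → Br T c → c ≢ w → side T p w c ≡ false
          outside br c≢w with next T (c≢w ∘ ≡.sym)
          ... | y , wy , sy with y ≟ p
          ...   | yes refl = side-rev-F T wy sy
          ...   | no y≢p = ⊥-elim (T≢F sy (ba wy y≢p br))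
        ... | climbed {t} {a} ta brt ⊆ ⊇ = avoid-three T w t t λ { (c , (brc , _) , c≢w , c≢t , _) →
            none (t , brt , splits (flat-side T ta) brw brc w≢t c≢t w∈ (¬T→F λ h → [ inside brc c≢w , (λ two → two-¬Br T two brc) ]′ (⊇ h))) }
          where
          w∈ : side T t a w ≡ true
          w∈ = ⊆ (shi T (esym T wp))
          w≢t : w ≢ t
          w≢t refl = T≢F w∈ (slo T ta)
          inside : ∀ {c} → Br T c → c ≢ w → ¬ (side T p w c ≡ true)
          inside br c≢w s with next T (c≢w ∘ ≡.sym)
          ... | y , wy , sy with y ≟ p
          ...   | yes refl = T≢F s (side-rev-F T wy sy)
          ...   | no y≢p = T≢F sy (ba wy y≢p br)

    -- The hub is chosen with the largest degree over all trees with `2k + 2` leaves before the stem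
    -- is enlarged. Insertions keep the degrees of branch vertices, so this choice survives them.
    few-leaves-case : ∀ T → Few T → ⊥
    few-leaves-case T few = a-hub T λ { (s , hub) →
      argmin {A = ∃[ T ] ∃[ s ] (Few T × Hub T s)} (λ { (T , s , _) → n ∸ degree T s }) (T , s , few , hub) λ { ((T₁ , s₁ , few₁ , hub₁) , best) →
      maximal-stem (λ T → Few T × Hub T s₁ × degree T s₁ ≡ degree T₁ s₁) (few-min ∘ proj₁)
        (λ {T} (f , (br , sp) , eq) lu I →
          ≤-trans (Inserted.ℓ≤ I) f
          , (subst (3 ≤_) (≡.sym (Inserted.deg-br I br)) br , Inserted.keeps I sp (λ { refl → leaf-¬Br T lu br }))
          , trans (Inserted.deg-br I br) eq)
        T₁ (few₁ , hub₁ , refl) λ { (T₂ , (few₂ , hub₂ , eq) , noins) →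
      tight few₂ noins hub₂ (λ {T′} {s′} f h → ≤-trans (max (cnt≤n (edge T′ s′)) (best (T′ , s′ , f , h))) (≤-reflexive (≡.sym eq))) σ } } }
      where
      max : ∀ {i j} → i ≤ n → n ∸ j ≤ n ∸ i → i ≤ j
      max {i} {j} i≤n h with i ≤? j
      ... | yes p = p
      ... | no ¬p = ⊥-elim (<⇒≱ (∸-monoʳ-< (≰⇒> ¬p) i≤n) h)

    many-leaves-case : ∀ T → Min T → 3 + (k + k) ≤ ℓ T → ⊥
    many-leaves-case T min many = maximal-stem Min id (λ _ _ I → Inserted.min′ I) T min λ { (T₁ , min₁ , noins) →
        go min₁ noins (subset-of-size (leaf? T₁) (3 + (k + k)) (≤-trans many (min T₁))) (twoBr T₁ (proj₁ (a-leaf T₁))) }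
      where
      go : ∀ {T} → Min T → NoInsert T → ∃[ S ] ((∀ v → S v ≡ true → leaf? T v ≡ true) × cnt S ≡ 3 + (k + k)) → ∃[ b ] (Br T b × _) → ⊥
      go {T} min noins (S , sub , size) (r , brr , _) = arith (sum (hits G S)) (ℓ T)
          -- Here `2k + 3` is `2m + 1` with `m = k + 1`, so the degree sum is at most
          -- `n + (k + 1) - (2k + 3)`, which is `n - k - 2`.
          (many-leaves min noins brr {suc k} S (λ h → T-leaf T (sub _ h)) (≤-reflexive (trans size (cong (λ j → suc (suc j)) (≡.sym (+-suc k k))))))
          (≤-trans (≤-reflexive (≡.sym size)) (cnt-mono sub))
          (sigma-hits G σ S size λ hu hv g → leaves-independent min (T-leaf T (sub _ hu)) (T-leaf T (sub _ hv)) (girr g) g)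
        where
        arith : ∀ Σ l → Σ + l ≤ n + suc k → 3 + (k + k) ≤ l → n + 1 ≤ Σ + k → ⊥
        arith Σ l h₁ h₂ h₃ = <-irrefl refl (begin-strict
          n + 1 + (3 + (k + k))   ≤⟨ +-mono-≤ h₃ h₂ ⟩
          Σ + k + l               ≡⟨ l₁ Σ k l ⟩
          Σ + l + k               ≤⟨ +-monoˡ-≤ k h₁ ⟩
          n + suc k + k           <⟨ ≤-trans (m≤m+n _ 2) (≤-reflexive (l₂ n k)) ⟩
          n + 1 + (3 + (k + k))   ∎)
          where
          open ≤-Reasoning
          l₁ : ∀ Σ k l → Σ + k + l ≡ Σ + l + k
          l₁ = solve-∀
          l₂ : ∀ n k → suc (n + suc k + k) + 2 ≡ n + 1 + (3 + (k + k))
          l₂ = solve-∀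

    contradictory : ⊥
    contradictory = spanning-tree connected λ T₀ → argmin ℓ T₀ λ { (T , min) → by-leaves T min (ℓ T ≤? 2 + (k + k)) }
      where
      by-leaves : ∀ T → Min T → Dec (ℓ T ≤ 2 + (k + k)) → ⊥
      by-leaves T min (yes few) = few-leaves-case T few
      by-leaves T min (no many) = many-leaves-case T min (≰⇒> many)

  -- The argument so far is classical. The tree itself is found by exhaustive search.
  Searchable : Set → Set₁
  Searchable A = {P : A → Set} → (∀ x → Dec (P x)) → Dec (∃ P)

  search-bool : Searchable Bool
  search-bool d with d true | d false
  ... | yes p | _     = yes (true , p)
  ... | no _  | yes q = yes (false , q)
  ... | no p  | no q  = no λ { (true , h) → p h ; (false , h) → q h }

  search-vec : ∀ {A} → Searchable A → ∀ m → Searchable (Vec A m)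
  search-vec s zero d = map′ ([] ,_) (λ { ([] , h) → h }) (d [])
  search-vec s (suc m) d = map′ (λ { (x , xs , h) → x ∷ xs , h }) (λ { (x ∷ xs , h) → x , xs , h }) (s λ x → search-vec s m λ xs → d (x ∷ xs))

  search-all : ∀ {A} → Searchable A → {P : A → Set} → (∀ x → Dec (P x)) → Dec (∀ x → P x)
  search-all s d with s (λ x → ¬? (d x))
  ... | yes (x , h) = no λ all → h (all x)
  ... | no none = yes λ x → decidable-stable (d x) λ h → none (x , h)

  isCut? : ∀ e c d f → Dec (IsCut e c d f)
  isCut? e c d f = map′ (λ { (p , q , r) → record { lo = p ; hi = q ; flat = λ {x} {y} → r x y } })
      (λ r → lo r , hi r , λ x y → flat r)
      ((f c ≟ᵇ false) ×-dec (f d ≟ᵇ true) ×-dec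
        all? λ x → all? λ y → (e x y ≟ᵇ true) →-dec (¬? (same? x y c d) →-dec (f x ≟ᵇ f y)))

  -- The law `conn` quantifies over functions on the vertices; the search runs over their tables.
  laws? : ∀ e s → Dec (Laws e s)
  laws? e s = map′
    (λ { (a , b , c , d , h) → record { esym = a ; eirr = b ; esub = c ; iscut = d ; conn = λ f k x y →
           trans (≡.sym (lookup∘tabulate f x)) (trans (h (tabulate f) (λ x y e → trans (lookup∘tabulate f x) (trans (k x y e) (≡.sym (lookup∘tabulate f y)))) x y)
             (lookup∘tabulate f y)) } })
    (λ l → Laws.esym l , Laws.eirr l , Laws.esub l , Laws.iscut l , λ f → Laws.conn l (lookup f))
    ((all? λ u → all? λ v → e u v ≟ᵇ e v u) ×-dec (all? λ v → e v v ≟ᵇ false) ×-dec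
     (all? λ u → all? λ v → (e u v ≟ᵇ true) →-dec (adj G u v ≟ᵇ true)) ×-dec
     (all? λ c → all? λ d → (e c d ≟ᵇ true) →-dec isCut? e c d (s c d)) ×-dec
     search-all (search-vec search-bool n) λ f →
       (all? λ x → all? λ y → (e x y ≟ᵇ true) →-dec (lookup f x ≟ᵇ lookup f y)) →-dec (all? λ x → all? λ y → lookup f x ≟ᵇ lookup f y))

  Good : ℕ → Set
  Good k = ∃[ T ] ∃[ χ ] ((∀ w → StemEnd T w → lookup χ w ≡ true) × cnt (lookup χ) ≤ k)

  stemEnd? : ∀ T w → Dec (StemEnd T w)
  stemEnd? T w = (3 ≤? degree T w) ×-dec any? λ p → (edge T w p ≟ᵇ true) ×-dec
    map′ (λ h {y} e ne {b} br → h y e ne b br) (λ h y e ne b br → h e ne br)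
      (all? λ y → (edge T w y ≟ᵇ true) →-dec (¬? (y ≟ p) →-dec all? λ b → (3 ≤? degree T b) →-dec (side T w y b ≟ᵇ false)))

  opaque
    unfolding edge

    good? : ∀ k → Dec (Good k)
    good? k = map′
      (λ { (R , C , l , χ , h) → record { rows = R ; cuts = C ; laws = l } , χ , h })
      (λ { (T , χ , h) → rows T , cuts T , laws T , χ , h })
      (search-vec (search-vec search-bool n) n λ R → search-vec (search-vec (search-vec search-bool n) n) n λ C → with-laws R C (laws? _ _))
      where
      with-laws : ∀ R C → Dec (Laws (λ u v → lookup (lookup R u) v) (λ c d v → lookup (lookup (lookup C c) d) v)) →
        Dec (Σ (Laws (λ u v → lookup (lookup R u) v) (λ c d v → lookup (lookup (lookup C c) d) v)) λ l → ∃[ χ ]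
          ((∀ w → StemEnd (record { rows = R ; cuts = C ; laws = l }) w → lookup χ w ≡ true) × cnt (lookup χ) ≤ k))
      with-laws R C (no nl) = no (nl ∘ proj₁)
      -- `StemEnd` depends only on the rows and the cuts, so one proof of the laws stands for all of
      -- them.
      with-laws R C (yes l) = map′ (l ,_) (λ { (_ , h) → h }) (search-vec search-bool n λ χ →
        (all? λ w → stemEnd? (record { rows = R ; cuts = C ; laws = l }) w →-dec (lookup χ w ≟ᵇ true)) ×-dec (cnt (lookup χ) ≤? k))

  good-tree : Connected G → K14Free G → ∀ k → 3 ≤ k → SigmaAtLeast G (3 + (k + k)) (n + 1) k → Good k
  good-tree con free k 3≤k σ = decidable-stable (good? k) λ none → contradictory con free k 3≤k σ λ T χ ends few →
    none (T , tabulate χ , (λ w h → trans (lookup∘tabulate χ w) (ends w h)) , subst (_≤ k) (cnt-cong (λ v → ≡.sym (lookup∘tabulate χ v))) few)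

  -- From trees given by cuts to trees given by walks

  module _ (T : Tree) where

    graph : Graph n
    graph = record { adj = edge T ; sym = esymT T ; irrefl = eirrT T }

    private
      Tg = graph

    -- The set `χ` of vertices with a known walk to `v` grows along an edge that leaves it. When no
    -- edge leaves it, `χ` is constant by connectedness, hence full.
    reach : ∀ v u → ∃[ vs ] Walk Tg u v vs
    reach v = go (cnt (not ∘ at-v)) at-v (λ {u} h → subst (λ u → ∃[ vs ] Walk Tg u v vs) (≡.sym (does⇒ (u ≟ v) h)) (v ∷ [] , here v))
                (dec-true (v ≟ v) refl) ≤-refl
      where
      at-v : V → Bool
      at-v u = does (u ≟ v)
      go : ∀ j (χ : V → Bool) → (∀ {u} → χ u ≡ true → ∃[ vs ] Walk Tg u v vs) → χ v ≡ true → cnt (not ∘ χ) ≤ j → ∀ u → ∃[ vs ] Walk Tg u v vs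
      go j χ walk χv le u with any? (λ x → any? λ y → (χ x ≟ᵇ true) ×-dec ((edge T y x ≟ᵇ true) ×-dec (χ y ≟ᵇ false)))
      ... | no closed = walk (trans (conn T χ (λ {x} {y} e → same x y e (bool (χ x)) (bool (χ y))) u v) χv)
        where
        same : ∀ x y → Edge T x y → (χ x ≡ true ⊎ χ x ≡ false) → (χ y ≡ true ⊎ χ y ≡ false) → χ x ≡ χ y
        same x y e (inj₁ p) (inj₁ q) = trans p (≡.sym q)
        same x y e (inj₂ p) (inj₂ q) = trans p (≡.sym q)
        same x y e (inj₁ p) (inj₂ q) = ⊥-elim (closed (x , y , p , esym T e , q))
        same x y e (inj₂ p) (inj₁ q) = ⊥-elim (closed (y , x , q , e , p))
      go zero χ walk χv le u | yes (x , y , _ , _ , χy) = ⊥-elim (<-irrefl refl (≤-trans (cnt≥1 (not ∘ χ) (cong not χy)) le))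
      go (suc j) χ walk χv le u | yes (x , y , χx , e , χy) = go j χ′ walk′ (∨-T₁ χv) smaller u
        where
        χ′ : V → Bool
        χ′ w = χ w ∨ does (w ≟ y)
        walk′ : ∀ {w} → χ′ w ≡ true → ∃[ vs ] Walk Tg w v vs
        walk′ {w} h with ∨-elim {χ w} h
        ... | inj₁ h′ = walk h′
        ... | inj₂ h′ with does⇒ (w ≟ y) h′
        ...   | refl = let (vs , p) = walk χx in w ∷ vs , step e p
        smaller : cnt (not ∘ χ′) ≤ j
        smaller = ≤-pred (≤-trans (s≤s (cnt-mono λ w h → ∖-intro (not ∘ χ) (cong not (¬T→F λ t → T≢F (∨-T₁ t) (not-T h)))
                      (λ { refl → T≢F (∨-T₂ {χ y} (dec-true (y ≟ y) refl)) (not-T h) })))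
                    (≤-trans (≤-reflexive (≡.sym (cnt-remove (not ∘ χ) y (cong not χy)))) le))

    first∈ : ∀ {u w vs} → Walk Tg u w vs → u ∈ vs
    first∈ (here u)   = here refl
    first∈ (step e p) = here refl

    last∈ : ∀ {u w vs} → Walk Tg u w vs → w ∈ vs
    last∈ (here u)   = here refl
    last∈ (step e p) = there (last∈ p)

    -- A path from `u` to `w` with at least three vertices avoids the edge `w u`. It would stay on
    -- one side of that edge, whose ends lie on different sides.
    acyclic : Acyclic Tg
    acyclic (u , w , _ , (here _ , _) , s≤s () , _)
    acyclic (u , w , _ , (step {v = v} uv p , u∉ ∷ un) , len , wu) = T≢F (trans (≡.sym (trans (flat cut uv ns) (const p u∉))) (shi T wu)) (slo T wu) 
      where
      cut = scut T wu
      v≢w : ∀ {vs} → Walk Tg v w vs → Unique vs → 2 ≤ length vs → v ≢ w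
      v≢w (here _) _ (s≤s ()) refl
      v≢w (step e q) (v∉ ∷ _) _ refl = All.lookup v∉ (last∈ q) refl
      ns : ¬ Same u v w u
      ns (inj₁ (p , _)) = eirr T wu (≡.sym p)
      ns (inj₂ (_ , q)) = v≢w p un (≤-pred len) q
      const : ∀ {a b vs} → Walk Tg a b vs → All (u ≢_) vs → side T w u a ≡ side T w u b
      const (here _) _ = refl
      const (step e q) (u≢a ∷ all) = trans (flat cut e (λ { (inj₁ (_ , r)) → All.lookup all (first∈ q) (≡.sym r) ; (inj₂ (r , _)) → u≢a (≡.sym r) })) (const q all)

    suffix : ∀ {a b u vs} → Path Tg a b vs → u ∈ vs → ∃[ ws ] Path Tg u b ws
    suffix (here _ , un) (here refl) = _ , here _ , un
    suffix (step e p , un) (here refl) = _ , step e p , un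
    suffix (step e p , _ ∷ un) (there u∈) = suffix (p , un) u∈

    path : ∀ {a b vs} → Walk Tg a b vs → ∃[ ws ] Path Tg a b ws
    path (here a) = a ∷ [] , here a , [] ∷ []
    path (step {u = a} e p) with path p
    ... | ws , q , un with DecMembership._∈?_ _≟_ a ws
    ...   | yes a∈ = suffix (q , un) a∈
    ...   | no a∉ = a ∷ ws , step e q , All.tabulate (λ {x} x∈ → λ { refl → a∉ x∈ }) ∷ un

    crosses : ∀ {a b c d vs} → Edge T c d → Walk Tg a b vs → side T c d a ≡ false → side T c d b ≡ true → d ∈ vs
    crosses cd (here _) f t = ⊥-elim (T≢F t f)
    crosses {c = c} {d} cd (step {v = x} e p) f t with bool (side T c d x)
    ... | inj₂ f′ = there (crosses cd p f′ t)
    ... | inj₁ t′ with crossing T (scut T cd) e f t′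
    ...   | _ , refl = there (first∈ p)

    record Between (v : V) (vs : List V) : Set where
      constructor between
      field
        {x y} : V
        vx    : Edge T v x
        vy    : Edge T v y
        x≢y   : x ≢ y
        x∈    : x ∈ vs
        y∈    : y ∈ vs

    interior : ∀ {a b v vs} → Walk Tg a b vs → Unique vs → v ∈ vs → v ≡ a ⊎ v ≡ b ⊎ Between v vs
    interior (here _) _ (here refl) = inj₁ refl
    interior (step e p) _ (here refl) = inj₁ refl
    interior {v = v} (step e p) (a∉ ∷ un) (there v∈) with interior p un v∈
    ... | inj₂ (inj₁ q) = inj₂ (inj₁ q)
    ... | inj₂ (inj₂ (between vx vy ne x∈ y∈)) = inj₂ (inj₂ (between vx vy ne (there x∈) (there y∈)))
    ... | inj₁ refl = second e p a∉
      where
      second : ∀ {a b vs} → Edge T a v → Walk Tg v b vs → All (a ≢_) vs → v ≡ a ⊎ v ≡ b ⊎ Between v (a ∷ vs)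
      second e (here _) _ = inj₂ (inj₁ refl)
      second e (step e′ q) (_ ∷ a≢) = inj₂ (inj₂ (between (esym T e) e′ (All.lookup a≢ (first∈ q)) (here refl) (there (there (first∈ q)))))

    branch : ∀ {v} → Branch Tg v → Br T v
    branch {v} = subst (3 ≤_) (deg-cnt Tg v)

    Br-branch : ∀ {v} → Br T v → Branch Tg v
    Br-branch {v} = subst (3 ≤_) (≡.sym (deg-cnt Tg v))

    -- An inner vertex of a path between branch vertices has two stem neighbours, so a stem leaf is
    -- an end of its path and hence a branch vertex. A branch vertex in a second direction would put
    -- a second neighbour on the stem.
    stem-leaf-end : ∀ {v} → StemLeaf Tg v → StemEnd T v
    stem-leaf-end {v} ((b₁ , b₂ , vs , br₁ , br₂ , (p , un) , v∈) , u , vu , _ , only) = brv , u , vu , bare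
      where
      on : ∀ {x} → x ∈ vs → InStem Tg x
      on x∈ = b₁ , b₂ , vs , br₁ , br₂ , (p , un) , x∈
      brv : Br T v
      brv with interior p un v∈
      ... | inj₁ refl = branch br₁
      ... | inj₂ (inj₁ refl) = branch br₂
      ... | inj₂ (inj₂ (between vx vy ne x∈ y∈)) = ⊥-elim (ne (trans (only _ vx (on x∈)) (≡.sym (only _ vy (on y∈)))))
      bare : ∀ {y} → Edge T v y → y ≢ u → Bare T (side T v y)
      bare {y} vy y≢u {b} brb = ¬T→F λ s → y≢u (only y vy (stem s))
        where
        stem : side T v y b ≡ true → InStem Tg y
        stem s with path (proj₂ (reach b v))
        ... | ws , q , un′ = v , b , ws , Br-branch brv , Br-branch brb , (q , un′) , crosses vy q (slo T vy) s

  stem-leaves : ∀ {k} → ((T , χ , _) : Good k) → IsSpanningTree (graph T) G × StemLeavesAtMost (graph T) k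
  stem-leaves (T , χ , ends , few) = (esubT T , (λ u v → reach T v u) , acyclic T)
    , elements (lookup χ) , ≤-trans (≤-reflexive (length-elements (lookup χ))) few , λ v h → ∈-elements (lookup χ) (ends v (stem-leaf-end T h))

theorem1p8 : ∀ (n : ℕ) (G : Graph n) (k : ℕ) → Connected G → K14Free G → 3 ≤ k →
    SigmaAtLeast G (2 * k + 3) (n + 1) k →
    ∃[ T ] (IsSpanningTree T G × StemLeavesAtMost T k)
theorem1p8 n G k connected free 3≤k σ = graph (proj₁ good) , stem-leaves good
  where
  open SpanningTrees G
  size : 2 * k + 3 ≡ 3 + (k + k)
  size = trans (+-comm (2 * k) 3) (cong (λ j → 3 + (k + j)) (+-identityʳ k))
  good : Good k
  good = good-tree connected free k 3≤k (subst (λ p → SigmaAtLeast G p (n + 1) k) size σ)
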